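{- Let $n=2^{s}$ and $q=2^{r}$ with $s,r$ positive integers, and let $N=q^{\binom{n}{2}}\prod_{j=2}^{n}(q^{j}-1)$ be the order of $SL(n,q)$. Let $\{C_i\}_{i=0}^{N}$ be the weight distribution of the binary code $C=C(SL(n,q))$ (defined in the context). Then for all positive integers $h$, $$q^{\binom{n}{2}h}MK_{n-1}^{h}=\sum_{i=0}^{h-1}(-1)^{h+i+1}\binom{h}{i}N^{h-i}q^{\binom{n}{2}i}MK_{n-1}^{i}+q\sum_{i=0}^{\min\{N,h\}}(-1)^{h+i}C_{i}\sum_{t=i}^{h}t!\,S(h,t)\,2^{h-t}\binom{N-i}{N-t}.$$ Moreover, for $0\le i\le N$, $$C_{i}=\sum\prod_{\beta\in\mathbb{F}_q}\binom{n_\beta}{\nu_\beta},$$ where the sum runs over all families of nonnegative integers $\{\nu_\beta\}_{\beta\in\mathbb{F}_q}$ with $\sum_{\beta}\nu_\beta=i$ and $\sum_\beta \nu_\beta\beta=0$ (an identity in $\mathbb{F}_q$), and $$n_\beta=|\{g\in SL(n,q): Tr(g)=\beta\}|=q^{\binom{n}{2}-1}\Big\{\prod_{j=2}^{n}(q^{j}-1)+1+q\,\theta(\beta)\Big\},\quad \theta(\beta)=\begin{cases}K_{n-2}(\lambda;\beta^{ -1}),&\beta\neq0,\\ 0,&\beta=0.\end{cases}$$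
   Context: $\mathbb{F}_q$ is the finite field with $q=2^r$ elements; $tr(x)=x+x^2+\cdots+x^{2^{r-1}}$ is the absolute trace $\mathbb{F}_q\to\mathbb{F}_2$ and $\lambda(x)=(-1)^{tr(x)}$ is the canonical additive character. For $m\ge1$ and $a\in\mathbb{F}_q^*$, the $m$-dimensional Kloosterman sum is $K_m(\lambda;a)=\sum_{\alpha_1,\dots,\alpha_m\in\mathbb{F}_q^*}\lambda(\alpha_1+\cdots+\alpha_m+a\alpha_1^{ -1}\cdots\alpha_m^{ -1})$, with the convention $K_0(\lambda;a)=\lambda(a)$. For $h\ge0$, $MK_m^h=\sum_{a\in\mathbb{F}_q^*}K_m(\lambda;a)^h$. $Tr(g)$ denotes the matrix trace. Fix an ordering $g_1,\dots,g_N$ of $SL(n,q)$ and let $v=(Tr(g_1),\dots,Tr(g_N))\in\mathbb{F}_q^N$; then $C(SL(n,q))=\{u\in\mathbb{F}_2^N: u\cdot v=0\}$ (dot product computed in $\mathbb{F}_q$), and $C_i$ is the number of codewords of Hamming weight $i$. $S(h,t)=\frac{1}{t!}\sum_{j=0}^{t}(-1)^{t-j}\binom{t}{j}j^h$ is the Stirling number of the second kind. Convention: $\binom{b}{a}=0$ if $b<a$. -}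

module Defs where

open import Level using (0ℓ)
open import Algebra.Bundles using (CommutativeRing)
import Data.Bool
open import Data.Bool using (Bool; true; false; if_then_else_; _∧_)
open import Data.Nat as ℕ using (ℕ; zero; suc; _∸_; _≤ᵇ_; _!)
open import Data.Nat.Properties using (_!≢0)
open import Data.Nat.Combinatorics using (_C_)
open import Data.Integer as ℤ using (ℤ; +_; -1ℤ; _/ℕ_)
open import Data.Fin using (Fin; punchIn; toℕ)
import Data.Fin as Fin
open import Data.Vec.Functional using (Vector) renaming (_∷_ to _∷ᵛ_)
open import Data.List using (List; []; _∷_; map; filterᵇ; concatMap; foldr; length; upTo; allFin; zipWith)
open import Data.List.Relation.Unary.Any using (Any)
open import Data.List.Relation.Unary.AllPairs using (AllPairs)
open import Relation.Nullary using (¬_; does)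
open import Relation.Binary using (Decidable)

record FiniteField : Set₁ where
  field
    commRing : CommutativeRing 0ℓ 0ℓ
  open CommutativeRing commRing public
  field
    _≟_      : Decidable _≈_
    _⁻¹      : Carrier → Carrier
    0≉1      : ¬ (0# ≈ 1#)
    ⁻¹-inv   : ∀ x → ¬ (x ≈ 0#) → (x * (x ⁻¹)) ≈ 1#
    elements : List Carrier
    complete : ∀ x → Any (x ≈_) elements
    distinct : AllPairs (λ x y → ¬ (x ≈ y)) elements

tuples : {A : Set} → ℕ → List A → List (List A)
tuples zero    xs = [] ∷ []
tuples (suc m) xs = concatMap (λ x → map (x ∷_) (tuples m xs)) xs

allFuns : {A : Set} → (n : ℕ) → List A → List (Vector A n)
allFuns zero    xs = (λ ()) ∷ []
allFuns (suc n) xs = concatMap (λ x → map (x ∷ᵛ_) (allFuns n xs)) xs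

count : {A : Set} → (A → Bool) → List A → ℕ
count p = foldr (λ x c → if p x then suc c else c) 0

sumℤ : List ℤ → ℤ
sumℤ = foldr ℤ._+_ (+ 0)

prodℤ : List ℤ → ℤ
prodℤ = foldr ℤ._*_ (+ 1)

sumℕ : List ℕ → ℕ
sumℕ = foldr ℕ._+_ 0

prodℕ : List ℕ → ℕ
prodℕ = foldr ℕ._*_ 1

-- [a, a+1, ..., b]  (empty if b < a)
fromTo : ℕ → ℕ → List ℕ
fromTo a b = map (a ℕ.+_) (upTo (suc b ∸ a))

-- Stirling numbers of the second kind, defined by the explicit formula
-- S(h,t) = (1/t!) Σ_{j=0}^{t} (-1)^{t-j} C(t,j) j^h   (exact division)
stirling2 : ℕ → ℕ → ℤ
stirling2 h t = (sumℤ (map (λ j → (-1ℤ ℤ.^ (t ∸ j)) ℤ.* (+ (t C j)) ℤ.* (+ (j ℕ.^ h))) (fromTo 0 t))) /ℕ (t !)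
  where instance _ = t !≢0

-- Everything over a fixed finite field F with |F| = 2^r

module OverField (F : FiniteField) (r : ℕ) where
  open FiniteField F

  q : ℕ
  q = length elements

  isZero : Carrier → Bool
  isZero x = does (x ≟ 0#)

  nonzeros : List Carrier
  nonzeros = filterᵇ (λ x → Data.Bool.not (isZero x)) elements

  pow : Carrier → ℕ → Carrier
  pow x zero    = 1#
  pow x (suc k) = x * pow x k

  sumF : List Carrier → Carrier
  sumF = foldr _+_ 0#

  prodF : List Carrier → Carrier
  prodF = foldr _*_ 1#

  natMul : ℕ → Carrier → Carrier
  natMul zero    x = 0#
  natMul (suc k) x = x + natMul k x

  tr : Carrier → Carrier
  tr x = sumF (map (λ k → pow x (2 ℕ.^ k)) (upTo r))

  -- canonical additive character λ(x) = (-1)^{tr(x)}  (tr(x) ∈ {0,1})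
  lam : Carrier → ℤ
  lam x = if isZero (tr x) then + 1 else -1ℤ

  K : ℕ → Carrier → ℤ
  K zero    a = lam a
  K (suc m) a = sumℤ (map (λ αs → lam (sumF αs + (a * (prodF αs ⁻¹)))) (tuples (suc m) nonzeros))

  MK : ℕ → ℕ → ℤ
  MK m h = sumℤ (map (λ a → K m a ℤ.^ h) nonzeros)

  Matrix : ℕ → Set
  Matrix n = Fin n → Fin n → Carrier

  sumFin : (n : ℕ) → (Fin n → Carrier) → Carrier
  sumFin n f = sumF (map f (allFin n))

  det : (n : ℕ) → Matrix n → Carrier
  det zero    A = 1#
  det (suc n) A = sumFin (suc n) (λ j →
      pow (- 1#) (toℕ j) * (A Fin.zero j * det n (λ i k → A (Fin.suc i) (punchIn j k))))

  Tr : (n : ℕ) → Matrix n → Carrier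
  Tr n A = sumFin n (λ i → A i i)

  SL : (n : ℕ) → List (Matrix n)
  SL n = filterᵇ (λ A → does (det n A ≟ 1#)) (allFuns n (allFuns n elements))

  module Code (n : ℕ) where

    N : ℕ
    N = length (SL n)

    -- all u ∈ F_2^N, as Boolean lists of length N (true = 1)
    binVecs : List (List Bool)
    binVecs = tuples N (true ∷ false ∷ [])

    weight : List Bool → ℕ
    weight = count (λ b → b)

    dot : List Bool → Carrier
    dot u = sumF (zipWith (λ b g → if b then Tr n g else 0#) u (SL n))

    Cw : ℕ → ℕ
    Cw i = count (λ u → (weight u ℕ.≡ᵇ i) ∧ isZero (dot u)) binVecs

    nβ : Carrier → ℕ
    nβ β = count (λ g → does (Tr n g ≟ β)) (SL n)

    θ : Carrier → ℤ
    θ β = if isZero β then + 0 else K (n ∸ 2) (β ⁻¹)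

    families : ℕ → List (List ℕ)
    families i = filterᵇ (λ ν → (sumℕ ν ℕ.≡ᵇ i) ∧ isZero (sumF (zipWith natMul ν elements)))
                         (tuples q (upTo (suc i)))

    CwFormula : ℕ → ℕ
    CwFormula i = sumℕ (map (λ ν → prodℕ (zipWith (λ β v → nβ β C v) elements ν)) (families i))

    -- the binomial C(N-i, N-t), which is 0 when N - t < 0 (i.e. t > N)
    binomNN : ℕ → ℕ → ℕ
    binomNN i t = if t ≤ᵇ N then (N ∸ i) C (N ∸ t) else 0

{-# OPTIONS --safe #-}
module Submission where

-- Orthogonality of the characters λ(a·) reduces all three claims to the sums Σ_{g ∈ SL(n,q)} λ(a Tr g)
-- and to the order of SL(n,q).
--
-- In characteristic 2 the determinant has no signs: det (y ; B) = y · m(B), where m(B) is the vector of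
-- maximal minors of the (n-1) × n block B.  Expanding the matrix B with row i repeated on top gives
-- Bᵢ · m(B) = 0.  So if B arises from a square matrix D by inserting a column c, then cᵢ det D is
-- determined by the other minors; when det D ≠ 0 these minors therefore depend bijectively on c.
-- * Counting B by the value of m(B) gives |{det = d}| = qⁿ⁻¹ (qⁿ - 1) |{det = 1}| in size n - 1.
-- * Writing g with corner entry x and lower right block D, the sum over x kills all singular D, and
--   Σ_{det g = d} λ(a Tr g) = qⁿ⁻¹ Σ_{δ ≠ 0} λ(a d / δ) Σ_{det D = δ} λ(a Tr D).  This is the recursion of
--   the Kloosterman sums, so the sum over SL(n,q) is q^C(n,2) K_{n-1}(aⁿ), and aⁿ may be replaced by a
--   because n is a power of 2 and λ(x²) = λ(x).
--
-- The formula for the number of codewords follows by adding the matrices one at a time (Pascal's rule).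
-- For the moments let w(a) be the number of g with λ(a Tr g) = -1, so N - Σ λ(a Tr g) = 2 w(a); expand
-- w(a)ʰ in binomial coefficients C(w(a),t), and read 2ᵗ C(w(a),t) as the coefficient of xᵗ in
-- ∏_g ((1 + x) - λ(a Tr g) x), a sum over binary vectors u of multiples of λ(a (u · v)).

open import Defs
open import Level using (0ℓ)
open import Algebra.Bundles using (CommutativeMonoid)
open import Data.Bool using (Bool; true; false; if_then_else_; _∧_; not; T)
open import Data.Empty using (⊥-elim)
open import Data.Fin as Fin using (Fin; punchIn)
import Data.Fin.Properties as FinP
open import Data.Integer as ℤ using (ℤ; +_; -1ℤ; 0ℤ; 1ℤ)
import Data.Integer.Properties as ℤP
open import Data.Integer.Tactic.RingSolver using (solve-∀)
open import Data.List using (List; []; _∷_; map; filterᵇ; concatMap; foldr; length; upTo; _++_; allFin; zipWith)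
import Data.List.Properties as ListP
open import Data.List.Relation.Unary.All as All using (All; []; _∷_)
open import Data.List.Relation.Unary.All.Properties using (¬All⇒Any¬)
open import Data.List.Relation.Unary.AllPairs using (AllPairs; []; _∷_)
open import Data.List.Relation.Unary.Any using (Any; here; there; satisfied)
open import Data.Nat as ℕ using (ℕ; zero; suc; s≤s; z≤n; _!)
open import Data.Nat.Combinatorics using (_C_; nC1≡n; nCn≡1; nCk≡nC[n∸k]; nCk+nC[k+1]≡[n+1]C[k+1]; k>n⇒nCk≡0)
import Data.Nat.DivMod as DivMod
import Data.Nat.Properties as ℕP
open import Data.Nat.Properties using (_!≢0)
import Data.Nat.Tactic.RingSolver as ℕSolver
open import Data.Product using (_×_; _,_; ∃; Σ)
open import Data.Sum using (_⊎_; inj₁; inj₂)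
open import Data.Vec.Functional using (Vector; insertAt) renaming (_∷_ to _∷ᵛ_)
import Data.Vec.Functional.Properties as VecP
open import Function using (_∘_)
open import Relation.Binary using (Decidable; Rel; IsEquivalence)
open import Relation.Binary.PropositionalEquality as ≡ using (_≡_; refl; cong; cong₂; subst; module ≡-Reasoning)
open import Relation.Nullary using (¬_; Dec; yes; no; does)
open import Relation.Nullary.Decidable using (_×-dec_; dec-true; dec-false)

-- The field comes only with a list of its elements, complete and distinct up to `_≈_`, and
-- functions agree only pointwise. Hence a count is an integer sum of 0/1 indicators, a change of
-- variables is an exchange of two sums around a Kronecker delta, and bijectivity of the minors in c
-- follows from injectivity and a comparison of totals. Characteristic two is derived from |F| =
-- 2^r, and nontriviality of λ from a bound on the number of roots of the trace polynomial.
--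
-- The fibres of the trace need one more Fourier step: the sum of λ(aβ) K_{n-1}(a) over a ≠ 0 is q
-- K_{n-2}(β⁻¹) + (-1)^n for β ≠ 0, and (-1)^n for β = 0. This explains θ, the drop in dimension,
-- and the summand 1, since n is even.
--
-- In the recursion, h ≥ 1 enters because orthogonality sums over all a, whereas MK omits a = 0;
-- that term is (N - N)^h, which vanishes for positive h.

ℤ+-congˡ : ∀ a {b c : ℤ} → b ≡ c → a ℤ.+ b ≡ a ℤ.+ c
ℤ+-congˡ a refl = refl

does-cong : {P Q : Set} (p : Dec P) (q : Dec Q) → (P → Q) → (Q → P) → does p ≡ does q
does-cong (yes p) q f g = ≡.sym (dec-true q (f p))
does-cong (no ¬p) q f g = ≡.sym (dec-false q (¬p ∘ g))

-- Finite sums and products in a commutative monoid, and change of variables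

module BigOp (M : CommutativeMonoid 0ℓ 0ℓ) where
  open CommutativeMonoid M
    renaming (refl to ≈-refl; sym to ≈-sym; trans to ≈-trans)
  open import Relation.Binary.Reasoning.Setoid setoid

  big : {A : Set} → List A → (A → Carrier) → Carrier
  big xs f = foldr _∙_ ε (map f xs)

  interchange : ∀ a b c d → (a ∙ b) ∙ (c ∙ d) ≈ (a ∙ c) ∙ (b ∙ d)
  interchange a b c d = begin
    (a ∙ b) ∙ (c ∙ d)  ≈⟨ assoc a b (c ∙ d) ⟩
    a ∙ (b ∙ (c ∙ d))  ≈⟨ ∙-congˡ (≈-trans (≈-sym (assoc b c d)) (≈-trans (∙-congʳ (comm b c)) (assoc c b d))) ⟩
    a ∙ (c ∙ (b ∙ d))  ≈⟨ assoc a c (b ∙ d) ⟨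
    (a ∙ c) ∙ (b ∙ d)  ∎

  module _ {A : Set} where

    big-cong : (xs : List A) {f g : A → Carrier} → (∀ x → f x ≈ g x) → big xs f ≈ big xs g
    big-cong []       e = ≈-refl
    big-cong (x ∷ xs) e = ∙-cong (e x) (big-cong xs e)

    big-ε : (xs : List A) → big xs (λ _ → ε) ≈ ε
    big-ε []       = ≈-refl
    big-ε (x ∷ xs) = ≈-trans (identityˡ _) (big-ε xs)

    big-∙ : (xs : List A) (f g : A → Carrier) → big xs (λ x → f x ∙ g x) ≈ big xs f ∙ big xs g
    big-∙ []       f g = ≈-sym (identityˡ ε)
    big-∙ (x ∷ xs) f g = ≈-trans (∙-congˡ (big-∙ xs f g)) (interchange _ _ _ _)

    big-++ : (xs ys : List A) (f : A → Carrier) → big (xs ++ ys) f ≈ big xs f ∙ big ys f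
    big-++ []       ys f = ≈-sym (identityˡ _)
    big-++ (x ∷ xs) ys f = ≈-trans (∙-congˡ (big-++ xs ys f)) (≈-sym (assoc _ _ _))

  module _ {A B : Set} where

    big-swap : (xs : List A) (ys : List B) (f : A → B → Carrier) →
      big xs (λ x → big ys (f x)) ≈ big ys (λ y → big xs (λ x → f x y))
    big-swap []       ys f = ≈-sym (big-ε ys)
    big-swap (x ∷ xs) ys f = ≈-trans (∙-congˡ (big-swap xs ys f)) (≈-sym (big-∙ ys _ _))

    big-map : (xs : List A) (h : A → B) (f : B → Carrier) → big (map h xs) f ≡ big xs (f ∘ h)
    big-map []       h f = refl
    big-map (x ∷ xs) h f = cong (f (h x) ∙_) (big-map xs h f)

    big-concatMap : (xs : List A) (h : A → List B) (f : B → Carrier) →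
      big (concatMap h xs) f ≈ big xs (λ x → big (h x) f)
    big-concatMap []       h f = ≈-refl
    big-concatMap (x ∷ xs) h f = ≈-trans (big-++ (h x) _ f) (∙-congˡ (big-concatMap xs h f))

  big-upTo-snoc : ∀ n (f : ℕ → Carrier) → big (upTo (suc n)) f ≈ big (upTo n) f ∙ f n
  big-upTo-snoc n f = ≈-trans (reflexive (cong (λ l → big l f) (≡.sym (ListP.upTo-∷ʳ n))))
    (≈-trans (big-++ (upTo n) (n ∷ []) f) (∙-congˡ (identityʳ (f n))))

  big-upTo-suc : ∀ n (f : ℕ → Carrier) → big (upTo (suc n)) f ≈ f 0 ∙ big (upTo n) (f ∘ suc)
  big-upTo-suc n f = ∙-congˡ (reflexive
    (≡.trans (cong (λ l → big l f) (≡.sym (ListP.map-upTo suc n))) (big-map (upTo n) suc f)))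

  module Reindex {A : Set} {_∼_ : Rel A 0ℓ} (∼-eq : IsEquivalence _∼_) (_≟_ : Decidable _∼_) where
    private module E = IsEquivalence ∼-eq

    -- In summed form: every class of `_∼_` is represented exactly once. Reindexing uses the
    -- enumeration only through this property.
    Picks : List A → Set
    Picks xs = ∀ z (g : A → Carrier) → (∀ {x y} → x ∼ y → g x ≈ g y) →
      big xs (λ x → if does (x ≟ z) then g x else ε) ≈ g z

    picks : (xs : List A) → (∀ x → Any (x ∼_) xs) → AllPairs (λ x y → ¬ (x ∼ y)) xs → Picks xs
    picks xs complete distinct z g gc = go xs (complete z) distinct
      where
      term : A → Carrier
      term x = if does (x ≟ z) then g x else ε
      none : ∀ y ys → y ∼ z → All (λ x → ¬ (y ∼ x)) ys → big ys term ≈ ε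
      none y [] p [] = ≈-refl
      none y (x ∷ ys) p (n ∷ ns) with x ≟ z
      ... | yes e = ⊥-elim (n (E.trans p (E.sym e)))
      ... | no _ = ≈-trans (identityˡ _) (none y ys p ns)
      go : ∀ xs → Any (z ∼_) xs → AllPairs (λ x y → ¬ (x ∼ y)) xs → big xs term ≈ g z
      go (x ∷ xs) a (d ∷ ds) with x ≟ z | a
      ... | yes e | _ = ≈-trans (∙-cong (gc e) (none x xs e d)) (identityʳ _)
      ... | no n | here e = ⊥-elim (n (E.sym e))
      ... | no n | there a′ = ≈-trans (identityˡ _) (go xs a′ ds)

    -- A bijection of classes need not permute the list itself. So g (f x) is written as a delta sum
    -- over y, the sums are exchanged, and the delta `y ∼ f x` is read as `x ∼ f⁻ y`, which selects
    -- one x for each y.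
    reindex : (xs : List A) → Picks xs → (f f⁻ : A → A) →
      (∀ {x y} → x ∼ y → f x ∼ f y) → (∀ {x y} → x ∼ y → f⁻ x ∼ f⁻ y) →
      (∀ x → f (f⁻ x) ∼ x) → (∀ x → f⁻ (f x) ∼ x) →
      (g : A → Carrier) → (∀ {x y} → x ∼ y → g x ≈ g y) →
      big xs (g ∘ f) ≈ big xs g
    reindex xs pick f f⁻ fc f⁻c ff⁻ f⁻f g gc = begin
      big xs (g ∘ f)
        ≈⟨ big-cong xs (λ x → ≈-sym (pick (f x) g gc)) ⟩
      big xs (λ x → big xs (λ y → if does (y ≟ f x) then g y else ε))
        ≈⟨ big-swap xs xs _ ⟩
      big xs (λ y → big xs (λ x → if does (y ≟ f x) then g y else ε))
        ≈⟨ big-cong xs (λ y → big-cong xs λ x →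
             reflexive (cong (if_then g y else ε) (does-cong (y ≟ f x) (x ≟ f⁻ y)
               (λ e → E.trans (E.sym (f⁻f x)) (f⁻c (E.sym e)))
               (λ e → E.sym (E.trans (fc e) (ff⁻ y)))))) ⟩
      big xs (λ y → big xs (λ x → if does (x ≟ f⁻ y) then g y else ε))
        ≈⟨ big-cong xs (λ y → pick (f⁻ y) (λ _ → g y) (λ _ → ≈-refl)) ⟩
      big xs g ∎

module Sum = BigOp ℤP.+-0-commutativeMonoid
open Sum using () renaming
  ( big to ∑; big-cong to ∑-cong; big-ε to ∑-0; big-∙ to ∑-+; big-++ to ∑-++; big-swap to ∑-swap
  ; big-map to ∑-map; big-concatMap to ∑-concatMap
  ; big-upTo-snoc to ∑-upTo-snoc; big-upTo-suc to ∑-upTo-suc )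

-- Indicators and integer sums

⟦_⟧ : Bool → ℤ
⟦ true ⟧  = 1ℤ
⟦ false ⟧ = 0ℤ

⟦∧⟧ : ∀ a b → ⟦ a ∧ b ⟧ ≡ ⟦ a ⟧ ℤ.* ⟦ b ⟧
⟦∧⟧ true  b = ≡.sym (ℤP.*-identityˡ ⟦ b ⟧)
⟦∧⟧ false b = refl

if-⟦⟧ : ∀ b x → (if b then x else 0ℤ) ≡ ⟦ b ⟧ ℤ.* x
if-⟦⟧ true  x = ≡.sym (ℤP.*-identityˡ x)
if-⟦⟧ false x = refl

⟦not⟧ : ∀ b → ⟦ not b ⟧ ≡ 1ℤ ℤ.- ⟦ b ⟧
⟦not⟧ true  = refl
⟦not⟧ false = refl

module _ {P : Set} where

  ⟦yes⟧ : (p : Dec P) → P → ⟦ does p ⟧ ≡ 1ℤ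
  ⟦yes⟧ p x = cong ⟦_⟧ (dec-true p x)

  ⟦no⟧ : (p : Dec P) → ¬ P → ⟦ does p ⟧ ≡ 0ℤ
  ⟦no⟧ p x = cong ⟦_⟧ (dec-false p x)

  ⟦⟧-when : (p : Dec P) {x y : ℤ} → (P → x ≡ y) → ⟦ does p ⟧ ℤ.* x ≡ ⟦ does p ⟧ ℤ.* y
  ⟦⟧-when (yes p) e = cong (1ℤ ℤ.*_) (e p)
  ⟦⟧-when (no _)  e = refl

module _ {A : Set} where

  ∑-*ˡ : (xs : List A) (c : ℤ) (f : A → ℤ) → ∑ xs (λ x → c ℤ.* f x) ≡ c ℤ.* ∑ xs f
  ∑-*ˡ []       c f = ≡.sym (ℤP.*-zeroʳ c)
  ∑-*ˡ (x ∷ xs) c f = ≡.trans (ℤ+-congˡ (c ℤ.* f x) (∑-*ˡ xs c f)) (≡.sym (ℤP.*-distribˡ-+ c (f x) _))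

  ∑-*ʳ : (xs : List A) (c : ℤ) (f : A → ℤ) → ∑ xs (λ x → f x ℤ.* c) ≡ ∑ xs f ℤ.* c
  ∑-*ʳ xs c f = ≡.trans (∑-cong xs (λ x → ℤP.*-comm (f x) c)) (≡.trans (∑-*ˡ xs c f) (ℤP.*-comm c _))

  ∑-const : (xs : List A) (c : ℤ) → ∑ xs (λ _ → c) ≡ + length xs ℤ.* c
  ∑-const []       c = refl
  ∑-const (x ∷ xs) c = ≡.trans (ℤ+-congˡ c (∑-const xs c)) (≡.sym (ℤP.suc-* (+ length xs) c))

  ∑-neg : (xs : List A) (f : A → ℤ) → ∑ xs (λ x → ℤ.- f x) ≡ ℤ.- ∑ xs f
  ∑-neg []       f = refl
  ∑-neg (x ∷ xs) f = ≡.trans (ℤ+-congˡ (ℤ.- f x) (∑-neg xs f)) (≡.sym (ℤP.neg-distrib-+ (f x) _))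

  ∑-filter : (p : A → Bool) (xs : List A) (f : A → ℤ) → ∑ (filterᵇ p xs) f ≡ ∑ xs (λ x → ⟦ p x ⟧ ℤ.* f x)
  ∑-filter p []       f = refl
  ∑-filter p (x ∷ xs) f with p x
  ... | true  = cong₂ ℤ._+_ (≡.sym (ℤP.*-identityˡ (f x))) (∑-filter p xs f)
  ... | false = ≡.trans (∑-filter p xs f) (≡.sym (ℤP.+-identityˡ _))

  count-∑ : (p : A → Bool) (xs : List A) → + count p xs ≡ ∑ xs (⟦_⟧ ∘ p)
  count-∑ p []       = refl
  count-∑ p (x ∷ xs) with p x
  ... | true  = ℤ+-congˡ 1ℤ (count-∑ p xs)
  ... | false = ≡.trans (count-∑ p xs) (≡.sym (ℤP.+-identityˡ _))

  -- Each term is at most the total. This later upgrades an equality of cardinalities to a pointwise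
  -- one.
  ∑-nonneg-zero : (xs : List A) (f : A → ℤ) → (∀ x → 0ℤ ℤ.≤ f x) → ∑ xs f ≡ 0ℤ → All (λ x → f x ≡ 0ℤ) xs
  ∑-nonneg-zero []       f nn e = []
  ∑-nonneg-zero (x ∷ xs) f nn e = fx≡0 ∷ ∑-nonneg-zero xs f nn rest
    where
    nonneg : ∀ ys → 0ℤ ℤ.≤ ∑ ys f
    nonneg []       = ℤP.≤-refl
    nonneg (y ∷ ys) = ℤP.+-mono-≤ (nn y) (nonneg ys)
    fx≡0 : f x ≡ 0ℤ
    fx≡0 = ℤP.≤-antisym
      (subst (f x ℤ.≤_) e (subst (ℤ._≤ f x ℤ.+ ∑ xs f) (ℤP.+-identityʳ (f x)) (ℤP.+-monoʳ-≤ (f x) (nonneg xs))))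
      (nn x)
    rest : ∑ xs f ≡ 0ℤ
    rest = ≡.trans (≡.sym (ℤP.+-identityˡ _)) (≡.trans (cong (ℤ._+ ∑ xs f) (≡.sym fx≡0)) e)

∑-upTo-+ : ∀ m n (f : ℕ → ℤ) → ∑ (upTo (m ℕ.+ n)) f ≡ ∑ (upTo m) f ℤ.+ ∑ (upTo n) (λ k → f (m ℕ.+ k))
∑-upTo-+ zero    n f = ≡.sym (ℤP.+-identityˡ _)
∑-upTo-+ (suc m) n f = begin
  ∑ (upTo (suc (m ℕ.+ n))) f
    ≡⟨ ∑-upTo-suc (m ℕ.+ n) f ⟩
  f 0 ℤ.+ ∑ (upTo (m ℕ.+ n)) (f ∘ suc)
    ≡⟨ ℤ+-congˡ (f 0) (∑-upTo-+ m n (f ∘ suc)) ⟩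
  f 0 ℤ.+ (∑ (upTo m) (f ∘ suc) ℤ.+ ∑ (upTo n) (λ k → f (suc m ℕ.+ k)))
    ≡⟨ ℤP.+-assoc (f 0) _ _ ⟨
  f 0 ℤ.+ ∑ (upTo m) (f ∘ suc) ℤ.+ ∑ (upTo n) (λ k → f (suc m ℕ.+ k))
    ≡⟨ cong (ℤ._+ ∑ (upTo n) (λ k → f (suc m ℕ.+ k))) (∑-upTo-suc m f) ⟨
  ∑ (upTo (suc m)) f ℤ.+ ∑ (upTo n) (λ k → f (suc m ℕ.+ k)) ∎
  where open ≡-Reasoning

∑-upTo-cong : ∀ n {f g : ℕ → ℤ} → (∀ k → k ℕ.< n → f k ≡ g k) → ∑ (upTo n) f ≡ ∑ (upTo n) g
∑-upTo-cong zero    e = refl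
∑-upTo-cong (suc n) {f} {g} e = ≡.trans (∑-upTo-snoc n f)
  (≡.trans (cong₂ ℤ._+_ (∑-upTo-cong n (λ k k<n → e k (ℕP.m≤n⇒m≤1+n k<n))) (e n (ℕP.n<1+n n)))
    (≡.sym (∑-upTo-snoc n g)))

∑-upTo-zero : ∀ n (f : ℕ → ℤ) → (∀ k → k ℕ.< n → f k ≡ 0ℤ) → ∑ (upTo n) f ≡ 0ℤ
∑-upTo-zero n f e = ≡.trans (∑-upTo-cong n e) (∑-0 (upTo n))

module _ {A : Set} where

  ∑-tuples-suc : ∀ n (xs : List A) (f : List A → ℤ) →
    ∑ (tuples (suc n) xs) f ≡ ∑ xs (λ x → ∑ (tuples n xs) (λ t → f (x ∷ t)))
  ∑-tuples-suc n xs f = ≡.trans (∑-concatMap xs _ f) (∑-cong xs (λ x → ∑-map (tuples n xs) (x ∷_) f))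

-- Binomial coefficients and Stirling numbers

[k+1]*[n+1]C[k+1] : ∀ n k → suc k ℕ.* (suc n C suc k) ≡ suc n ℕ.* (n C k)
[k+1]*[n+1]C[k+1] zero    zero    = refl
[k+1]*[n+1]C[k+1] zero    (suc k) = ≡.trans (cong (suc (suc k) ℕ.*_) (k>n⇒nCk≡0 {1} {suc (suc k)} (s≤s (s≤s z≤n)))) (ℕP.*-zeroʳ (suc (suc k)))
[k+1]*[n+1]C[k+1] (suc n) zero    = ≡.trans (ℕP.*-identityˡ _) (≡.trans (nC1≡n (suc (suc n))) (≡.sym (ℕP.*-identityʳ _)))
[k+1]*[n+1]C[k+1] (suc n) (suc k) = begin
  suc (suc k) ℕ.* (suc (suc n) C suc (suc k))
    ≡⟨ cong (suc (suc k) ℕ.*_) (nCk+nC[k+1]≡[n+1]C[k+1] (suc n) (suc k)) ⟨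
  suc (suc k) ℕ.* (x ℕ.+ y)
    ≡⟨ rearrange₁ k x y ⟩
  x ℕ.+ (suc k ℕ.* x ℕ.+ suc (suc k) ℕ.* y)
    ≡⟨ cong (x ℕ.+_) (cong₂ ℕ._+_ ([k+1]*[n+1]C[k+1] n k) ([k+1]*[n+1]C[k+1] n (suc k))) ⟩
  x ℕ.+ (suc n ℕ.* (n C k) ℕ.+ suc n ℕ.* (n C suc k))
    ≡⟨ cong (x ℕ.+_) (≡.trans (≡.sym (ℕP.*-distribˡ-+ (suc n) (n C k) (n C suc k))) (cong (suc n ℕ.*_) (nCk+nC[k+1]≡[n+1]C[k+1] n k))) ⟩
  suc (suc n) ℕ.* x ∎
  where
  open ≡-Reasoning
  x = suc n C suc k
  y = suc n C suc (suc k)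
  rearrange₁ : ∀ k x y → suc (suc k) ℕ.* (x ℕ.+ y) ≡ x ℕ.+ (suc k ℕ.* x ℕ.+ suc (suc k) ℕ.* y)
  rearrange₁ = ℕSolver.solve-∀

-- Multiplication by n in the basis of binomial coefficients. With one more C(n,k) added, both sides
-- are (k+1) C(n+1,k+1), once by absorption and once by Pascal's rule.
n*nCk : ∀ n k → n ℕ.* (n C k) ≡ k ℕ.* (n C k) ℕ.+ suc k ℕ.* (n C suc k)
n*nCk n k = ℕP.+-cancelˡ-≡ (n C k) _ _ (begin
  suc n ℕ.* (n C k)                                             ≡⟨ [k+1]*[n+1]C[k+1] n k ⟨
  suc k ℕ.* (suc n C suc k)                                     ≡⟨ cong (suc k ℕ.*_) (nCk+nC[k+1]≡[n+1]C[k+1] n k) ⟨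
  suc k ℕ.* (n C k ℕ.+ n C suc k)                               ≡⟨ rearrange k (n C k) (n C suc k) ⟩
  n C k ℕ.+ (k ℕ.* (n C k) ℕ.+ suc k ℕ.* (n C suc k))           ∎)
  where
  open ≡-Reasoning
  rearrange : ∀ k x y → suc k ℕ.* (x ℕ.+ y) ≡ x ℕ.+ (k ℕ.* x ℕ.+ suc k ℕ.* y)
  rearrange = ℕSolver.solve-∀

pascalℤ : ∀ n k → + (suc n C suc k) ≡ + (n C k) ℤ.+ + (n C suc k)
pascalℤ n k = ≡.trans (cong +_ (≡.sym (nCk+nC[k+1]≡[n+1]C[k+1] n k))) (ℤP.pos-+ (n C k) (n C suc k))

binomial : ∀ (x y : ℤ) h → (x ℤ.+ y) ℤ.^ h ≡ ∑ (upTo (suc h)) (λ i → + (h C i) ℤ.* (x ℤ.^ (h ℕ.∸ i) ℤ.* y ℤ.^ i))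
binomial x y zero    = refl
binomial x y (suc h) = begin
  (x ℤ.+ y) ℤ.* (x ℤ.+ y) ℤ.^ h
    ≡⟨ cong ((x ℤ.+ y) ℤ.*_) (binomial x y h) ⟩
  (x ℤ.+ y) ℤ.* B
    ≡⟨ ℤP.*-distribʳ-+ B x y ⟩
  x ℤ.* B ℤ.+ y ℤ.* B
    ≡⟨ cong₂ ℤ._+_ xB yB ⟩
  (head ℤ.+ R) ℤ.+ L
    ≡⟨ rearrange head L R ⟩
  head ℤ.+ (L ℤ.+ R)
    ≡⟨ ℤ+-congˡ head (≡.trans (≡.sym (∑-+ (upTo (suc h)) (λ i → + (h C i) ℤ.* z i) (λ i → + (h C suc i) ℤ.* z i))) (∑-cong (upTo (suc h)) (λ i → ≡.sym (≡.trans
         (cong (ℤ._* z i) (pascalℤ h i)) (ℤP.*-distribʳ-+ (z i) (+ (h C i)) (+ (h C suc i))))))) ⟩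
  head ℤ.+ ∑ (upTo (suc h)) (λ i → + (suc h C suc i) ℤ.* z i)
    ≡⟨ ∑-upTo-suc (suc h) (λ i → + (suc h C i) ℤ.* (x ℤ.^ (suc h ℕ.∸ i) ℤ.* y ℤ.^ i)) ⟨
  ∑ (upTo (suc (suc h))) (λ i → + (suc h C i) ℤ.* (x ℤ.^ (suc h ℕ.∸ i) ℤ.* y ℤ.^ i)) ∎
  where
  open ≡-Reasoning
  B head L R : ℤ
  z w : ℕ → ℤ
  B = ∑ (upTo (suc h)) (λ i → + (h C i) ℤ.* (x ℤ.^ (h ℕ.∸ i) ℤ.* y ℤ.^ i))
  z i = x ℤ.^ (h ℕ.∸ i) ℤ.* y ℤ.^ suc i
  w i = + (h C i) ℤ.* (x ℤ.^ (suc h ℕ.∸ i) ℤ.* y ℤ.^ i)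
  head = + 1 ℤ.* (x ℤ.^ suc h ℤ.* 1ℤ)
  L = ∑ (upTo (suc h)) (λ i → + (h C i) ℤ.* z i)
  R = ∑ (upTo (suc h)) (λ i → + (h C suc i) ℤ.* z i)
  rearrange : ∀ a l r → (a ℤ.+ r) ℤ.+ l ≡ a ℤ.+ (l ℤ.+ r)
  rearrange = solve-∀
  yB : y ℤ.* B ≡ L
  yB = ≡.trans (≡.sym (∑-*ˡ (upTo (suc h)) y _)) (∑-cong (upTo (suc h)) (λ i → assoc y (+ (h C i)) (x ℤ.^ (h ℕ.∸ i)) (y ℤ.^ i)))
    where
    assoc : ∀ y c a b → y ℤ.* (c ℤ.* (a ℤ.* b)) ≡ c ℤ.* (a ℤ.* (y ℤ.* b))
    assoc = solve-∀
  xB : x ℤ.* B ≡ head ℤ.+ R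
  xB = begin
    x ℤ.* B
      ≡⟨ ∑-*ˡ (upTo (suc h)) x _ ⟨
    ∑ (upTo (suc h)) (λ i → x ℤ.* (+ (h C i) ℤ.* (x ℤ.^ (h ℕ.∸ i) ℤ.* y ℤ.^ i)))
      ≡⟨ ∑-upTo-cong (suc h) (λ i i≤h → ≡.trans (assoc x (+ (h C i)) (x ℤ.^ (h ℕ.∸ i)) (y ℤ.^ i))
           (cong (λ e → + (h C i) ℤ.* (x ℤ.^ e ℤ.* y ℤ.^ i)) (≡.sym (ℕP.+-∸-assoc 1 (ℕP.≤-pred i≤h))))) ⟩
    ∑ (upTo (suc h)) w
      ≡⟨ ℤP.+-identityʳ _ ⟨
    ∑ (upTo (suc h)) w ℤ.+ 0ℤ
      ≡⟨ ℤ+-congˡ (∑ (upTo (suc h)) w) (cong (λ c → + c ℤ.* (x ℤ.^ (suc h ℕ.∸ suc h) ℤ.* y ℤ.^ suc h)) (k>n⇒nCk≡0 (ℕP.n<1+n h))) ⟨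
    ∑ (upTo (suc h)) w ℤ.+ w (suc h)
      ≡⟨ ∑-upTo-snoc (suc h) w ⟨
    ∑ (upTo (suc (suc h))) w
      ≡⟨ ∑-upTo-suc (suc h) w ⟩
    head ℤ.+ R ∎
    where
    assoc : ∀ x c a b → x ℤ.* (c ℤ.* (a ℤ.* b)) ≡ c ℤ.* ((x ℤ.* a) ℤ.* b)
    assoc = solve-∀

-- The t-th finite difference of f at 0.
difference : ℕ → (ℕ → ℤ) → ℤ
difference t f = ∑ (upTo (suc t)) (λ j → (-1ℤ ℤ.^ (t ℕ.∸ j)) ℤ.* + (t C j) ℤ.* f j)

-- Pascal's rule splits C(t+1,j+1). The part with C(t,j) is the difference of the shifted function;
-- the part with C(t,j+1) joins the term of index 0 and gives the negative of `difference t f`.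
difference-suc : ∀ t f → difference (suc t) f ≡ difference t (f ∘ suc) ℤ.- difference t f
difference-suc t f = begin
  difference (suc t) f
    ≡⟨ ∑-upTo-suc (suc t) (λ j → (-1ℤ ℤ.^ (suc t ℕ.∸ j)) ℤ.* + (suc t C j) ℤ.* f j) ⟩
  (-1ℤ ℤ.* s) ℤ.* 1ℤ ℤ.* f 0 ℤ.+ ∑ (upTo (suc t)) (λ j → (-1ℤ ℤ.^ (t ℕ.∸ j)) ℤ.* + (suc t C suc j) ℤ.* f (suc j))
    ≡⟨ ℤ+-congˡ ((-1ℤ ℤ.* s) ℤ.* 1ℤ ℤ.* f 0) (≡.trans (∑-cong (upTo (suc t)) (λ j → ≡.trans
         (cong (λ c → (-1ℤ ℤ.^ (t ℕ.∸ j)) ℤ.* c ℤ.* f (suc j)) (pascalℤ t j))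
         (distrib (-1ℤ ℤ.^ (t ℕ.∸ j)) (+ (t C j)) (+ (t C suc j)) (f (suc j)))))
         (∑-+ (upTo (suc t)) (λ j → (-1ℤ ℤ.^ (t ℕ.∸ j)) ℤ.* + (t C j) ℤ.* f (suc j)) (λ j → (-1ℤ ℤ.^ (t ℕ.∸ j)) ℤ.* + (t C suc j) ℤ.* f (suc j)))) ⟩
  (-1ℤ ℤ.* s) ℤ.* 1ℤ ℤ.* f 0 ℤ.+ (difference t (f ∘ suc) ℤ.+ R)
    ≡⟨ ℤ+-congˡ ((-1ℤ ℤ.* s) ℤ.* 1ℤ ℤ.* f 0) (ℤ+-congˡ (difference t (f ∘ suc)) R≡) ⟩
  (-1ℤ ℤ.* s) ℤ.* 1ℤ ℤ.* f 0 ℤ.+ (difference t (f ∘ suc) ℤ.+ (ℤ.- R′))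
    ≡⟨ rearrange s (f 0) (difference t (f ∘ suc)) R′ ⟩
  difference t (f ∘ suc) ℤ.- (s ℤ.* 1ℤ ℤ.* f 0 ℤ.+ R′)
    ≡⟨ cong (λ z → difference t (f ∘ suc) ℤ.- z) (∑-upTo-suc t (λ j → (-1ℤ ℤ.^ (t ℕ.∸ j)) ℤ.* + (t C j) ℤ.* f j)) ⟨
  difference t (f ∘ suc) ℤ.- difference t f ∎
  where
  open ≡-Reasoning
  s R R′ : ℤ
  s  = -1ℤ ℤ.^ t
  R  = ∑ (upTo (suc t)) (λ j → (-1ℤ ℤ.^ (t ℕ.∸ j)) ℤ.* + (t C suc j) ℤ.* f (suc j))
  R′ = ∑ (upTo t) (λ j → (-1ℤ ℤ.^ (t ℕ.∸ suc j)) ℤ.* + (t C suc j) ℤ.* f (suc j))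
  distrib : ∀ e a b x → e ℤ.* (a ℤ.+ b) ℤ.* x ≡ e ℤ.* a ℤ.* x ℤ.+ e ℤ.* b ℤ.* x
  distrib = solve-∀
  rearrange : ∀ s x d r → (-1ℤ ℤ.* s) ℤ.* 1ℤ ℤ.* x ℤ.+ (d ℤ.+ (ℤ.- r)) ≡ d ℤ.- (s ℤ.* 1ℤ ℤ.* x ℤ.+ r)
  rearrange = solve-∀
  negate : ∀ s c x → (-1ℤ ℤ.* s) ℤ.* c ℤ.* x ≡ ℤ.- (s ℤ.* c ℤ.* x)
  negate = solve-∀
  vanish : ∀ e x → e ℤ.* 0ℤ ℤ.* x ≡ 0ℤ
  vanish = solve-∀
  R≡ : R ≡ ℤ.- R′
  R≡ = begin
    R
      ≡⟨ ∑-upTo-snoc t (λ j → (-1ℤ ℤ.^ (t ℕ.∸ j)) ℤ.* + (t C suc j) ℤ.* f (suc j)) ⟩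
    ∑ (upTo t) (λ j → (-1ℤ ℤ.^ (t ℕ.∸ j)) ℤ.* + (t C suc j) ℤ.* f (suc j)) ℤ.+ (-1ℤ ℤ.^ (t ℕ.∸ t)) ℤ.* + (t C suc t) ℤ.* f (suc t)
      ≡⟨ cong₂ ℤ._+_ (∑-upTo-cong t (λ j j<t → ≡.trans
           (cong (λ e → (-1ℤ ℤ.^ e) ℤ.* + (t C suc j) ℤ.* f (suc j)) (ℕP.+-∸-assoc 1 j<t))
           (negate (-1ℤ ℤ.^ (t ℕ.∸ suc j)) (+ (t C suc j)) (f (suc j)))))
         (≡.trans (cong (λ c → (-1ℤ ℤ.^ (t ℕ.∸ t)) ℤ.* + c ℤ.* f (suc t)) (k>n⇒nCk≡0 (ℕP.n<1+n t))) (vanish (-1ℤ ℤ.^ (t ℕ.∸ t)) (f (suc t)))) ⟩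
    ∑ (upTo t) (λ j → ℤ.- ((-1ℤ ℤ.^ (t ℕ.∸ suc j)) ℤ.* + (t C suc j) ℤ.* f (suc j))) ℤ.+ 0ℤ
      ≡⟨ ≡.trans (ℤP.+-identityʳ _) (∑-neg (upTo t) _) ⟩
    ℤ.- R′ ∎

difference-cong : ∀ t {f g} → (∀ j → f j ≡ g j) → difference t f ≡ difference t g
difference-cong t e = ∑-cong (upTo (suc t)) (λ j → cong ((-1ℤ ℤ.^ (t ℕ.∸ j)) ℤ.* + (t C j) ℤ.*_) (e j))

-- The factor j is absorbed through j C(t+1,j) = (t+1) C(t,j-1), and the term j = 0 disappears.
difference-mul : ∀ t f → difference (suc t) (λ j → + j ℤ.* f j) ≡ + suc t ℤ.* difference t (f ∘ suc)
difference-mul t f = begin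
  difference (suc t) (λ j → + j ℤ.* f j)
    ≡⟨ ∑-upTo-suc (suc t) (λ j → (-1ℤ ℤ.^ (suc t ℕ.∸ j)) ℤ.* + (suc t C j) ℤ.* (+ j ℤ.* f j)) ⟩
  (-1ℤ ℤ.^ suc t) ℤ.* 1ℤ ℤ.* (0ℤ ℤ.* f 0) ℤ.+ ∑ (upTo (suc t)) (λ j → (-1ℤ ℤ.^ (t ℕ.∸ j)) ℤ.* + (suc t C suc j) ℤ.* (+ suc j ℤ.* f (suc j)))
    ≡⟨ cong₂ ℤ._+_ (vanish (-1ℤ ℤ.^ suc t) (f 0)) (∑-cong (upTo (suc t)) absorb) ⟩
  0ℤ ℤ.+ ∑ (upTo (suc t)) (λ j → + suc t ℤ.* ((-1ℤ ℤ.^ (t ℕ.∸ j)) ℤ.* + (t C j) ℤ.* f (suc j)))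
    ≡⟨ ≡.trans (ℤP.+-identityˡ _) (∑-*ˡ (upTo (suc t)) (+ suc t) (λ j → (-1ℤ ℤ.^ (t ℕ.∸ j)) ℤ.* + (t C j) ℤ.* f (suc j))) ⟩
  + suc t ℤ.* difference t (f ∘ suc) ∎
  where
  open ≡-Reasoning
  vanish : ∀ e x → e ℤ.* 1ℤ ℤ.* (0ℤ ℤ.* x) ≡ 0ℤ
  vanish = solve-∀
  rearrange₁ : ∀ e c j x → e ℤ.* c ℤ.* (j ℤ.* x) ≡ (j ℤ.* c) ℤ.* (e ℤ.* x)
  rearrange₁ = solve-∀
  rearrange₂ : ∀ e c t x → (t ℤ.* c) ℤ.* (e ℤ.* x) ≡ t ℤ.* (e ℤ.* c ℤ.* x)
  rearrange₂ = solve-∀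
  absorb : ∀ j → (-1ℤ ℤ.^ (t ℕ.∸ j)) ℤ.* + (suc t C suc j) ℤ.* (+ suc j ℤ.* f (suc j))
    ≡ + suc t ℤ.* ((-1ℤ ℤ.^ (t ℕ.∸ j)) ℤ.* + (t C j) ℤ.* f (suc j))
  absorb j = ≡.trans (rearrange₁ (-1ℤ ℤ.^ (t ℕ.∸ j)) (+ (suc t C suc j)) (+ suc j) (f (suc j)))
    (≡.trans (cong (ℤ._* ((-1ℤ ℤ.^ (t ℕ.∸ j)) ℤ.* f (suc j)))
      (≡.trans (≡.sym (ℤP.pos-* (suc j) (suc t C suc j))) (≡.trans (cong +_ ([k+1]*[n+1]C[k+1] t j)) (ℤP.pos-* (suc t) (t C j)))))
      (rearrange₂ (-1ℤ ℤ.^ (t ℕ.∸ j)) (+ (t C j)) (+ suc t) (f (suc j))))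

-- S(h,t).
partitions : ℕ → ℕ → ℕ
partitions zero    zero    = 1
partitions zero    (suc t) = 0
partitions (suc h) zero    = 0
partitions (suc h) (suc t) = suc t ℕ.* partitions h (suc t) ℕ.+ partitions h t

-- The number of surjections from an h-set onto a t-set. It is defined as a multiple of t!, so that
-- the division in `stirling2` is visibly exact.
surjections : ℕ → ℕ → ℕ
surjections h t = partitions h t ℕ.* t !

surjections-suc : ∀ h t → surjections (suc h) (suc t) ≡ suc t ℕ.* (surjections h (suc t) ℕ.+ surjections h t)
surjections-suc h t = rearrange (suc t) (partitions h (suc t)) (partitions h t) (t !)
  where
  rearrange : ∀ t a b f → (t ℕ.* a ℕ.+ b) ℕ.* (t ℕ.* f) ≡ t ℕ.* (a ℕ.* (t ℕ.* f) ℕ.+ b ℕ.* f)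
  rearrange = ℕSolver.solve-∀

surjections-0 : ∀ h t → h ℕ.< t → surjections h t ≡ 0
surjections-0 h t h<t = cong (ℕ._* t !) (partitions-0 h t h<t)
  where
  partitions-0 : ∀ h t → h ℕ.< t → partitions h t ≡ 0
  partitions-0 zero    (suc t) _         = refl
  partitions-0 (suc h) (suc t) (s≤s h<t) = cong₂ ℕ._+_
    (≡.trans (cong (suc t ℕ.*_) (partitions-0 h (suc t) (ℕP.m≤n⇒m≤1+n h<t))) (ℕP.*-zeroʳ (suc t))) (partitions-0 h t h<t)

-- Both sides obey the same recurrence in h: the factor j of j^(h+1) is absorbed, and the shifted
-- power that remains is the sum of the differences of order t+1 and t.
difference-surjections : ∀ h t → difference t (λ j → + (j ℕ.^ h)) ≡ + surjections h t
difference-surjections zero    zero    = refl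
difference-surjections zero    (suc t) = ≡.trans (difference-suc t (λ _ → 1ℤ)) (ℤP.+-inverseʳ (difference t (λ _ → 1ℤ)))
difference-surjections (suc h) zero    = refl
difference-surjections (suc h) (suc t) = begin
  difference (suc t) (λ j → + (j ℕ.^ suc h))
    ≡⟨ difference-cong (suc t) (λ j → ℤP.pos-* j (j ℕ.^ h)) ⟩
  difference (suc t) (λ j → + j ℤ.* + (j ℕ.^ h))
    ≡⟨ difference-mul t (λ j → + (j ℕ.^ h)) ⟩
  + suc t ℤ.* difference t f₁
    ≡⟨ cong (+ suc t ℤ.*_) (rearrange (difference t f₁) (difference t f)) ⟩
  + suc t ℤ.* ((difference t f₁ ℤ.- difference t f) ℤ.+ difference t f)
    ≡⟨ cong (λ z → + suc t ℤ.* (z ℤ.+ difference t f)) (difference-suc t f) ⟨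
  + suc t ℤ.* (difference (suc t) f ℤ.+ difference t f)
    ≡⟨ cong (+ suc t ℤ.*_) (cong₂ ℤ._+_ (difference-surjections h (suc t)) (difference-surjections h t)) ⟩
  + suc t ℤ.* + (surjections h (suc t) ℕ.+ surjections h t)
    ≡⟨ ℤP.pos-* (suc t) _ ⟨
  + (suc t ℕ.* (surjections h (suc t) ℕ.+ surjections h t))
    ≡⟨ cong +_ (surjections-suc h t) ⟨
  + surjections (suc h) (suc t) ∎
  where
  open ≡-Reasoning
  f f₁ : ℕ → ℤ
  f j  = + (j ℕ.^ h)
  f₁ j = f (suc j)
  rearrange : ∀ a b → a ≡ (a ℤ.- b) ℤ.+ b
  rearrange = solve-∀

t!*stirling2 : ∀ h t → + (t !) ℤ.* stirling2 h t ≡ + surjections h t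
t!*stirling2 h t = begin
  + (t !) ℤ.* stirling2 h t
    ≡⟨ cong (λ x → + (t !) ℤ.* (x ℤ./ℕ (t !))) (≡.trans
         (∑-map (upTo (suc t)) (0 ℕ.+_) (λ j → (-1ℤ ℤ.^ (t ℕ.∸ j)) ℤ.* + (t C j) ℤ.* + (j ℕ.^ h))) (difference-surjections h t)) ⟩
  + (t !) ℤ.* + (surjections h t ℕ./ t !)
    ≡⟨ cong (λ x → + (t !) ℤ.* + x) (DivMod.m*n/n≡m (partitions h t) (t !)) ⟩
  + (t !) ℤ.* + partitions h t
    ≡⟨ ≡.trans (ℤP.*-comm (+ (t !)) (+ partitions h t)) (≡.sym (ℤP.pos-* (partitions h t) (t !))) ⟩
  + surjections h t ∎
  where
  open ≡-Reasoning
  instance _ = t !≢0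

-- Every function from an h-set to a w-set is a surjection onto its image.
pow-surjections : ∀ w h → + (w ℕ.^ h) ≡ ∑ (upTo (suc h)) (λ t → + surjections h t ℤ.* + (w C t))
pow-surjections w zero    = refl
pow-surjections w (suc h) = begin
  + (w ℕ.^ suc h)
    ≡⟨ ≡.trans (ℤP.pos-* w (w ℕ.^ h)) (cong (+ w ℤ.*_) (pow-surjections w h)) ⟩
  + w ℤ.* ∑ (upTo (suc h)) (λ t → y t ℤ.* c t)
    ≡⟨ ∑-*ˡ (upTo (suc h)) (+ w) _ ⟨
  ∑ (upTo (suc h)) (λ t → + w ℤ.* (y t ℤ.* c t))
    ≡⟨ ≡.trans (∑-cong (upTo (suc h)) expand) (∑-+ (upTo (suc h)) b b′) ⟩
  ∑ (upTo (suc h)) b ℤ.+ ∑ (upTo (suc h)) b′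
    ≡⟨ cong (ℤ._+ ∑ (upTo (suc h)) b′) shifted ⟩
  ∑ (upTo (suc h)) (b ∘ suc) ℤ.+ ∑ (upTo (suc h)) b′
    ≡⟨ ∑-+ (upTo (suc h)) (b ∘ suc) b′ ⟨
  ∑ (upTo (suc h)) (λ t → b (suc t) ℤ.+ b′ t)
    ≡⟨ ∑-cong (upTo (suc h)) collect ⟩
  ∑ (upTo (suc h)) (λ t → + surjections (suc h) (suc t) ℤ.* c (suc t))
    ≡⟨ ℤP.+-identityˡ _ ⟨
  0ℤ ℤ.+ ∑ (upTo (suc h)) (λ t → + surjections (suc h) (suc t) ℤ.* c (suc t))
    ≡⟨ ∑-upTo-suc (suc h) (λ t → + surjections (suc h) t ℤ.* c t) ⟨
  ∑ (upTo (suc (suc h))) (λ t → + surjections (suc h) t ℤ.* c t) ∎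
  where
  open ≡-Reasoning
  y c b b′ : ℕ → ℤ
  y t = + surjections h t
  c t = + (w C t)
  b t = + t ℤ.* (y t ℤ.* c t)
  b′ t = + suc t ℤ.* (y t ℤ.* c (suc t))
  w*c : ∀ t → + w ℤ.* c t ≡ + t ℤ.* c t ℤ.+ + suc t ℤ.* c (suc t)
  w*c t = ≡.trans (≡.sym (ℤP.pos-* w (w C t))) (≡.trans (cong +_ (n*nCk w t))
    (≡.trans (ℤP.pos-+ (t ℕ.* (w C t)) _) (cong₂ ℤ._+_ (ℤP.pos-* t (w C t)) (ℤP.pos-* (suc t) (w C suc t)))))
  expand : ∀ t → + w ℤ.* (y t ℤ.* c t) ≡ b t ℤ.+ b′ t
  expand t = ≡.trans (comm (+ w) (y t) (c t)) (≡.trans (cong (y t ℤ.*_) (w*c t)) (dist (y t) (+ t) (c t) (+ suc t) (c (suc t))))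
    where
    comm : ∀ w y c → w ℤ.* (y ℤ.* c) ≡ y ℤ.* (w ℤ.* c)
    comm = solve-∀
    dist : ∀ y t c t′ c′ → y ℤ.* (t ℤ.* c ℤ.+ t′ ℤ.* c′) ≡ t ℤ.* (y ℤ.* c) ℤ.+ t′ ℤ.* (y ℤ.* c′)
    dist = solve-∀
  -- The term t = 0 carries the factor 0, and t = h+1 counts surjections onto a larger set, so the
  -- range may move by one.
  shifted : ∑ (upTo (suc h)) b ≡ ∑ (upTo (suc h)) (b ∘ suc)
  shifted = begin
    ∑ (upTo (suc h)) b
      ≡⟨ ℤP.+-identityʳ _ ⟨
    ∑ (upTo (suc h)) b ℤ.+ 0ℤ
      ≡⟨ ℤ+-congˡ (∑ (upTo (suc h)) b) (≡.trans (cong (λ z → + suc h ℤ.* (+ z ℤ.* c (suc h))) (surjections-0 h (suc h) (ℕP.n<1+n h))) (ℤP.*-zeroʳ (+ suc h))) ⟨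
    ∑ (upTo (suc h)) b ℤ.+ b (suc h)
      ≡⟨ ∑-upTo-snoc (suc h) b ⟨
    ∑ (upTo (suc (suc h))) b
      ≡⟨ ∑-upTo-suc (suc h) b ⟩
    0ℤ ℤ.+ ∑ (upTo (suc h)) (b ∘ suc)
      ≡⟨ ℤP.+-identityˡ _ ⟩
    ∑ (upTo (suc h)) (b ∘ suc) ∎
  collect : ∀ t → b (suc t) ℤ.+ b′ t ≡ + surjections (suc h) (suc t) ℤ.* c (suc t)
  collect t = ≡.trans (factor (+ suc t) (y (suc t)) (y t) (c (suc t))) (cong (ℤ._* c (suc t))
    (≡.sym (≡.trans (cong +_ (surjections-suc h t)) (ℤP.pos-* (suc t) (surjections h (suc t) ℕ.+ surjections h t)))))
    where
    factor : ∀ t y y′ c → t ℤ.* (y ℤ.* c) ℤ.+ t ℤ.* (y′ ℤ.* c) ≡ (t ℤ.* (y ℤ.+ y′)) ℤ.* c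
    factor = solve-∀

-- The coefficient of xᵗ in xʷ(1 + x)ᶻ.
coef : ℕ → ℕ → ℕ → ℕ
coef zero    z t       = z C t
coef (suc w) z zero    = 0
coef (suc w) z (suc t) = coef w z t

coef-0 : ∀ w z → coef w (suc z) 0 ≡ coef w z 0
coef-0 zero    z = refl
coef-0 (suc w) z = refl

coef-suc : ∀ w z t → coef w (suc z) (suc t) ≡ coef w z t ℕ.+ coef w z (suc t)
coef-suc zero    z t       = ≡.sym (nCk+nC[k+1]≡[n+1]C[k+1] z t)
coef-suc (suc w) z zero    = coef-0 w z
coef-suc (suc w) z (suc t) = coef-suc w z t

coef-< : ∀ w z t → t ℕ.< w → coef w z t ≡ 0
coef-< (suc w) z zero    _         = refl
coef-< (suc w) z (suc t) (s≤s t<w) = coef-< w z t t<w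

coef-+ : ∀ w z k → coef w z (w ℕ.+ k) ≡ z C k
coef-+ zero    z k = refl
coef-+ (suc w) z k = coef-+ w z k

^-*ℤ : ∀ (x y : ℤ) h → (x ℤ.* y) ℤ.^ h ≡ x ℤ.^ h ℤ.* y ℤ.^ h
^-*ℤ x y zero    = refl
^-*ℤ x y (suc h) = ≡.trans (cong ((x ℤ.* y) ℤ.*_) (^-*ℤ x y h)) (rearrange x y (x ℤ.^ h) (y ℤ.^ h))
  where
  rearrange : ∀ a b c d → (a ℤ.* b) ℤ.* (c ℤ.* d) ≡ (a ℤ.* c) ℤ.* (b ℤ.* d)
  rearrange = solve-∀

pos-^ : ∀ w h → (+ w) ℤ.^ h ≡ + (w ℕ.^ h)
pos-^ w zero    = refl
pos-^ w (suc h) = ≡.trans (cong (+ w ℤ.*_) (pos-^ w h)) (≡.sym (ℤP.pos-* w (w ℕ.^ h)))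

∑-upTo-δ : ∀ n w (f : ℕ → ℤ) → w ℕ.< n → ∑ (upTo n) (λ i → ⟦ w ℕ.≡ᵇ i ⟧ ℤ.* f i) ≡ f w
∑-upTo-δ (suc n) zero    f _         = ≡.trans (∑-upTo-suc n (λ i → ⟦ 0 ℕ.≡ᵇ i ⟧ ℤ.* f i))
  (≡.trans (cong₂ ℤ._+_ (ℤP.*-identityˡ (f 0)) (∑-0 (upTo n))) (ℤP.+-identityʳ (f 0)))
∑-upTo-δ (suc n) (suc w) f (s≤s w<n) = ≡.trans (∑-upTo-suc n (λ i → ⟦ suc w ℕ.≡ᵇ i ⟧ ℤ.* f i))
  (≡.trans (ℤP.+-identityˡ _) (∑-upTo-δ n w (f ∘ suc) w<n))

∑-upTo-δ-≥ : ∀ n w (f : ℕ → ℤ) → n ℕ.≤ w → ∑ (upTo n) (λ i → ⟦ w ℕ.≡ᵇ i ⟧ ℤ.* f i) ≡ 0ℤ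
∑-upTo-δ-≥ zero    w       f _         = refl
∑-upTo-δ-≥ (suc n) (suc w) f (s≤s n≤w) = ≡.trans (∑-upTo-suc n (λ i → ⟦ suc w ℕ.≡ᵇ i ⟧ ℤ.* f i))
  (≡.trans (ℤP.+-identityˡ _) (∑-upTo-δ-≥ n w (f ∘ suc) n≤w))

-1^-sq : ∀ h → -1ℤ ℤ.^ h ℤ.* -1ℤ ℤ.^ h ≡ 1ℤ
-1^-sq h = ≡.trans (≡.sym (^-*ℤ -1ℤ -1ℤ h)) (ℤP.^-zeroˡ h)

-- Arithmetic of the field

module OverF (F : FiniteField) (r : ℕ) (1≤r : 1 ℕ.≤ r)
             (|F|≡2^r : length (FiniteField.elements F) ≡ 2 ℕ.^ r) where
  open FiniteField F renaming (refl to ≈-refl; sym to ≈-sym; trans to ≈-trans; reflexive to ≈-reflexive)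
  open OverField F r
  open import Algebra.Solver.Ring.NaturalCoefficients.Default commutativeSemiring
    using (solve; _:=_; _:+_; _:*_; con)
  import Algebra.Properties.Group +-group as +-Group
  import Relation.Binary.Reasoning.Setoid setoid as ≈-Reasoning

  module Add = BigOp +-commutativeMonoid
  module Mul = BigOp *-commutativeMonoid
  module AddR = Add.Reindex isEquivalence _≟_
  module MulR = Mul.Reindex isEquivalence _≟_
  module SumR = Sum.Reindex isEquivalence _≟_

  E : List Carrier
  E = elements

  1≉0 : ¬ (1# ≈ 0#)
  1≉0 e = 0≉1 (≈-sym e)

  ⁻¹-invˡ : ∀ x → ¬ (x ≈ 0#) → x ⁻¹ * x ≈ 1#
  ⁻¹-invˡ x x≉0 = ≈-trans (*-comm _ _) (⁻¹-inv x x≉0)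

  cancelˡ : ∀ {x y z} → ¬ (x ≈ 0#) → x * y ≈ x * z → y ≈ z
  cancelˡ {x} {y} {z} x≉0 e = ≈-trans (≈-sym (step y)) (≈-trans (*-congˡ e) (step z))
    where
    step : ∀ w → x ⁻¹ * (x * w) ≈ w
    step w = ≈-trans (≈-sym (*-assoc _ _ _)) (≈-trans (*-congʳ (⁻¹-invˡ x x≉0)) (*-identityˡ w))

  x*y≉0 : ∀ {x y} → ¬ (x ≈ 0#) → ¬ (y ≈ 0#) → ¬ (x * y ≈ 0#)
  x*y≉0 x≉0 y≉0 e = y≉0 (cancelˡ x≉0 (≈-trans e (≈-sym (zeroʳ _))))

  x⁻¹≉0 : ∀ {x} → ¬ (x ≈ 0#) → ¬ (x ⁻¹ ≈ 0#)
  x⁻¹≉0 {x} x≉0 e = 1≉0 (≈-trans (≈-sym (⁻¹-inv x x≉0)) (≈-trans (*-congˡ e) (zeroʳ x)))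

  ⁻¹-unique : ∀ {x y} → ¬ (x ≈ 0#) → x * y ≈ 1# → y ≈ x ⁻¹
  ⁻¹-unique {x} x≉0 e = cancelˡ x≉0 (≈-trans e (≈-sym (⁻¹-inv x x≉0)))

  -- `_⁻¹` is a bare function. Away from zero, uniqueness of inverses makes it respect `_≈_`; this
  -- is why later congruence hypotheses are restricted to nonzero arguments.
  ⁻¹-cong : ∀ {x y} → ¬ (x ≈ 0#) → x ≈ y → x ⁻¹ ≈ y ⁻¹
  ⁻¹-cong {x} x≉0 e = ⁻¹-unique (λ y≈0 → x≉0 (≈-trans e y≈0)) (≈-trans (*-congʳ (≈-sym e)) (⁻¹-inv x x≉0))

  ⁻¹-* : ∀ {x y} → ¬ (x ≈ 0#) → ¬ (y ≈ 0#) → (x * y) ⁻¹ ≈ x ⁻¹ * y ⁻¹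
  ⁻¹-* {x} {y} x≉0 y≉0 = ≈-sym (⁻¹-unique (x*y≉0 x≉0 y≉0) (≈-trans
    (solve 4 (λ a b c d → (a :* b) :* (c :* d) := (a :* c) :* (b :* d)) ≈-refl x y (x ⁻¹) (y ⁻¹))
    (≈-trans (*-cong (⁻¹-inv x x≉0) (⁻¹-inv y y≉0)) (*-identityˡ 1#))))

  ⁻¹-⁻¹ : ∀ {x} → ¬ (x ≈ 0#) → (x ⁻¹) ⁻¹ ≈ x
  ⁻¹-⁻¹ {x} x≉0 = ≈-sym (⁻¹-unique (x⁻¹≉0 x≉0) (⁻¹-invˡ x x≉0))

  -- Characteristic two

  natMul-+ : ∀ m n x → natMul (m ℕ.+ n) x ≈ natMul m x + natMul n x
  natMul-+ zero    n x = ≈-sym (+-identityˡ _)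
  natMul-+ (suc m) n x = ≈-trans (+-congˡ (natMul-+ m n x)) (≈-sym (+-assoc _ _ _))

  Add-pick : AddR.Picks E
  Add-pick = AddR.picks E complete distinct

  Mul-pick : MulR.Picks E
  Mul-pick = MulR.picks E complete distinct

  x+a-a : ∀ x a → (x + a) + (- a) ≈ x
  x+a-a x a = ≈-trans (+-assoc _ _ _) (≈-trans (+-congˡ (-‿inverseʳ a)) (+-identityʳ x))

  x-a+a : ∀ x a → (x + (- a)) + a ≈ x
  x-a+a x a = ≈-trans (+-assoc _ _ _) (≈-trans (+-congˡ (-‿inverseˡ a)) (+-identityʳ x))

  -- x ↦ x + 1 permutes the field, so the sum S of all elements equals S + q·1.
  q·1≈0 : natMul q 1# ≈ 0#
  q·1≈0 = +-Group.∙-cancelˡ (Add.big E (λ x → x)) _ _ (begin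
    Add.big E (λ x → x) + natMul q 1#             ≈⟨ +-congˡ (ones E) ⟨
    Add.big E (λ x → x) + Add.big E (λ _ → 1#)    ≈⟨ Add.big-∙ E _ _ ⟨
    Add.big E (λ x → x + 1#)                      ≈⟨ AddR.reindex E Add-pick (_+ 1#) (_+ (- 1#)) +-congʳ +-congʳ
                                                       (λ x → x-a+a x 1#) (λ x → x+a-a x 1#) (λ x → x) (λ e → e) ⟩
    Add.big E (λ x → x)                           ≈⟨ +-identityʳ _ ⟨
    Add.big E (λ x → x) + 0#                      ∎)
    where
    open ≈-Reasoning
    ones : ∀ xs → Add.big xs (λ _ → 1#) ≈ natMul (length xs) 1#
    ones []       = ≈-refl
    ones (x ∷ xs) = +-congˡ (ones xs)

  -- 2^(k+1)·1 = (2^k·1)(1 + 1). Descending from 2^r·1 = 0, either the smaller multiple vanishes too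
  -- or it can be cancelled, and 1 = 0 is impossible.
  1+1≈0 : 1# + 1# ≈ 0#
  1+1≈0 = go r (subst (λ k → natMul k 1# ≈ 0#) |F|≡2^r q·1≈0)
    where
    go : ∀ k → natMul (2 ℕ.^ k) 1# ≈ 0# → 1# + 1# ≈ 0#
    go zero    e = ⊥-elim (1≉0 (≈-trans (≈-sym (+-identityʳ 1#)) e))
    go (suc k) e with natMul (2 ℕ.^ k) 1# ≟ 0#
    ... | yes e′ = go k e′
    ... | no ≉0 = cancelˡ ≉0 (begin
      t * (1# + 1#)                   ≈⟨ solve 1 (λ t → t :* (con 1 :+ con 1) := t :+ (t :+ con 0)) ≈-refl t ⟩
      t + (t + 0#)                    ≈⟨ +-congˡ (natMul-+ (2 ℕ.^ k) 0 1#) ⟨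
      t + natMul (2 ℕ.^ k ℕ.+ 0) 1#  ≈⟨ natMul-+ (2 ℕ.^ k) _ 1# ⟨
      natMul (2 ℕ.^ suc k) 1#         ≈⟨ e ⟩
      0#                              ≈⟨ zeroʳ t ⟨
      t * 0#                          ∎)
      where
      open ≈-Reasoning
      t = natMul (2 ℕ.^ k) 1#

  x+x≈0 : ∀ x → x + x ≈ 0#
  x+x≈0 x = ≈-trans (solve 1 (λ x → x :+ x := (con 1 :+ con 1) :* x) ≈-refl x) (≈-trans (*-congʳ 1+1≈0) (zeroˡ x))

  x+y≈0⇒x≈y : ∀ {x y} → x + y ≈ 0# → x ≈ y
  x+y≈0⇒x≈y {x} {y} e = +-Group.∙-cancelʳ y x y (≈-trans e (≈-sym (x+x≈0 y)))

  x≈y⇒x+y≈0 : ∀ {x y} → x ≈ y → x + y ≈ 0#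
  x≈y⇒x+y≈0 {x} {y} e = ≈-trans (+-congʳ e) (x+x≈0 y)

  x+a+a : ∀ x a → (x + a) + a ≈ x
  x+a+a x a = ≈-trans (+-assoc _ _ _) (≈-trans (+-congˡ (x+x≈0 a)) (+-identityʳ x))

  -1≈1 : - 1# ≈ 1#
  -1≈1 = ≈-sym (+-Group.inverseˡ-unique 1# 1# 1+1≈0)

  -- Powers and the trace

  pow-cong : ∀ {x y} n → x ≈ y → pow x n ≈ pow y n
  pow-cong zero    e = ≈-refl
  pow-cong (suc n) e = *-cong e (pow-cong n e)

  pow-+ : ∀ x m n → pow x (m ℕ.+ n) ≈ pow x m * pow x n
  pow-+ x zero    n = ≈-sym (*-identityˡ _)
  pow-+ x (suc m) n = ≈-trans (*-congˡ (pow-+ x m n)) (≈-sym (*-assoc _ _ _))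

  pow-* : ∀ x y n → pow (x * y) n ≈ pow x n * pow y n
  pow-* x y zero    = ≈-sym (*-identityˡ _)
  pow-* x y (suc n) = ≈-trans (*-congˡ (pow-* x y n))
    (solve 4 (λ a b c d → (a :* b) :* (c :* d) := (a :* c) :* (b :* d)) ≈-refl x y (pow x n) (pow y n))

  pow-1# : ∀ n → pow 1# n ≈ 1#
  pow-1# zero    = ≈-refl
  pow-1# (suc n) = ≈-trans (*-identityˡ _) (pow-1# n)

  sq : Carrier → Carrier
  sq x = x * x

  sq-cong : ∀ {x y} → x ≈ y → sq x ≈ sq y
  sq-cong e = *-cong e e

  sq-+ : ∀ x y → sq (x + y) ≈ sq x + sq y
  sq-+ x y = ≈-trans
    (solve 2 (λ x y → (x :+ y) :* (x :+ y) := (con 1 :+ con 1) :* (x :* y) :+ (x :* x :+ y :* y)) ≈-refl x y)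
    (≈-trans (+-congʳ (≈-trans (*-congʳ 1+1≈0) (zeroˡ _))) (+-identityˡ _))

  pow-2^suc : ∀ x k → pow x (2 ℕ.^ suc k) ≈ sq (pow x (2 ℕ.^ k))
  pow-2^suc x k = ≈-trans (pow-+ x (2 ℕ.^ k) _) (*-congˡ (≈-reflexive (cong (pow x) (ℕP.+-identityʳ (2 ℕ.^ k)))))

  pow-2^-+ : ∀ k x y → pow (x + y) (2 ℕ.^ k) ≈ pow x (2 ℕ.^ k) + pow y (2 ℕ.^ k)
  pow-2^-+ zero    x y = solve 2 (λ x y → (x :+ y) :* con 1 := x :* con 1 :+ y :* con 1) ≈-refl x y
  pow-2^-+ (suc k) x y = ≈-trans (pow-2^suc (x + y) k) (≈-trans (sq-cong (pow-2^-+ k x y))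
    (≈-trans (sq-+ _ _) (≈-sym (+-cong (pow-2^suc x k) (pow-2^suc y k)))))

  pow-0# : ∀ k → pow 0# (2 ℕ.^ k) ≈ 0#
  pow-0# zero    = zeroˡ _
  pow-0# (suc k) = ≈-trans (pow-2^suc 0# k) (≈-trans (*-congʳ (pow-0# k)) (zeroˡ _))

  -- x ↦ ax permutes the nonzero elements, so aᑫ⁻¹ = 1 by comparing products.
  pow-q-≉0 : ∀ a → ¬ (a ≈ 0#) → pow a q ≈ a
  pow-q-≉0 a a≉0 = begin
    pow a q                                         ≈⟨ consts E ⟨
    Mul.big E (λ _ → a)                             ≈⟨ Mul.big-cong E split ⟩
    Mul.big E (λ x → at0 a x * off0 a x)            ≈⟨ Mul.big-∙ E _ _ ⟩
    Mul.big E (at0 a) * Mul.big E (off0 a)          ≈⟨ *-congʳ (Mul-pick 0# (λ _ → a) (λ _ → ≈-refl)) ⟩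
    a * Mul.big E (off0 a)                          ≈⟨ *-congˡ off≈1 ⟩
    a * 1#                                          ≈⟨ *-identityʳ a ⟩
    a                                               ∎
    where
    open ≈-Reasoning
    consts : ∀ xs → Mul.big xs (λ _ → a) ≈ pow a (length xs)
    consts []       = ≈-refl
    consts (x ∷ xs) = *-congˡ (consts xs)
    -- All products stay indexed by the whole list `E`: `at0` carries the one factor a at the index
    -- 0, `off0` the other q - 1 factors.
    at0 off0 : Carrier → Carrier → Carrier
    at0 c x  = if does (x ≟ 0#) then c else 1#
    off0 c x = if does (x ≟ 0#) then 1# else c
    split : ∀ x → a ≈ at0 a x * off0 a x
    split x with does (x ≟ 0#)
    ... | true  = ≈-sym (*-identityʳ a)
    ... | false = ≈-sym (*-identityˡ a)
    -- The element 0 is replaced by 1, so that the product `P` is nonzero and can be cancelled.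
    g : Carrier → Carrier
    g x = off0 x x
    g-cong : ∀ {x y} → x ≈ y → g x ≈ g y
    g-cong {x} {y} e with x ≟ 0# | y ≟ 0#
    ... | yes _ | yes _ = ≈-refl
    ... | yes p | no n  = ⊥-elim (n (≈-trans (≈-sym e) p))
    ... | no n  | yes p = ⊥-elim (n (≈-trans e p))
    ... | no _  | no _  = e
    g-* : ∀ x → off0 a x * g x ≈ g (a * x)
    g-* x with x ≟ 0# | (a * x) ≟ 0#
    ... | yes _ | yes _ = *-identityˡ 1#
    ... | yes p | no n  = ⊥-elim (n (≈-trans (*-congˡ p) (zeroʳ a)))
    ... | no n  | yes p = ⊥-elim (x*y≉0 a≉0 n p)
    ... | no _  | no _  = ≈-refl
    P : Carrier
    P = Mul.big E g
    g≉0 : ∀ x → ¬ (g x ≈ 0#)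
    g≉0 x with x ≟ 0#
    ... | yes _ = 1≉0
    ... | no n  = n
    big≉0 : ∀ xs → ¬ (Mul.big xs g ≈ 0#)
    big≉0 []       = 1≉0
    big≉0 (x ∷ xs) = x*y≉0 (g≉0 x) (big≉0 xs)
    off≈1 : Mul.big E (off0 a) ≈ 1#
    off≈1 = cancelˡ (big≉0 E) (begin
      P * Mul.big E (off0 a)              ≈⟨ *-comm _ _ ⟩
      Mul.big E (off0 a) * P              ≈⟨ Mul.big-∙ E _ _ ⟨
      Mul.big E (λ x → off0 a x * g x)    ≈⟨ Mul.big-cong E g-* ⟩
      Mul.big E (λ x → g (a * x))         ≈⟨ MulR.reindex E Mul-pick (a *_) (a ⁻¹ *_) *-congˡ *-congˡ
                                               (λ x → ≈-trans (≈-sym (*-assoc _ _ _)) (≈-trans (*-congʳ (⁻¹-inv a a≉0)) (*-identityˡ x)))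
                                               (λ x → ≈-trans (≈-sym (*-assoc _ _ _)) (≈-trans (*-congʳ (⁻¹-invˡ a a≉0)) (*-identityˡ x)))
                                               g g-cong ⟩
      P                                   ≈⟨ *-identityʳ P ⟨
      P * 1#                              ∎)

  pow-2^r : ∀ a → pow a (2 ℕ.^ r) ≈ a
  pow-2^r a with a ≟ 0#
  ... | yes a≈0 = ≈-trans (pow-cong (2 ℕ.^ r) a≈0) (≈-trans (pow-0# r) (≈-sym a≈0))
  ... | no a≉0  = subst (λ k → pow a k ≈ a) |F|≡2^r (pow-q-≉0 a a≉0)

  tr-cong : ∀ {x y} → x ≈ y → tr x ≈ tr y
  tr-cong e = Add.big-cong (upTo r) (λ k → pow-cong (2 ℕ.^ k) e)

  tr-+ : ∀ x y → tr (x + y) ≈ tr x + tr y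
  tr-+ x y = ≈-trans (Add.big-cong (upTo r) (λ k → pow-2^-+ k x y)) (Add.big-∙ (upTo r) _ _)

  sq-big : {A : Set} (xs : List A) (f : A → Carrier) → sq (Add.big xs f) ≈ Add.big xs (sq ∘ f)
  sq-big []       f = zeroˡ 0#
  sq-big (x ∷ xs) f = ≈-trans (sq-+ _ _) (+-congˡ (sq-big xs f))

  -- Squaring moves each exponent 2^k to 2^(k+1), so the sum trades x for x^(2^r), which is x again.
  -- Adding x twice, which changes nothing, lets the two ranges be compared.
  sq-tr : ∀ x → sq (tr x) ≈ tr x
  sq-tr x = begin
    sq (tr x)                                                ≈⟨ sq-big (upTo r) _ ⟩
    Add.big (upTo r) (λ k → sq (pow x (2 ℕ.^ k)))            ≈⟨ Add.big-cong (upTo r) (λ k → pow-2^suc x k) ⟨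
    S                                                        ≈⟨ x+a+a S x ⟨
    (S + x) + x                                              ≈⟨ +-congʳ (+-comm S x) ⟩
    (x + S) + x                                              ≈⟨ +-congʳ (+-congʳ (*-identityʳ x)) ⟨
    (x * 1# + S) + x                                         ≈⟨ +-congʳ (Add.big-upTo-suc r (λ k → pow x (2 ℕ.^ k))) ⟨
    Add.big (upTo (suc r)) (λ k → pow x (2 ℕ.^ k)) + x       ≈⟨ +-congʳ (Add.big-upTo-snoc r (λ k → pow x (2 ℕ.^ k))) ⟩
    (tr x + pow x (2 ℕ.^ r)) + x                             ≈⟨ +-congʳ (+-congˡ (pow-2^r x)) ⟩
    (tr x + x) + x                                           ≈⟨ x+a+a (tr x) x ⟩
    tr x                                                     ∎
    where
    open ≈-Reasoning
    S = Add.big (upTo r) (λ k → pow x (2 ℕ.^ suc k))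

  tr-sq : ∀ x → tr (sq x) ≈ tr x
  tr-sq x = ≈-trans (Add.big-cong (upTo r) (λ k → pow-* x x (2 ℕ.^ k))) (≈-trans (≈-sym (sq-big (upTo r) _)) (sq-tr x))

  -- The trace is its own square, and a nonzero idempotent of a field is 1.
  tr∈𝔽₂ : ∀ x → tr x ≈ 0# ⊎ tr x ≈ 1#
  tr∈𝔽₂ x with tr x ≟ 0#
  ... | yes p = inj₁ p
  ... | no n  = inj₂ (cancelˡ n (≈-trans (sq-tr x) (≈-sym (*-identityʳ _))))

  -- Lead d ℓ f: f is a polynomial function of degree at most d whose coefficient of xᵈ is ℓ.
  Lead : ℕ → Carrier → (Carrier → Carrier) → Set
  Lead zero    ℓ f = ∀ x → f x ≈ ℓ
  Lead (suc d) ℓ f = Σ (Carrier → Carrier) λ g → Lead d ℓ g × ∃ λ c → ∀ x → f x ≈ x * g x + c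

  Lead-+ : ∀ d {ℓ m f g} → Lead d ℓ f → Lead d m g → Lead d (ℓ + m) (λ x → f x + g x)
  Lead-+ zero    p q x = +-cong (p x) (q x)
  Lead-+ (suc d) (f′ , p , c , e) (g′ , q , c′ , e′) = _ , Lead-+ d p q , c + c′ , λ x →
    ≈-trans (+-cong (e x) (e′ x))
      (solve 5 (λ x a b c d → (x :* a :+ b) :+ (x :* c :+ d) := x :* (a :+ c) :+ (b :+ d)) ≈-refl x (f′ x) c (g′ x) c′)

  Lead-* : ∀ d {ℓ f} a → Lead d ℓ f → Lead d (a * ℓ) (λ x → a * f x)
  Lead-* zero    a p x = *-congˡ (p x)
  Lead-* (suc d) a (f′ , p , c , e) = _ , Lead-* d a p , a * c , λ x → ≈-trans (*-congˡ (e x))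
      (solve 4 (λ a x f c → a :* (x :* f :+ c) := x :* (a :* f) :+ a :* c) ≈-refl a x (f′ x) c)

  Lead-resp : ∀ d {ℓ m f g} → ℓ ≈ m → (∀ x → f x ≈ g x) → Lead d ℓ f → Lead d m g
  Lead-resp zero    e e′ p x = ≈-trans (≈-sym (e′ x)) (≈-trans (p x) e)
  Lead-resp (suc d) e e′ (f′ , p , c , h) =
    f′ , Lead-resp d e (λ _ → ≈-refl) p , c , λ x → ≈-trans (≈-sym (e′ x)) (h x)

  Lead-raise : ∀ d {ℓ f} → Lead d ℓ f → Lead (suc d) 0# f
  Lead-raise zero    {ℓ} p = (λ _ → 0#) , (λ _ → ≈-refl) , ℓ , λ x →
    ≈-trans (p x) (≈-sym (≈-trans (+-congʳ (zeroʳ x)) (+-identityˡ ℓ)))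
  Lead-raise (suc d) (f′ , p , c , e) = f′ , Lead-raise d p , c , e

  Lead-raise< : ∀ {d d′ ℓ f} → d ℕ.<′ d′ → Lead d ℓ f → Lead d′ 0# f
  Lead-raise< ℕ.<′-base       p = Lead-raise _ p
  Lead-raise< (ℕ.≤′-step d<n) p = Lead-raise _ (Lead-raise< d<n p)

  Lead-pow : ∀ n → Lead n 1# (λ x → pow x n)
  Lead-pow zero    x = ≈-refl
  Lead-pow (suc n) = _ , Lead-pow n , 0# , λ x → ≈-sym (+-identityʳ _)

  -- Division with remainder by x + a, which is x - a in characteristic two. If g = (x + a) k +
  -- g(a), then x g + c has the quotient g + a k; since k has smaller degree, the leading
  -- coefficient of g survives.
  Lead-factor : ∀ d {ℓ f} → Lead (suc d) ℓ f → ∀ a → Σ (Carrier → Carrier) λ h → Lead d ℓ h × (∀ x → f x ≈ (x + a) * h x + f a)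
  Lead-factor zero {ℓ} {f} (g , p , c , e) a = g , p , λ x → begin
    f x                           ≈⟨ e x ⟩
    x * g x + c                   ≈⟨ +-congˡ (≈-trans (+-congʳ (x+x≈0 (a * ℓ))) (+-identityˡ c)) ⟨
    x * g x + ((a * ℓ + a * ℓ) + c)   ≈⟨ +-congˡ (+-congʳ (+-cong (*-congˡ (p x)) (*-congˡ (p a)))) ⟨
    x * g x + ((a * g x + a * g a) + c)   ≈⟨ solve 5 (λ x a gx ga c → x :* gx :+ ((a :* gx :+ a :* ga) :+ c)
                                               := (x :+ a) :* gx :+ (a :* ga :+ c)) ≈-refl x a (g x) (g a) c ⟩
    (x + a) * g x + (a * g a + c) ≈⟨ +-congˡ (e a) ⟨
    (x + a) * g x + f a           ∎
    where open ≈-Reasoning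
  Lead-factor (suc d) {ℓ} {f} (g , p , c , e) a with Lead-factor d p a
  ... | k , pk , ek = (λ x → g x + a * k x)
      , Lead-resp (suc d) (≈-trans (+-congˡ (zeroʳ a)) (+-identityʳ ℓ)) (λ _ → ≈-refl)
          (Lead-+ (suc d) p (Lead-* (suc d) a (Lead-raise d pk)))
      , λ x → begin
    f x                                ≈⟨ e x ⟩
    x * g x + c                        ≈⟨ +-congˡ (≈-trans (+-congʳ (x+x≈0 (a * g x))) (+-identityˡ c)) ⟨
    x * g x + ((a * g x + a * g x) + c)  ≈⟨ +-congˡ (+-congʳ (+-congˡ (*-congˡ (ek x)))) ⟩
    x * g x + ((a * g x + a * ((x + a) * k x + g a)) + c)
      ≈⟨ solve 6 (λ x a gx kx ga c → x :* gx :+ ((a :* gx :+ a :* ((x :+ a) :* kx :+ ga)) :+ c)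
            := (x :+ a) :* (gx :+ a :* kx) :+ (a :* ga :+ c)) ≈-refl x a (g x) (k x) (g a) c ⟩
    (x + a) * (g x + a * k x) + (a * g a + c) ≈⟨ +-congˡ (e a) ⟨
    (x + a) * (g x + a * k x) + f a    ∎
    where open ≈-Reasoning

  -- Dividing by x + a at the first root a leaves a quotient with the same ℓ that vanishes at the
  -- other points of the list. When the degree has reached 0 a point is still left, and there the
  -- value is ℓ.
  root-bound : ∀ d {ℓ f} → Lead d ℓ f → (xs : List Carrier) → d ℕ.< length xs →
    AllPairs (λ x y → ¬ (x ≈ y)) xs → All (λ x → f x ≈ 0#) xs → ℓ ≈ 0#
  root-bound zero    p (x ∷ xs) _ _ (e ∷ _) = ≈-trans (≈-sym (p x)) e
  root-bound (suc d) {ℓ} {f} p (a ∷ xs) (s≤s d<) (a≉ ∷ ds) (fa≈0 ∷ zs) with Lead-factor d p a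
  ... | h , ph , eh = root-bound d ph xs d< ds (All.zipWith root (a≉ , zs))
    where
    root : ∀ {x} → ¬ (a ≈ x) × f x ≈ 0# → h x ≈ 0#
    root {x} (a≉x , fx≈0) = cancelˡ (λ e → a≉x (≈-sym (x+y≈0⇒x≈y e)))
      (≈-trans (≈-trans (≈-sym (≈-trans (eh x) (≈-trans (+-congˡ fa≈0) (+-identityʳ _)))) fx≈0) (≈-sym (zeroʳ _)))

  Lead-tr : ∀ k → Lead (2 ℕ.^ k) 1# (λ x → Add.big (upTo (suc k)) (λ i → pow x (2 ℕ.^ i)))
  Lead-tr zero    = Lead-resp 1 ≈-refl (λ x → ≈-sym (+-identityʳ _)) (Lead-pow 1)
  Lead-tr (suc k) = Lead-resp (2 ℕ.^ suc k) (+-identityˡ 1#)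
    (λ x → ≈-sym (Add.big-upTo-snoc (suc k) (λ i → pow x (2 ℕ.^ i))))
    (Lead-+ (2 ℕ.^ suc k) (Lead-raise< (ℕP.<⇒<′ (ℕP.^-monoʳ-< 2 (s≤s (s≤s z≤n)) (ℕP.n<1+n k))) (Lead-tr k))
      (Lead-pow (2 ℕ.^ suc k)))

  -- The trace is a monic polynomial function of degree 2^(r-1), less than the number 2^r of
  -- elements. If it vanished everywhere, its leading coefficient 1 would be 0.
  tr-nontrivial : ¬ All (λ x → tr x ≈ 0#) E
  tr-nontrivial = go r 1≤r |F|≡2^r
    where
    go : ∀ k → 1 ℕ.≤ k → length E ≡ 2 ℕ.^ k → ¬ All (λ x → Add.big (upTo k) (λ i → pow x (2 ℕ.^ i)) ≈ 0#) E
    go (suc k) _ e all = 1≉0 (root-bound (2 ℕ.^ k) (Lead-tr k) E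
      (subst (2 ℕ.^ k ℕ.<_) (≡.sym e) (ℕP.^-monoʳ-< 2 (s≤s (s≤s z≤n)) (ℕP.n<1+n k))) distinct all)

  -- Sums over the field and over its nonzero elements

  Q : ℤ
  Q = + q

  ∑-pick : SumR.Picks E
  ∑-pick = SumR.picks E complete distinct

  ⟦≟⟧-cong : ∀ {x y x′ y′} → (x ≈ y → x′ ≈ y′) → (x′ ≈ y′ → x ≈ y) → ⟦ does (x ≟ y) ⟧ ≡ ⟦ does (x′ ≟ y′) ⟧
  ⟦≟⟧-cong f g = cong ⟦_⟧ (does-cong (_ ≟ _) (_ ≟ _) f g)

  ∑-δ : ∀ z (g : Carrier → ℤ) → (∀ {x y} → x ≈ y → g x ≡ g y) → ∑ E (λ x → ⟦ does (x ≟ z) ⟧ ℤ.* g x) ≡ g z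
  ∑-δ z g gc = ≡.trans (∑-cong E (λ x → ≡.sym (if-⟦⟧ (does (x ≟ z)) (g x)))) (∑-pick z g gc)

  ∑-δ-1 : ∀ z → ∑ E (λ x → ⟦ does (x ≟ z) ⟧) ≡ 1ℤ
  ∑-δ-1 z = ≡.trans (∑-cong E (λ x → ≡.sym (ℤP.*-identityʳ _))) (∑-δ z (λ _ → 1ℤ) (λ _ → refl))

  ∑-shift : ∀ a (g : Carrier → ℤ) → (∀ {x y} → x ≈ y → g x ≡ g y) → ∑ E (λ x → g (x + a)) ≡ ∑ E g
  ∑-shift a g gc = SumR.reindex E ∑-pick (_+ a) (_+ a) +-congʳ +-congʳ (λ x → x+a+a x a) (λ x → x+a+a x a) g gc

  x*a*a⁻¹ : ∀ {a} x → ¬ (a ≈ 0#) → (x * a) * a ⁻¹ ≈ x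
  x*a*a⁻¹ {a} x a≉0 = ≈-trans (*-assoc _ _ _) (≈-trans (*-congˡ (⁻¹-inv a a≉0)) (*-identityʳ x))

  x*a⁻¹*a : ∀ {a} x → ¬ (a ≈ 0#) → (x * a ⁻¹) * a ≈ x
  x*a⁻¹*a {a} x a≉0 = ≈-trans (*-assoc _ _ _) (≈-trans (*-congˡ (⁻¹-invˡ a a≉0)) (*-identityʳ x))

  ∑-scale : ∀ {a} → ¬ (a ≈ 0#) → (g : Carrier → ℤ) → (∀ {x y} → x ≈ y → g x ≡ g y) → ∑ E (λ x → g (x * a)) ≡ ∑ E g
  ∑-scale {a} a≉0 g gc = SumR.reindex E ∑-pick (_* a) (_* a ⁻¹) *-congʳ *-congʳ
    (λ x → x*a⁻¹*a x a≉0) (λ x → x*a*a⁻¹ x a≉0) g gc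

  -- Squaring is inverted by x ↦ x^(2^(r-1)), because x^(2^r) = x. The local `go` writes r as k + 1
  -- to have that exponent.
  ∑-sq : (g : Carrier → ℤ) → (∀ {x y} → x ≈ y → g x ≡ g y) → ∑ E (λ x → g (sq x)) ≡ ∑ E g
  ∑-sq g gc = go r 1≤r pow-2^r
    where
    go : ∀ k → 1 ℕ.≤ k → (∀ a → pow a (2 ℕ.^ k) ≈ a) → ∑ E (λ x → g (sq x)) ≡ ∑ E g
    go (suc k) _ fix = SumR.reindex E ∑-pick sq (λ x → pow x (2 ℕ.^ k)) sq-cong (pow-cong (2 ℕ.^ k))
      (λ x → ≈-trans (≈-sym (pow-2^suc x k)) (fix x))
      (λ x → ≈-trans (pow-* x x (2 ℕ.^ k)) (≈-trans (≈-sym (pow-2^suc x k)) (fix x))) g gc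

  unit : Carrier → ℤ
  unit x = ⟦ not (isZero x) ⟧

  unit-≉0 : ∀ {x} → ¬ (x ≈ 0#) → unit x ≡ 1ℤ
  unit-≉0 {x} x≉0 = cong (⟦_⟧ ∘ not) (dec-false (x ≟ 0#) x≉0)

  unit-≈0 : ∀ {x} → x ≈ 0# → unit x ≡ 0ℤ
  unit-≈0 {x} x≈0 = cong (⟦_⟧ ∘ not) (dec-true (x ≟ 0#) x≈0)

  unit-iff : ∀ {x y} → (x ≈ 0# → y ≈ 0#) → (y ≈ 0# → x ≈ 0#) → unit x ≡ unit y
  unit-iff f g = cong (⟦_⟧ ∘ not) (does-cong (_ ≟ 0#) (_ ≟ 0#) f g)

  unit-cong : ∀ {x y} → x ≈ y → unit x ≡ unit y
  unit-cong e = unit-iff (≈-trans (≈-sym e)) (≈-trans e)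

  unit-when : ∀ x {a b : ℤ} → (¬ (x ≈ 0#) → a ≡ b) → unit x ℤ.* a ≡ unit x ℤ.* b
  unit-when x e with x ≟ 0#
  ... | yes _ = refl
  ... | no n  = cong (1ℤ ℤ.*_) (e n)

  -- Nonzero elements are selected by a weight instead of a sublist, so that every substitution
  -- takes place over the full enumeration `E`.
  ∑ˣ : (Carrier → ℤ) → ℤ
  ∑ˣ f = ∑ E (λ x → unit x ℤ.* f x)

  ∑-nonzeros : ∀ f → ∑ nonzeros f ≡ ∑ˣ f
  ∑-nonzeros f = ∑-filter (λ x → not (isZero x)) E f

  ∑ˣ-cong : ∀ {f g} → (∀ x → ¬ (x ≈ 0#) → f x ≡ g x) → ∑ˣ f ≡ ∑ˣ g
  ∑ˣ-cong e = ∑-cong E (λ x → unit-when x (e x))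

  ∑-split0 : ∀ f → (∀ {x y} → x ≈ y → f x ≡ f y) → ∑ E f ≡ f 0# ℤ.+ ∑ˣ f
  ∑-split0 f fc = begin
    ∑ E f
      ≡⟨ ∑-cong E (λ x → ≡.trans (≡.sym (ℤP.*-identityˡ (f x))) (≡.trans (cong (ℤ._* f x) (≡.sym (one x)))
           (ℤP.*-distribʳ-+ (f x) ⟦ does (x ≟ 0#) ⟧ (unit x)))) ⟩
    ∑ E (λ x → ⟦ does (x ≟ 0#) ⟧ ℤ.* f x ℤ.+ unit x ℤ.* f x)
      ≡⟨ ∑-+ E _ _ ⟩
    ∑ E (λ x → ⟦ does (x ≟ 0#) ⟧ ℤ.* f x) ℤ.+ ∑ˣ f
      ≡⟨ cong (ℤ._+ ∑ˣ f) (∑-δ 0# f fc) ⟩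
    f 0# ℤ.+ ∑ˣ f ∎
    where
    open ≡-Reasoning
    one : ∀ x → ⟦ does (x ≟ 0#) ⟧ ℤ.+ unit x ≡ 1ℤ
    one x with does (x ≟ 0#)
    ... | true  = refl
    ... | false = refl

  ∑ˣ-*ˡ : ∀ c f → ∑ˣ (λ x → c ℤ.* f x) ≡ c ℤ.* ∑ˣ f
  ∑ˣ-*ˡ c f = ≡.trans (∑-cong E (λ x → lemma (unit x) c (f x))) (∑-*ˡ E c _)
    where
    lemma : ∀ u c y → u ℤ.* (c ℤ.* y) ≡ c ℤ.* (u ℤ.* y)
    lemma = solve-∀

  ∑ˣ-*ʳ : ∀ c f → ∑ˣ (λ x → f x ℤ.* c) ≡ ∑ˣ f ℤ.* c
  ∑ˣ-*ʳ c f = ≡.trans (∑-cong E (λ x → ≡.sym (ℤP.*-assoc (unit x) (f x) c))) (∑-*ʳ E c _)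

  ∑ˣ-+ : ∀ f g → ∑ˣ (λ x → f x ℤ.+ g x) ≡ ∑ˣ f ℤ.+ ∑ˣ g
  ∑ˣ-+ f g = ≡.trans (∑-cong E (λ x → ℤP.*-distribˡ-+ (unit x) (f x) (g x))) (∑-+ E _ _)

  ∑ˣ-swap-∑ : {A : Set} (xs : List A) (f : Carrier → A → ℤ) → ∑ˣ (λ x → ∑ xs (f x)) ≡ ∑ xs (λ y → ∑ˣ (λ x → f x y))
  ∑ˣ-swap-∑ xs f = ≡.trans (∑-cong E (λ x → ≡.sym (∑-*ˡ xs (unit x) (f x)))) (∑-swap E xs _)

  ∑ˣ-swap : ∀ (f : Carrier → Carrier → ℤ) → ∑ˣ (λ x → ∑ˣ (f x)) ≡ ∑ˣ (λ y → ∑ˣ (λ x → f x y))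
  ∑ˣ-swap f = ≡.trans (∑ˣ-swap-∑ E _) (∑-cong E (λ y → ∑ˣ-*ˡ (unit y) (λ x → f x y)))

  ∑ˣ-scale : ∀ {a} → ¬ (a ≈ 0#) → (g : Carrier → ℤ) → (∀ {x y} → ¬ (x ≈ 0#) → x ≈ y → g x ≡ g y) → ∑ˣ (λ x → g (x * a)) ≡ ∑ˣ g
  ∑ˣ-scale {a} a≉0 g gc = ≡.trans
    (∑-cong E (λ x → cong (ℤ._* g (x * a)) (unit-iff (λ e → ≈-trans (*-congʳ e) (zeroˡ a)) (back x))))
    (∑-scale a≉0 (λ x → unit x ℤ.* g x) (λ {x} {y} e → ≡.trans (unit-when x (λ n → gc n e)) (cong (ℤ._* g y) (unit-cong e))))
    where
    back : ∀ x → x * a ≈ 0# → x ≈ 0#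
    back x e with x ≟ 0#
    ... | yes p = p
    ... | no n  = ⊥-elim (x*y≉0 n a≉0 e)

  -- The value of `0# ⁻¹` is arbitrary, so inversion is replaced by `inv`, which fixes 0 and is an
  -- involution of the whole field.
  ∑ˣ-inv : (g : Carrier → ℤ) → (∀ {x y} → ¬ (x ≈ 0#) → x ≈ y → g x ≡ g y) → ∑ˣ (λ x → g (x ⁻¹)) ≡ ∑ˣ g
  ∑ˣ-inv g gc = ≡.trans (∑-cong E step) (SumR.reindex E ∑-pick inv inv inv-cong inv-cong inv-inv inv-inv
      (λ x → unit x ℤ.* g x) (λ {x} {y} e → ≡.trans (unit-when x (λ n → gc n e)) (cong (ℤ._* g y) (unit-cong e))))
    where
    inv : Carrier → Carrier
    inv x = if does (x ≟ 0#) then 0# else x ⁻¹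
    inv-0 : ∀ {x} → x ≈ 0# → inv x ≈ 0#
    inv-0 {x} e = ≈-reflexive (cong (if_then 0# else x ⁻¹) (dec-true (x ≟ 0#) e))
    inv-≉0 : ∀ {x} → ¬ (x ≈ 0#) → inv x ≈ x ⁻¹
    inv-≉0 {x} e = ≈-reflexive (cong (if_then 0# else x ⁻¹) (dec-false (x ≟ 0#) e))
    inv-cong : ∀ {x y} → x ≈ y → inv x ≈ inv y
    inv-cong {x} {y} e with x ≟ 0# | y ≟ 0#
    ... | yes _ | yes _ = ≈-refl
    ... | yes p | no n  = ⊥-elim (n (≈-trans (≈-sym e) p))
    ... | no n  | yes p = ⊥-elim (n (≈-trans e p))
    ... | no n  | no _  = ⁻¹-cong n e
    inv-inv : ∀ x → inv (inv x) ≈ x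
    inv-inv x = h (x ≟ 0#)
      where
      h : Dec (x ≈ 0#) → inv (inv x) ≈ x
      h (yes e) = ≈-trans (inv-0 (inv-0 e)) (≈-sym e)
      h (no n) = ≈-trans (inv-cong (inv-≉0 n)) (≈-trans (inv-≉0 (x⁻¹≉0 n)) (⁻¹-⁻¹ n))
    step : ∀ x → unit x ℤ.* g (x ⁻¹) ≡ unit (inv x) ℤ.* g (inv x)
    step x = h (x ≟ 0#)
      where
      h : Dec (x ≈ 0#) → unit x ℤ.* g (x ⁻¹) ≡ unit (inv x) ℤ.* g (inv x)
      h (yes e) = ≡.trans (cong (ℤ._* g (x ⁻¹)) (unit-≈0 e)) (≡.sym (cong (ℤ._* g (inv x)) (unit-≈0 (inv-0 e))))
      h (no n) = ≡.trans (cong (ℤ._* g (x ⁻¹)) (≡.trans (unit-≉0 n) (≡.sym (unit-≉0 (x⁻¹≉0 n)))))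
        (≡.trans (unit-when (x ⁻¹) (λ n′ → gc n′ (≈-sym (inv-≉0 n)))) (cong (ℤ._* g (inv x)) (unit-cong (≈-sym (inv-≉0 n)))))

  -- The additive character

  lam-cong : ∀ {x y} → x ≈ y → lam x ≡ lam y
  lam-cong e = cong (if_then 1ℤ else -1ℤ) (does-cong (_ ≟ 0#) (_ ≟ 0#)
    (≈-trans (≈-sym (tr-cong e))) (≈-trans (tr-cong e)))

  lam-tr0 : ∀ {x} → tr x ≈ 0# → lam x ≡ 1ℤ
  lam-tr0 {x} e = cong (if_then 1ℤ else -1ℤ) (dec-true (tr x ≟ 0#) e)

  lam-tr1 : ∀ {x} → tr x ≈ 1# → lam x ≡ -1ℤ
  lam-tr1 {x} e = cong (if_then 1ℤ else -1ℤ) (dec-false (tr x ≟ 0#) (λ e′ → 1≉0 (≈-trans (≈-sym e) e′)))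

  lam-+ : ∀ x y → lam (x + y) ≡ lam x ℤ.* lam y
  lam-+ x y with tr∈𝔽₂ x | tr∈𝔽₂ y
  ... | inj₁ p | inj₁ p′ = ≡.trans (lam-tr0 (≈-trans (tr-+ x y) (≈-trans (+-cong p p′) (+-identityˡ 0#))))
    (≡.sym (cong₂ ℤ._*_ (lam-tr0 p) (lam-tr0 p′)))
  ... | inj₁ p | inj₂ p′ = ≡.trans (lam-tr1 (≈-trans (tr-+ x y) (≈-trans (+-cong p p′) (+-identityˡ 1#))))
    (≡.sym (cong₂ ℤ._*_ (lam-tr0 p) (lam-tr1 p′)))
  ... | inj₂ p | inj₁ p′ = ≡.trans (lam-tr1 (≈-trans (tr-+ x y) (≈-trans (+-cong p p′) (+-identityʳ 1#))))
    (≡.sym (cong₂ ℤ._*_ (lam-tr1 p) (lam-tr0 p′)))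
  ... | inj₂ p | inj₂ p′ = ≡.trans (lam-tr0 (≈-trans (tr-+ x y) (≈-trans (+-cong p p′) 1+1≈0)))
    (≡.sym (cong₂ ℤ._*_ (lam-tr1 p) (lam-tr1 p′)))

  lam-sq : ∀ x → lam (sq x) ≡ lam x
  lam-sq x = cong (if_then 1ℤ else -1ℤ) (does-cong (_ ≟ 0#) (_ ≟ 0#)
    (≈-trans (≈-sym (tr-sq x))) (≈-trans (tr-sq x)))

  lam-0 : ∀ {x} → x ≈ 0# → lam x ≡ 1ℤ
  lam-0 {x} e = lam-tr0 (≈-trans (tr-cong e) (≈-trans (Add.big-cong (upTo r) pow-0#) (Add.big-ε (upTo r))))

  lam-nontrivial : ∃ λ z → lam z ≡ -1ℤ
  lam-nontrivial with satisfied (¬All⇒Any¬ (λ x → tr x ≟ 0#) E tr-nontrivial)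
  ... | z , n = z , cong (if_then 1ℤ else -1ℤ) (dec-false (tr z ≟ 0#) n)

  -- Translation by some z with λ(z) = -1 permutes the field and reverses the sign of the sum.
  ∑-lam : ∑ E lam ≡ 0ℤ
  ∑-lam with lam-nontrivial
  ... | z , lz = x≡-x⇒x≡0 (begin
    ∑ E lam                        ≡⟨ ∑-shift z lam lam-cong ⟨
    ∑ E (λ x → lam (x + z))        ≡⟨ ∑-cong E (λ x → ≡.trans (lam-+ x z) (cong (lam x ℤ.*_) lz)) ⟩
    ∑ E (λ x → lam x ℤ.* -1ℤ)      ≡⟨ ∑-*ʳ E -1ℤ lam ⟩
    ∑ E lam ℤ.* -1ℤ                ≡⟨ ℤP.*-comm _ -1ℤ ⟩
    -1ℤ ℤ.* ∑ E lam                ≡⟨ ℤP.-1*i≡-i _ ⟩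
    ℤ.- ∑ E lam                    ∎)
    where
    open ≡-Reasoning
    x≡-x⇒x≡0 : ∀ {x : ℤ} → x ≡ ℤ.- x → x ≡ 0ℤ
    x≡-x⇒x≡0 {+ zero}     e = refl
    x≡-x⇒x≡0 {+ suc n}    ()
    x≡-x⇒x≡0 {ℤ.-[1+ n ]} ()

  ∑-lam-* : ∀ a → ∑ E (λ x → lam (x * a)) ≡ Q ℤ.* ⟦ isZero a ⟧
  ∑-lam-* a with a ≟ 0#
  ... | yes e = ≡.trans (∑-cong E (λ x → lam-0 (≈-trans (*-congˡ e) (zeroʳ x)))) (∑-const E 1ℤ)
  ... | no n  = ≡.trans (∑-scale n lam lam-cong) (≡.trans ∑-lam (≡.sym (ℤP.*-zeroʳ Q)))

  ∑ˣ-lam-* : ∀ a → ∑ˣ (λ x → lam (x * a)) ≡ Q ℤ.* ⟦ isZero a ⟧ ℤ.- 1ℤ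
  ∑ˣ-lam-* a = begin
    S                              ≡⟨ lemma S ⟩
    (1ℤ ℤ.+ S) ℤ.- 1ℤ              ≡⟨ cong (λ l → (l ℤ.+ S) ℤ.- 1ℤ) (lam-0 (zeroˡ a)) ⟨
    (lam (0# * a) ℤ.+ S) ℤ.- 1ℤ    ≡⟨ cong (ℤ._- 1ℤ) (∑-split0 (λ x → lam (x * a)) (λ e → lam-cong (*-congʳ e))) ⟨
    ∑ E (λ x → lam (x * a)) ℤ.- 1ℤ ≡⟨ cong (ℤ._- 1ℤ) (∑-lam-* a) ⟩
    Q ℤ.* ⟦ isZero a ⟧ ℤ.- 1ℤ      ∎
    where
    open ≡-Reasoning
    S = ∑ˣ (λ x → lam (x * a))
    lemma : ∀ s → s ≡ (1ℤ ℤ.+ s) ℤ.- 1ℤ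
    lemma = solve-∀

  ∑ˣ-lam : ∑ˣ lam ≡ -1ℤ
  ∑ˣ-lam = begin
    ∑ˣ lam                           ≡⟨ ∑ˣ-cong (λ x _ → lam-cong (*-identityʳ x)) ⟨
    ∑ˣ (λ x → lam (x * 1#))          ≡⟨ ∑ˣ-lam-* 1# ⟩
    Q ℤ.* ⟦ isZero 1# ⟧ ℤ.- 1ℤ       ≡⟨ cong (λ b → Q ℤ.* b ℤ.- 1ℤ) (⟦no⟧ (1# ≟ 0#) 1≉0) ⟩
    Q ℤ.* 0ℤ ℤ.- 1ℤ                  ≡⟨ cong (ℤ._- 1ℤ) (ℤP.*-zeroʳ Q) ⟩
    -1ℤ                              ∎
    where open ≡-Reasoning

  -- Kloosterman sums

  ∑-tuples-cong : ∀ m {f g : List Carrier → ℤ} → (∀ t → ¬ (prodF t ≈ 0#) → f t ≡ g t) →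
    ∑ (tuples m nonzeros) f ≡ ∑ (tuples m nonzeros) g
  ∑-tuples-cong zero    {f} {g} e = cong (ℤ._+ 0ℤ) (e [] 1≉0)
  ∑-tuples-cong (suc m) {f} {g} e = begin
    ∑ (tuples (suc m) nonzeros) f                                  ≡⟨ ∑-tuples-suc m nonzeros f ⟩
    ∑ nonzeros (λ x → ∑ (tuples m nonzeros) (λ t → f (x ∷ t)))     ≡⟨ ∑-nonzeros _ ⟩
    ∑ˣ (λ x → ∑ (tuples m nonzeros) (λ t → f (x ∷ t)))             ≡⟨ ∑ˣ-cong (λ x x≉0 → ∑-tuples-cong m (λ t t≉0 → e (x ∷ t) (x*y≉0 x≉0 t≉0))) ⟩
    ∑ˣ (λ x → ∑ (tuples m nonzeros) (λ t → g (x ∷ t)))             ≡⟨ ∑-nonzeros _ ⟨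
    ∑ nonzeros (λ x → ∑ (tuples m nonzeros) (λ t → g (x ∷ t)))     ≡⟨ ∑-tuples-suc m nonzeros g ⟨
    ∑ (tuples (suc m) nonzeros) g                                  ∎
    where open ≡-Reasoning

  -- The convention for m = 0 agrees with the single empty tuple, of sum 0 and product 1. One
  -- formula for all m lets the recursion start at `K 0`.
  K-∑ : ∀ m a → K m a ≡ ∑ (tuples m nonzeros) (λ t → lam (sumF t + a * prodF t ⁻¹))
  K-∑ (suc m) a = refl
  K-∑ zero    a = ≡.sym (≡.trans (ℤP.+-identityʳ _) (lam-cong (≈-trans (+-identityˡ _)
    (≈-trans (*-congˡ (≈-sym (⁻¹-unique 1≉0 (*-identityˡ 1#)))) (*-identityʳ a)))))

  K-cong : ∀ m {a b} → a ≈ b → K m a ≡ K m b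
  K-cong m {a} {b} e = ≡.trans (K-∑ m a) (≡.trans (∑-cong (tuples m nonzeros) (λ t → lam-cong (+-congˡ (*-congʳ e)))) (≡.sym (K-∑ m b)))

  K-suc : ∀ m a → K (suc m) a ≡ ∑ˣ (λ α → lam α ℤ.* K m (a * α ⁻¹))
  K-suc m a = begin
    K (suc m) a
      ≡⟨ ∑-tuples-suc m nonzeros _ ⟩
    ∑ nonzeros (λ α → ∑ (tuples m nonzeros) (λ t → lam ((α + sumF t) + a * (α * prodF t) ⁻¹)))
      ≡⟨ ∑-nonzeros _ ⟩
    ∑ˣ (λ α → ∑ (tuples m nonzeros) (λ t → lam ((α + sumF t) + a * (α * prodF t) ⁻¹)))
      ≡⟨ ∑ˣ-cong (λ α α≉0 → ∑-tuples-cong m (λ t t≉0 → ≡.trans (lam-cong (split α t α≉0 t≉0)) (lam-+ α _))) ⟩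
    ∑ˣ (λ α → ∑ (tuples m nonzeros) (λ t → lam α ℤ.* lam (sumF t + (a * α ⁻¹) * prodF t ⁻¹)))
      ≡⟨ ∑ˣ-cong (λ α _ → ≡.trans (∑-*ˡ (tuples m nonzeros) (lam α) _) (cong (lam α ℤ.*_) (≡.sym (K-∑ m (a * α ⁻¹))))) ⟩
    ∑ˣ (λ α → lam α ℤ.* K m (a * α ⁻¹)) ∎
    where
    open ≡-Reasoning
    split : ∀ α t → ¬ (α ≈ 0#) → ¬ (prodF t ≈ 0#) →
      (α + sumF t) + a * (α * prodF t) ⁻¹ ≈ α + (sumF t + (a * α ⁻¹) * prodF t ⁻¹)
    split α t α≉0 t≉0 = ≈-trans (+-congˡ (*-congˡ (⁻¹-* α≉0 t≉0)))
      (solve 5 (λ α s a i p → (α :+ s) :+ a :* (i :* p) := α :+ (s :+ (a :* i) :* p)) ≈-refl α (sumF t) a (α ⁻¹) (prodF t ⁻¹))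

  -- Substitute α² for α in the recursion: λ is invariant under squaring, and a² / α² is again a
  -- square, so induction on m applies.
  K-sq : ∀ m a → K m (sq a) ≡ K m a
  K-sq zero    a = lam-sq a
  K-sq (suc m) a = begin
    K (suc m) (sq a)
      ≡⟨ K-suc m (sq a) ⟩
    ∑ˣ (λ α → lam α ℤ.* K m (sq a * α ⁻¹))
      ≡⟨ ∑-sq (λ α → unit α ℤ.* (lam α ℤ.* K m (sq a * α ⁻¹)))
           (λ {x} {y} e → ≡.trans
             (unit-when x (λ n → cong₂ ℤ._*_ (lam-cong e) (K-cong m (*-congˡ (⁻¹-cong n e)))))
             (cong (ℤ._* (lam y ℤ.* K m (sq a * y ⁻¹))) (unit-cong e))) ⟨
    ∑ E (λ α → unit (sq α) ℤ.* (lam (sq α) ℤ.* K m (sq a * sq α ⁻¹)))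
      ≡⟨ ∑-cong E (λ α → cong (ℤ._* (lam (sq α) ℤ.* K m (sq a * sq α ⁻¹))) (unit-iff (sq≈0 α) (λ e → ≈-trans (*-congʳ e) (zeroˡ α)))) ⟩
    ∑ˣ (λ α → lam (sq α) ℤ.* K m (sq a * sq α ⁻¹))
      ≡⟨ ∑ˣ-cong (λ α n → cong₂ ℤ._*_ (lam-sq α) (≡.trans (K-cong m (quot α n)) (K-sq m (a * α ⁻¹)))) ⟩
    ∑ˣ (λ α → lam α ℤ.* K m (a * α ⁻¹))
      ≡⟨ K-suc m a ⟨
    K (suc m) a ∎
    where
    open ≡-Reasoning
    sq≈0 : ∀ α → sq α ≈ 0# → α ≈ 0#
    sq≈0 α e with α ≟ 0#
    ... | yes p = p
    ... | no n  = ⊥-elim (x*y≉0 n n e)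
    quot : ∀ α → ¬ (α ≈ 0#) → sq a * sq α ⁻¹ ≈ sq (a * α ⁻¹)
    quot α n = ≈-trans (*-congˡ (⁻¹-* n n))
      (solve 2 (λ a i → (a :* a) :* (i :* i) := (a :* i) :* (a :* i)) ≈-refl a (α ⁻¹))

  K-pow-2^ : ∀ m s a → K m (pow a (2 ℕ.^ s)) ≡ K m a
  K-pow-2^ m zero    a = K-cong m (*-identityʳ a)
  K-pow-2^ m (suc s) a = ≡.trans (K-cong m (pow-2^suc a s)) (≡.trans (K-sq m _) (K-pow-2^ m s a))

  -- Fourier transforms of the Kloosterman sums

  signℤ : ℕ → ℤ
  signℤ m = -1ℤ ℤ.^ m

  -- The Fourier transform of `K m` over the nonzero elements. It arises when matrices of trace β
  -- are counted by additive characters.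
  J : ℕ → Carrier → ℤ
  J m β = ∑ˣ (λ a → lam (a * β) ℤ.* K m a)

  J-cong : ∀ m {β γ} → β ≈ γ → J m β ≡ J m γ
  J-cong m e = ∑ˣ-cong (λ a _ → cong (ℤ._* K m a) (lam-cong (*-congˡ e)))

  -- Once a is replaced by a α, the parameter a α / α is free of α, and λ(a α β) exhibits the
  -- transform at α β.
  J-suc : ∀ m β → J (suc m) β ≡ ∑ˣ (λ α → lam α ℤ.* J m (α * β))
  J-suc m β = begin
    ∑ˣ (λ a → lam (a * β) ℤ.* K (suc m) a)
      ≡⟨ ∑ˣ-cong (λ a _ → ≡.trans (cong (lam (a * β) ℤ.*_) (K-suc m a)) (≡.sym (∑ˣ-*ˡ (lam (a * β)) _))) ⟩
    ∑ˣ (λ a → ∑ˣ (λ α → lam (a * β) ℤ.* (lam α ℤ.* K m (a * α ⁻¹))))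
      ≡⟨ ∑ˣ-swap _ ⟩
    ∑ˣ (λ α → ∑ˣ (λ a → lam (a * β) ℤ.* (lam α ℤ.* K m (a * α ⁻¹))))
      ≡⟨ ∑ˣ-cong (λ α α≉0 → ≡.sym (∑ˣ-scale α≉0 (λ a → lam (a * β) ℤ.* (lam α ℤ.* K m (a * α ⁻¹)))
           (λ _ e → cong₂ ℤ._*_ (lam-cong (*-congʳ e)) (cong (lam α ℤ.*_) (K-cong m (*-congʳ e)))))) ⟩
    ∑ˣ (λ α → ∑ˣ (λ a → lam ((a * α) * β) ℤ.* (lam α ℤ.* K m ((a * α) * α ⁻¹))))
      ≡⟨ ∑ˣ-cong (λ α α≉0 → ∑ˣ-cong (λ a _ → ≡.trans
           (cong₂ ℤ._*_ (lam-cong (*-assoc a α β)) (cong (lam α ℤ.*_) (K-cong m (x*a*a⁻¹ a α≉0))))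
           (lemma (lam (a * (α * β))) (lam α) (K m a)))) ⟩
    ∑ˣ (λ α → ∑ˣ (λ a → lam α ℤ.* (lam (a * (α * β)) ℤ.* K m a)))
      ≡⟨ ∑ˣ-cong (λ α _ → ∑ˣ-*ˡ (lam α) _) ⟩
    ∑ˣ (λ α → lam α ℤ.* J m (α * β)) ∎
    where
    open ≡-Reasoning
    lemma : ∀ x y z → x ℤ.* (y ℤ.* z) ≡ y ℤ.* (x ℤ.* z)
    lemma = solve-∀

  J-0 : ∀ β → J 0 β ≡ Q ℤ.* ⟦ does (β ≟ 1#) ⟧ ℤ.- 1ℤ
  J-0 β = begin
    ∑ˣ (λ a → lam (a * β) ℤ.* lam a)     ≡⟨ ∑ˣ-cong (λ a _ → ≡.trans (≡.sym (lam-+ (a * β) a))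
                                              (lam-cong (solve 2 (λ a β → a :* β :+ a := a :* (β :+ con 1)) ≈-refl a β))) ⟩
    ∑ˣ (λ a → lam (a * (β + 1#)))        ≡⟨ ∑ˣ-lam-* (β + 1#) ⟩
    Q ℤ.* ⟦ isZero (β + 1#) ⟧ ℤ.- 1ℤ     ≡⟨ cong (λ b → Q ℤ.* b ℤ.- 1ℤ) (⟦≟⟧-cong x+y≈0⇒x≈y x≈y⇒x+y≈0) ⟩
    Q ℤ.* ⟦ does (β ≟ 1#) ⟧ ℤ.- 1ℤ       ∎
    where open ≡-Reasoning

  -- At β = 0 every step of the recursion multiplies by the sum of λ over nonzero elements, which is
  -- -1.
  J-zero : ∀ m → J m 0# ≡ signℤ (suc m)
  J-zero zero    = ≡.trans (J-0 0#) (≡.trans (cong (λ b → Q ℤ.* b ℤ.- 1ℤ) (⟦no⟧ (0# ≟ 1#) 0≉1)) (cong (ℤ._- 1ℤ) (ℤP.*-zeroʳ Q)))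
  J-zero (suc m) = begin
    J (suc m) 0#                           ≡⟨ J-suc m 0# ⟩
    ∑ˣ (λ α → lam α ℤ.* J m (α * 0#))      ≡⟨ ∑ˣ-cong (λ α _ → cong (lam α ℤ.*_) (≡.trans (J-cong m (zeroʳ α)) (J-zero m))) ⟩
    ∑ˣ (λ α → lam α ℤ.* signℤ (suc m))     ≡⟨ ∑ˣ-*ʳ (signℤ (suc m)) lam ⟩
    ∑ˣ lam ℤ.* signℤ (suc m)               ≡⟨ cong (ℤ._* signℤ (suc m)) ∑ˣ-lam ⟩
    signℤ (suc (suc m))                    ∎
    where open ≡-Reasoning

  -- `J 0` is q times the delta at 1, minus 1, so the first step of the recursion picks α = β⁻¹.
  -- Every further step is the recursion of the Kloosterman sums with parameter β⁻¹, while the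
  -- constant changes sign.
  J-≉0 : ∀ m {β} → ¬ (β ≈ 0#) → J (suc m) β ≡ Q ℤ.* K m (β ⁻¹) ℤ.+ signℤ m
  J-≉0 zero {β} β≉0 = begin
    J 1 β
      ≡⟨ J-suc 0 β ⟩
    ∑ˣ (λ α → lam α ℤ.* J 0 (α * β))
      ≡⟨ ∑ˣ-cong (λ α _ → ≡.trans (cong (lam α ℤ.*_) (≡.trans (J-0 (α * β))
           (cong (λ b → Q ℤ.* b ℤ.- 1ℤ) (⟦≟⟧-cong (toβ⁻¹ α) (fromβ⁻¹ α)))))
           (lemma (lam α) Q ⟦ does (α ≟ (β ⁻¹)) ⟧)) ⟩
    ∑ˣ (λ α → Q ℤ.* (⟦ does (α ≟ (β ⁻¹)) ⟧ ℤ.* lam α) ℤ.+ lam α ℤ.* -1ℤ)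
      ≡⟨ ∑ˣ-+ _ _ ⟩
    ∑ˣ (λ α → Q ℤ.* (⟦ does (α ≟ (β ⁻¹)) ⟧ ℤ.* lam α)) ℤ.+ ∑ˣ (λ α → lam α ℤ.* -1ℤ)
      ≡⟨ cong₂ ℤ._+_ (∑ˣ-*ˡ Q _) (≡.trans (∑ˣ-*ʳ -1ℤ lam) (cong (ℤ._* -1ℤ) ∑ˣ-lam)) ⟩
    Q ℤ.* ∑ˣ (λ α → ⟦ does (α ≟ (β ⁻¹)) ⟧ ℤ.* lam α) ℤ.+ 1ℤ
      ≡⟨ cong (λ z → Q ℤ.* z ℤ.+ 1ℤ) (≡.trans
           (∑-cong E (λ α → swap (unit α) ⟦ does (α ≟ (β ⁻¹)) ⟧ (lam α)))
           (≡.trans (∑-δ (β ⁻¹) (λ α → unit α ℤ.* lam α) (λ e → cong₂ ℤ._*_ (unit-cong e) (lam-cong e)))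
             (≡.trans (cong (ℤ._* lam (β ⁻¹)) (unit-≉0 (x⁻¹≉0 β≉0))) (ℤP.*-identityˡ _)))) ⟩
    Q ℤ.* lam (β ⁻¹) ℤ.+ 1ℤ ∎
    where
    open ≡-Reasoning
    toβ⁻¹ : ∀ α → α * β ≈ 1# → α ≈ β ⁻¹
    toβ⁻¹ α e = ⁻¹-unique β≉0 (≈-trans (*-comm β α) e)
    fromβ⁻¹ : ∀ α → α ≈ β ⁻¹ → α * β ≈ 1#
    fromβ⁻¹ α e = ≈-trans (*-congʳ e) (⁻¹-invˡ β β≉0)
    lemma : ∀ l Q b → l ℤ.* (Q ℤ.* b ℤ.- 1ℤ) ≡ Q ℤ.* (b ℤ.* l) ℤ.+ l ℤ.* -1ℤ
    lemma = solve-∀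
    swap : ∀ u b l → u ℤ.* (b ℤ.* l) ≡ b ℤ.* (u ℤ.* l)
    swap = solve-∀
  J-≉0 (suc m) {β} β≉0 = begin
    J (suc (suc m)) β
      ≡⟨ J-suc (suc m) β ⟩
    ∑ˣ (λ α → lam α ℤ.* J (suc m) (α * β))
      ≡⟨ ∑ˣ-cong (λ α α≉0 → ≡.trans
           (cong (lam α ℤ.*_) (≡.trans (J-≉0 m (x*y≉0 α≉0 β≉0))
             (cong (λ k → Q ℤ.* k ℤ.+ signℤ m) (K-cong m (≈-trans (⁻¹-* α≉0 β≉0) (*-comm _ _))))))
           (lemma (lam α) Q (K m (β ⁻¹ * α ⁻¹)) (signℤ m))) ⟩
    ∑ˣ (λ α → Q ℤ.* (lam α ℤ.* K m (β ⁻¹ * α ⁻¹)) ℤ.+ lam α ℤ.* signℤ m)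
      ≡⟨ ∑ˣ-+ _ _ ⟩
    ∑ˣ (λ α → Q ℤ.* (lam α ℤ.* K m (β ⁻¹ * α ⁻¹))) ℤ.+ ∑ˣ (λ α → lam α ℤ.* signℤ m)
      ≡⟨ cong₂ ℤ._+_ (≡.trans (∑ˣ-*ˡ Q _) (cong (Q ℤ.*_) (≡.sym (K-suc m (β ⁻¹)))))
           (≡.trans (∑ˣ-*ʳ (signℤ m) lam) (cong (ℤ._* signℤ m) ∑ˣ-lam)) ⟩
    Q ℤ.* K (suc m) (β ⁻¹) ℤ.+ signℤ (suc m) ∎
    where
    open ≡-Reasoning
    lemma : ∀ l Q k s → l ℤ.* (Q ℤ.* k ℤ.+ s) ≡ Q ℤ.* (l ℤ.* k) ℤ.+ l ℤ.* s
    lemma = solve-∀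

  -- Vectors over the field

  sumFin-suc : ∀ n (f : Fin (suc n) → Carrier) → sumFin (suc n) f ≈ f Fin.zero + sumFin n (f ∘ Fin.suc)
  sumFin-suc n f = +-congˡ (≈-reflexive (≡.trans
    (cong (λ l → Add.big l f) (≡.sym (ListP.map-tabulate (λ i → i) Fin.suc))) (Add.big-map (allFin n) Fin.suc f)))

  sumFin-cong : ∀ n {f g : Fin n → Carrier} → (∀ i → f i ≈ g i) → sumFin n f ≈ sumFin n g
  sumFin-cong n = Add.big-cong (allFin n)

  sumFin-0 : ∀ n {f : Fin n → Carrier} → (∀ i → f i ≈ 0#) → sumFin n f ≈ 0#
  sumFin-0 n e = ≈-trans (sumFin-cong n e) (Add.big-ε (allFin n))

  sumFin-*ˡ : ∀ n c (f : Fin n → Carrier) → sumFin n (λ i → c * f i) ≈ c * sumFin n f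
  sumFin-*ˡ n c f = go (allFin n)
    where
    go : ∀ xs → Add.big xs (λ i → c * f i) ≈ c * Add.big xs f
    go []       = ≈-sym (zeroʳ c)
    go (x ∷ xs) = ≈-trans (+-congˡ (go xs)) (≈-sym (distribˡ c _ _))

  sumFin-punchIn : ∀ n j (f : Fin (suc n) → Carrier) → sumFin (suc n) f ≈ f j + sumFin n (f ∘ punchIn j)
  sumFin-punchIn n       Fin.zero    f = sumFin-suc n f
  sumFin-punchIn (suc n) (Fin.suc j) f = begin
    sumFin (suc (suc n)) f
      ≈⟨ sumFin-suc (suc n) f ⟩
    f Fin.zero + sumFin (suc n) (f ∘ Fin.suc)
      ≈⟨ +-congˡ (sumFin-punchIn n j (f ∘ Fin.suc)) ⟩
    f Fin.zero + (f (Fin.suc j) + sumFin n (f ∘ Fin.suc ∘ punchIn j))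
      ≈⟨ solve 3 (λ a b c → a :+ (b :+ c) := b :+ (a :+ c)) ≈-refl _ _ _ ⟩
    f (Fin.suc j) + (f Fin.zero + sumFin n (f ∘ Fin.suc ∘ punchIn j))
      ≈⟨ +-congˡ (sumFin-suc n (f ∘ punchIn (Fin.suc j))) ⟨
    f (Fin.suc j) + sumFin (suc n) (f ∘ punchIn (Fin.suc j)) ∎
    where open ≈-Reasoning

  infix 4 _≋_ _≋?_

  _≋_ : ∀ {n} → Vector Carrier n → Vector Carrier n → Set
  u ≋ v = ∀ i → u i ≈ v i

  _≋?_ : ∀ {n} (u v : Vector Carrier n) → Dec (u ≋ v)
  u ≋? v = FinP.all? (λ i → u i ≟ v i)

  infix 8 _·_

  _·_ : ∀ {n} → Vector Carrier n → Vector Carrier n → Carrier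
  u · v = sumFin _ (λ i → u i * v i)

  ·-cong : ∀ {n} {u u′ v v′ : Vector Carrier n} → u ≋ u′ → v ≋ v′ → u · v ≈ u′ · v′
  ·-cong e e′ = sumFin-cong _ (λ i → *-cong (e i) (e′ i))

  insertAt-· : ∀ {n} (w : Vector Carrier n) j x (m : Vector Carrier (suc n)) →
    insertAt w j x · m ≈ x * m j + w · (m ∘ punchIn j)
  insertAt-· {n} w j x m = ≈-trans (sumFin-punchIn n j _) (+-cong
    (*-congʳ (≈-reflexive (VecP.insertAt-lookup w j x)))
    (sumFin-cong n (λ k → *-congʳ (≈-reflexive (VecP.insertAt-punchIn w j x k)))))

  -- Determinants in characteristic two

  Rows : ℕ → ℕ → Set
  Rows m n = Fin m → Vector Carrier n

  infix 4 _≋≋_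

  _≋≋_ : ∀ {m n} → Rows m n → Rows m n → Set
  A ≋≋ B = ∀ i → A i ≋ B i

  minors : ∀ {n} → Rows n (suc n) → Vector Carrier (suc n)
  minors B j = det _ (λ i k → B i (punchIn j k))

  det-cong : ∀ n {A B : Matrix n} → A ≋≋ B → det n A ≈ det n B
  det-cong zero    e = ≈-refl
  det-cong (suc n) e = sumFin-cong (suc n) (λ j → *-congˡ
    (*-cong (e Fin.zero j) (det-cong n (λ i k → e (Fin.suc i) (punchIn j k)))))

  minors-cong : ∀ {n} {A B : Rows n (suc n)} → A ≋≋ B → minors A ≋ minors B
  minors-cong e j = det-cong _ (λ i k → e i (punchIn j k))

  det-expand : ∀ n (A : Matrix (suc n)) → det (suc n) A ≈ A Fin.zero · minors (A ∘ Fin.suc)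
  det-expand n A = sumFin-cong (suc n) (λ j → ≈-trans (*-congʳ (≈-trans (pow-cong (Fin.toℕ j) -1≈1) (pow-1# (Fin.toℕ j)))) (*-identityˡ _))

  -- A term of the Laplace expansion along two rows: the two columns used by these rows, and the
  -- enumeration of the remaining columns.
  PairFun : ℕ → Set
  PairFun n = Fin (suc (suc n)) → Fin (suc (suc n)) → (Fin n → Fin (suc (suc n))) → Carrier

  Ext : ∀ {n} → PairFun n → Set
  Ext f = ∀ a b {c c′} → (∀ k → c k ≡ c′ k) → f a b c ≈ f a b c′

  flipPair : ∀ {n} → PairFun n → PairFun n
  flipPair f a b = f b a

  lift0 : ∀ {m n} → (Fin m → Fin n) → Fin (suc m) → Fin (suc n)
  lift0 c Fin.zero    = Fin.zero
  lift0 c (Fin.suc k) = Fin.suc (c k)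

  lift0-cong : ∀ {m n} {c c′ : Fin m → Fin n} → (∀ k → c k ≡ c′ k) → ∀ k → lift0 c k ≡ lift0 c′ k
  lift0-cong e Fin.zero    = refl
  lift0-cong e (Fin.suc k) = cong Fin.suc (e k)

  tailPair : ∀ {n} → PairFun (suc n) → PairFun n
  tailPair f a b c = f (Fin.suc a) (Fin.suc b) (lift0 c)

  orderedPairs : ∀ n → PairFun n → Carrier
  orderedPairs n f = sumFin (suc (suc n)) (λ j → sumFin (suc n) (λ l → f j (punchIn j l) (punchIn j ∘ punchIn l)))

  increasingPairs : ∀ n → PairFun n → Carrier
  increasingPairs zero    f = sumFin 1 (λ l → f Fin.zero (Fin.suc l) (Fin.suc ∘ punchIn l))
  increasingPairs (suc n) f = sumFin (suc (suc n)) (λ l → f Fin.zero (Fin.suc l) (Fin.suc ∘ punchIn l))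
                            + increasingPairs n (tailPair f)

  increasingPairs-cong : ∀ n {f g : PairFun n} → (∀ a b c → f a b c ≈ g a b c) → increasingPairs n f ≈ increasingPairs n g
  increasingPairs-cong zero {f} {g} e = +-congʳ (e Fin.zero (Fin.suc Fin.zero) (Fin.suc ∘ punchIn Fin.zero))
  increasingPairs-cong (suc n) e = +-cong (sumFin-cong (suc (suc n)) (λ l → e _ _ _)) (increasingPairs-cong n (λ a b c → e _ _ _))

  -- The enumeration of the remaining columns depends only on the set of the two removed ones, so
  -- the decreasing pairs are the increasing pairs of the flipped function. Induction separates off
  -- the pairs containing column 0; for all others column 0 stays first among the remaining columns,
  -- which is `lift0`. `Ext` is required because these enumerations agree only pointwise.
  orderedPairs-split : ∀ n f → Ext f → orderedPairs n f ≈ increasingPairs n f + increasingPairs n (flipPair f)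
  orderedPairs-split zero f ext = +-congˡ (≈-trans (+-identityʳ _)
    (+-congʳ (ext (Fin.suc Fin.zero) Fin.zero {punchIn (Fin.suc Fin.zero) ∘ punchIn Fin.zero} {Fin.suc ∘ punchIn Fin.zero} (λ ()))))
  orderedPairs-split (suc n) f ext = begin
    orderedPairs (suc n) f
      ≈⟨ sumFin-suc (suc (suc n)) _ ⟩
    P + sumFin (suc (suc n)) (λ j → sumFin (suc (suc n)) (λ l → f (Fin.suc j) (punchIn (Fin.suc j) l) (punchIn (Fin.suc j) ∘ punchIn l)))
      ≈⟨ +-congˡ (sumFin-cong (suc (suc n)) (λ j → ≈-trans (sumFin-suc (suc n) _)
           (+-congˡ (sumFin-cong (suc n) (λ l → ext _ _ (lifted j l)))))) ⟩
    P + sumFin (suc (suc n)) (λ j → f (Fin.suc j) Fin.zero (Fin.suc ∘ punchIn j)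
          + sumFin (suc n) (λ l → tailPair f j (punchIn j l) (punchIn j ∘ punchIn l)))
      ≈⟨ +-congˡ (Add.big-∙ (allFin (suc (suc n))) _ _) ⟩
    P + (P′ + orderedPairs n (tailPair f))
      ≈⟨ +-congˡ (+-congˡ (orderedPairs-split n (tailPair f) (λ a b e → ext _ _ (lift0-cong e)))) ⟩
    P + (P′ + (increasingPairs n (tailPair f) + increasingPairs n (flipPair (tailPair f))))
      ≈⟨ solve 4 (λ a b c d → a :+ (b :+ (c :+ d)) := (a :+ c) :+ (b :+ d)) ≈-refl _ _ _ _ ⟩
    increasingPairs (suc n) f + increasingPairs (suc n) (flipPair f) ∎
    where
    open ≈-Reasoning
    P P′ : Carrier
    P  = sumFin (suc (suc n)) (λ l → f Fin.zero (Fin.suc l) (Fin.suc ∘ punchIn l))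
    P′ = sumFin (suc (suc n)) (λ l → f (Fin.suc l) Fin.zero (Fin.suc ∘ punchIn l))
    lifted : ∀ (j : Fin (suc (suc n))) (l : Fin (suc n)) k →
      punchIn (Fin.suc j) (punchIn (Fin.suc l) k) ≡ lift0 (punchIn j ∘ punchIn l) k
    lifted j l Fin.zero    = refl
    lifted j l (Fin.suc k) = refl

  doubleMinor : ∀ {n} → Vector Carrier (suc (suc n)) → Vector Carrier (suc (suc n)) → Rows n (suc (suc n)) → PairFun n
  doubleMinor y z B a b c = y a * (z b * det _ (λ i k → B i (c k)))

  doubleMinor-ext : ∀ {n} y z (B : Rows n (suc (suc n))) → Ext (doubleMinor y z B)
  doubleMinor-ext y z B a b e = *-congˡ (*-congˡ (det-cong _ (λ i k → ≈-reflexive (cong (B i) (e k)))))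

  det-doubleExpand : ∀ n (A : Matrix (suc (suc n))) →
    det (suc (suc n)) A ≈ orderedPairs n (doubleMinor (A Fin.zero) (A (Fin.suc Fin.zero)) (λ i → A (Fin.suc (Fin.suc i))))
  det-doubleExpand n A = ≈-trans (det-expand (suc n) A) (sumFin-cong (suc (suc n)) (λ j →
    ≈-trans (*-congˡ (det-expand n (λ i k → A (Fin.suc i) (punchIn j k)))) (≈-sym (sumFin-*ˡ (suc n) (A Fin.zero j) _))))

  swapTop : ∀ {n} → Matrix (suc (suc n)) → Matrix (suc (suc n))
  swapTop A Fin.zero              = A (Fin.suc Fin.zero)
  swapTop A (Fin.suc Fin.zero)    = A Fin.zero
  swapTop A (Fin.suc (Fin.suc i)) = A (Fin.suc (Fin.suc i))

  -- Exchanging the two rows exchanges increasing and decreasing column pairs; the usual sign is 1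
  -- here.
  det-swapTop : ∀ n (A : Matrix (suc (suc n))) → det (suc (suc n)) A ≈ det (suc (suc n)) (swapTop A)
  det-swapTop n A = begin
    det (suc (suc n)) A
      ≈⟨ det-doubleExpand n A ⟩
    orderedPairs n (doubleMinor y z B)
      ≈⟨ orderedPairs-split n _ (doubleMinor-ext y z B) ⟩
    increasingPairs n (doubleMinor y z B) + increasingPairs n (flipPair (doubleMinor y z B))
      ≈⟨ +-cong (increasingPairs-cong n (λ a b c → x∙yz≈y∙xz (y a) (z b) _)) (increasingPairs-cong n (λ a b c → x∙yz≈y∙xz (y b) (z a) _)) ⟩
    increasingPairs n (flipPair (doubleMinor z y B)) + increasingPairs n (doubleMinor z y B)
      ≈⟨ +-comm _ _ ⟩
    increasingPairs n (doubleMinor z y B) + increasingPairs n (flipPair (doubleMinor z y B))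
      ≈⟨ orderedPairs-split n _ (doubleMinor-ext z y B) ⟨
    orderedPairs n (doubleMinor z y B)
      ≈⟨ det-doubleExpand n (swapTop A) ⟨
    det (suc (suc n)) (swapTop A) ∎
    where
    open ≈-Reasoning
    y = A Fin.zero
    z = A (Fin.suc Fin.zero)
    B : Rows n (suc (suc n))
    B i = A (Fin.suc (Fin.suc i))
    x∙yz≈y∙xz : ∀ a b c → a * (b * c) ≈ b * (a * c)
    x∙yz≈y∙xz a b c = solve 3 (λ a b c → a :* (b :* c) := b :* (a :* c)) ≈-refl a b c

  -- If the first two rows agree, increasing and decreasing pairs give equal sums, which cancel in
  -- characteristic two. Otherwise swapping the top rows moves the repeated row down by one, so that
  -- every minor of the next expansion has its own top row repeated.
  det-equalRows : ∀ n (A : Matrix (suc n)) k → A Fin.zero ≋ A (Fin.suc k) → det (suc n) A ≈ 0#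
  det-equalRows (suc n) A Fin.zero e = begin
    det (suc (suc n)) A
      ≈⟨ det-doubleExpand n A ⟩
    orderedPairs n f
      ≈⟨ orderedPairs-split n f (doubleMinor-ext (A Fin.zero) (A (Fin.suc Fin.zero)) (λ i → A (Fin.suc (Fin.suc i)))) ⟩
    increasingPairs n f + increasingPairs n (flipPair f)
      ≈⟨ +-congˡ (increasingPairs-cong n (λ a b c → ≈-trans (*-cong (e b) (*-congʳ (≈-sym (e a))))
           (solve 3 (λ a b c → a :* (b :* c) := b :* (a :* c)) ≈-refl _ _ _))) ⟩
    increasingPairs n f + increasingPairs n f
      ≈⟨ x+x≈0 _ ⟩
    0# ∎
    where
    open ≈-Reasoning
    f = doubleMinor (A Fin.zero) (A (Fin.suc Fin.zero)) (λ i → A (Fin.suc (Fin.suc i)))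
  det-equalRows (suc n) A (Fin.suc k) e = ≈-trans (det-swapTop n A) (≈-trans (det-expand (suc n) (swapTop A))
    (sumFin-0 (suc (suc n)) (λ j → ≈-trans
      (*-congˡ (det-equalRows n (λ i l → swapTop A (Fin.suc i) (punchIn j l)) k (λ l → e (punchIn j l)))) (zeroʳ _))))

  row-·-minors : ∀ {n} (B : Rows n (suc n)) i → B i · minors B ≈ 0#
  row-·-minors {n} B i = ≈-trans (≈-sym (det-expand n (B i ∷ᵛ B))) (det-equalRows n (B i ∷ᵛ B) i (λ _ → ≈-refl))

  insertCol : ∀ {m n} → Fin (suc n) → Vector Carrier m → Rows m n → Rows m (suc n)
  insertCol j c D i = insertAt (D i) j (c i)

  insertCol-minor : ∀ {n} j c (D : Matrix n) → minors (insertCol j c D) j ≈ det n D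
  insertCol-minor j c D = det-cong _ (λ i k → ≈-reflexive (VecP.insertAt-punchIn (D i) j (c i) k))

  otherMinors : ∀ {n} → Fin (suc n) → Matrix n → Vector Carrier n → Vector Carrier n
  otherMinors j D c = minors (insertCol j c D) ∘ punchIn j

  -- Cramer's rule: the vector x of the other minors solves D x = (det D) c. It is the relation
  -- `row-·-minors` with the term of column j set apart.
  col-*-det : ∀ {n} j (D : Matrix n) c i → c i * det n D ≈ D i · otherMinors j D c
  col-*-det {n} j D c i = x+y≈0⇒x≈y (begin
    c i * det n D + D i · otherMinors j D c
      ≈⟨ +-congʳ (*-congˡ (insertCol-minor j c D)) ⟨
    c i * minors (insertCol j c D) j + D i · otherMinors j D c
      ≈⟨ insertAt-· (D i) j (c i) (minors (insertCol j c D)) ⟨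
    insertCol j c D i · minors (insertCol j c D)
      ≈⟨ row-·-minors (insertCol j c D) i ⟩
    0# ∎)
    where open ≈-Reasoning

  otherMinors-injective : ∀ {n} j (D : Matrix n) → ¬ (det n D ≈ 0#) → ∀ {c c′} →
    otherMinors j D c ≋ otherMinors j D c′ → c ≋ c′
  otherMinors-injective j D D≉0 {c} {c′} e i = cancelˡ D≉0 (≈-trans (*-comm _ _) (≈-trans (col-*-det j D c i)
    (≈-trans (·-cong (λ _ → ≈-refl) e) (≈-trans (≈-sym (col-*-det j D c′ i)) (*-comm _ _)))))

  insertAt-cong : ∀ {n} {u v : Vector Carrier n} j {x y} → u ≋ v → x ≈ y → insertAt u j x ≋ insertAt v j y
  insertAt-cong Fin.zero    e e′ Fin.zero    = e′
  insertAt-cong Fin.zero    e e′ (Fin.suc k) = e k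
  insertAt-cong {suc n} (Fin.suc j) e e′ Fin.zero    = e Fin.zero
  insertAt-cong {suc n} (Fin.suc j) e e′ (Fin.suc k) = insertAt-cong j (e ∘ Fin.suc) e′ k

  otherMinors-cong : ∀ {n} j (D : Matrix n) {c c′} → c ≋ c′ → otherMinors j D c ≋ otherMinors j D c′
  otherMinors-cong j D e k = minors-cong (λ i → insertAt-cong j (λ _ → ≈-refl) (e i)) (punchIn j k)

  -- Sums over vectors and matrices

  V : (n : ℕ) → List (Vector Carrier n)
  V n = allFuns n E

  M : (m n : ℕ) → List (Rows m n)
  M m n = allFuns m (V n)

  ∑-allFuns-suc : {A : Set} (n : ℕ) (xs : List A) (f : Vector A (suc n) → ℤ) →
    ∑ (allFuns (suc n) xs) f ≡ ∑ xs (λ x → ∑ (allFuns n xs) (λ v → f (x ∷ᵛ v)))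
  ∑-allFuns-suc n xs f = ≡.trans (∑-concatMap xs _ f) (∑-cong xs (λ x → ∑-map (allFuns n xs) (x ∷ᵛ_) f))

  ∑V-const : ∀ n c → ∑ (V n) (λ _ → c) ≡ Q ℤ.^ n ℤ.* c
  ∑V-const zero    c = ≡.trans (ℤP.+-identityʳ c) (≡.sym (ℤP.*-identityˡ c))
  ∑V-const (suc n) c = begin
    ∑ (V (suc n)) (λ _ → c)               ≡⟨ ∑-allFuns-suc n E _ ⟩
    ∑ E (λ _ → ∑ (V n) (λ _ → c))         ≡⟨ ∑-const E _ ⟩
    Q ℤ.* ∑ (V n) (λ _ → c)               ≡⟨ cong (Q ℤ.*_) (∑V-const n c) ⟩
    Q ℤ.* (Q ℤ.^ n ℤ.* c)                 ≡⟨ ℤP.*-assoc Q (Q ℤ.^ n) c ⟨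
    Q ℤ.^ suc n ℤ.* c                     ∎
    where open ≡-Reasoning

  ∑V-δ : ∀ n z (g : Vector Carrier n → ℤ) → (∀ {u v} → u ≋ v → g u ≡ g v) →
    ∑ (V n) (λ v → ⟦ does (v ≋? z) ⟧ ℤ.* g v) ≡ g z
  ∑V-δ zero    z g gc = ≡.trans (ℤP.+-identityʳ _) (≡.trans (cong (ℤ._* g (λ ())) (⟦yes⟧ ((λ ()) ≋? z) (λ ())))
    (≡.trans (ℤP.*-identityˡ _) (gc (λ ()))))
  ∑V-δ (suc n) z g gc = begin
    ∑ (V (suc n)) (λ v → ⟦ does (v ≋? z) ⟧ ℤ.* g v)
      ≡⟨ ∑-allFuns-suc n E _ ⟩
    ∑ E (λ x → ∑ (V n) (λ v → ⟦ does ((x ∷ᵛ v) ≋? z) ⟧ ℤ.* g (x ∷ᵛ v)))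
      ≡⟨ ∑-cong E (λ x → ≡.trans (∑-cong (V n) (λ v → ≡.trans (cong (ℤ._* g (x ∷ᵛ v)) (split x v))
           (ℤP.*-assoc ⟦ does (x ≟ z Fin.zero) ⟧ _ _))) (∑-*ˡ (V n) ⟦ does (x ≟ z Fin.zero) ⟧ _)) ⟩
    ∑ E (λ x → ⟦ does (x ≟ z Fin.zero) ⟧ ℤ.* ∑ (V n) (λ v → ⟦ does (v ≋? (z ∘ Fin.suc)) ⟧ ℤ.* g (x ∷ᵛ v)))
      ≡⟨ ∑-cong E (λ x → cong (⟦ does (x ≟ z Fin.zero) ⟧ ℤ.*_) (∑V-δ n (z ∘ Fin.suc) (λ v → g (x ∷ᵛ v))
           (λ e → gc (λ { Fin.zero → ≈-refl ; (Fin.suc i) → e i })))) ⟩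
    ∑ E (λ x → ⟦ does (x ≟ z Fin.zero) ⟧ ℤ.* g (x ∷ᵛ (z ∘ Fin.suc)))
      ≡⟨ ∑-δ (z Fin.zero) (λ x → g (x ∷ᵛ (z ∘ Fin.suc))) (λ e → gc (λ { Fin.zero → e ; (Fin.suc i) → ≈-refl })) ⟩
    g (z Fin.zero ∷ᵛ (z ∘ Fin.suc))
      ≡⟨ gc (λ { Fin.zero → ≈-refl ; (Fin.suc i) → ≈-refl }) ⟩
    g z ∎
    where
    open ≡-Reasoning
    split : ∀ x v → ⟦ does ((x ∷ᵛ v) ≋? z) ⟧ ≡ ⟦ does (x ≟ z Fin.zero) ⟧ ℤ.* ⟦ does (v ≋? (z ∘ Fin.suc)) ⟧
    split x v = ≡.trans (cong ⟦_⟧ (does-cong ((x ∷ᵛ v) ≋? z) ((x ≟ z Fin.zero) ×-dec (v ≋? (z ∘ Fin.suc)))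
        (λ e → e Fin.zero , e ∘ Fin.suc) (λ (e , e′) → λ { Fin.zero → e ; (Fin.suc i) → e′ i })))
      (⟦∧⟧ (does (x ≟ z Fin.zero)) _)

  ∑V-δ-1 : ∀ n z → ∑ (V n) (λ v → ⟦ does (v ≋? z) ⟧) ≡ 1ℤ
  ∑V-δ-1 n z = ≡.trans (∑-cong (V n) (λ v → ≡.sym (ℤP.*-identityʳ _))) (∑V-δ n z (λ _ → 1ℤ) (λ _ → refl))

  ≋-sym : ∀ {n} {u v : Vector Carrier n} → u ≋ v → v ≋ u
  ≋-sym e i = ≈-sym (e i)

  ≋-trans : ∀ {n} {u v w : Vector Carrier n} → u ≋ v → v ≋ w → u ≋ w
  ≋-trans e e′ i = ≈-trans (e i) (e′ i)

  ∑V-δ-1ʳ : ∀ n z → ∑ (V n) (λ v → ⟦ does (z ≋? v) ⟧) ≡ 1ℤ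
  ∑V-δ-1ʳ n z = ≡.trans (∑-cong (V n) (λ v → cong ⟦_⟧ (does-cong (z ≋? v) (v ≋? z) ≋-sym ≋-sym))) (∑V-δ-1 n z)

  -- Every fibre has at most one element, and the fibre sizes add up to qⁿ.
  fibre-1 : ∀ n (Φ : Vector Carrier n → Vector Carrier n) → (∀ {c c′} → c ≋ c′ → Φ c ≋ Φ c′) →
    (∀ {c c′} → Φ c ≋ Φ c′ → c ≋ c′) → ∀ t → ∑ (V n) (λ c → ⟦ does (Φ c ≋? t) ⟧) ≡ 1ℤ
  fibre-1 n Φ Φ-cong Φ-inj t = begin
    fib t                        ≡⟨ lemma (fib t) ⟩
    1ℤ ℤ.- gap t                 ≡⟨ cong (λ z → 1ℤ ℤ.- z) gap≡0 ⟩
    1ℤ                           ∎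
    where
    open ≡-Reasoning
    fib gap : Vector Carrier n → ℤ
    fib t = ∑ (V n) (λ c → ⟦ does (Φ c ≋? t) ⟧)
    gap t = 1ℤ ℤ.- fib t
    lemma : ∀ x → x ≡ 1ℤ ℤ.- (1ℤ ℤ.- x)
    lemma = solve-∀
    none-or-some : ∀ xs t → ∑ xs (λ c → ⟦ does (Φ c ≋? t) ⟧) ≡ 0ℤ ⊎ ∃ λ c → Φ c ≋ t
    none-or-some []       t = inj₁ refl
    none-or-some (x ∷ xs) t with Φ x ≋? t | none-or-some xs t
    ... | yes p | _      = inj₂ (x , p)
    ... | no ¬p | inj₁ e = inj₁ (cong₂ ℤ._+_ (⟦no⟧ (Φ x ≋? t) ¬p) e)
    ... | no _  | inj₂ p = inj₂ p
    -- An empty fibre has gap 1. In a fibre with a point c₀, injectivity turns the indicator into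
    -- the delta at c₀, so the gap is 0.
    gap-nonneg : ∀ t → 0ℤ ℤ.≤ gap t
    gap-nonneg t with none-or-some (V n) t
    ... | inj₁ e = subst (0ℤ ℤ.≤_) (cong (λ z → 1ℤ ℤ.- z) (≡.sym e)) (ℤ.+≤+ z≤n)
    ... | inj₂ (c₀ , e₀) = subst (0ℤ ℤ.≤_) (cong (λ z → 1ℤ ℤ.- z) (≡.sym (≡.trans
        (∑-cong (V n) (λ c → cong ⟦_⟧ (does-cong (Φ c ≋? t) (c ≋? c₀)
          (λ e → Φ-inj (≋-trans e (≋-sym e₀))) (λ e → ≋-trans (Φ-cong e) e₀)))) (∑V-δ-1 n c₀)))) (ℤ.+≤+ z≤n)
    total : ∑ (V n) gap ≡ 0ℤ
    total = begin
      ∑ (V n) gap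
        ≡⟨ ∑-+ (V n) (λ _ → 1ℤ) (λ t → ℤ.- fib t) ⟩
      ∑ (V n) (λ _ → 1ℤ) ℤ.+ ∑ (V n) (λ t → ℤ.- fib t)
        ≡⟨ ℤ+-congˡ (∑ (V n) (λ _ → 1ℤ)) (≡.trans (∑-neg (V n) fib) (cong ℤ.-_ (≡.trans (∑-swap (V n) (V n) _)
             (∑-cong (V n) (λ c → ∑V-δ-1ʳ n (Φ c)))))) ⟩
      ∑ (V n) (λ _ → 1ℤ) ℤ.- ∑ (V n) (λ _ → 1ℤ)
        ≡⟨ ℤP.+-inverseʳ (∑ (V n) (λ _ → 1ℤ)) ⟩
      0ℤ ∎
    all-zero : ∀ {xs} z → All (λ v → gap v ≡ 0ℤ) xs → ∑ xs (λ v → ⟦ does (v ≋? z) ⟧ ℤ.* gap v) ≡ 0ℤ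
    all-zero z []       = refl
    all-zero {v ∷ _} z (e ∷ es) = cong₂ ℤ._+_
      (≡.trans (cong (⟦ does (v ≋? z) ⟧ ℤ.*_) e) (ℤP.*-zeroʳ ⟦ does (v ≋? z) ⟧)) (all-zero z es)
    gap-cong : ∀ {u v} → u ≋ v → gap u ≡ gap v
    gap-cong e = cong (λ z → 1ℤ ℤ.- z) (∑-cong (V n) (λ c → cong ⟦_⟧ (does-cong (Φ c ≋? _) (Φ c ≋? _)
      (λ p → ≋-trans p e) (λ p → ≋-trans p (≋-sym e)))))
    gap≡0 : gap t ≡ 0ℤ
    gap≡0 = ≡.trans (≡.sym (∑V-δ n t gap gap-cong)) (all-zero t (∑-nonneg-zero (V n) gap gap-nonneg total))

  ∑V-insertAt : ∀ n j (g : Vector Carrier (suc n) → ℤ) → (∀ {u v} → u ≋ v → g u ≡ g v) →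
    ∑ (V (suc n)) g ≡ ∑ E (λ x → ∑ (V n) (λ w → g (insertAt w j x)))
  ∑V-insertAt n Fin.zero g gc = ≡.trans (∑-allFuns-suc n E g) (∑-cong E (λ x → ∑-cong (V n) (λ w →
    gc (λ { Fin.zero → ≈-refl ; (Fin.suc i) → ≈-refl }))))
  ∑V-insertAt (suc n) (Fin.suc j) g gc = begin
    ∑ (V (suc (suc n))) g
      ≡⟨ ∑-allFuns-suc (suc n) E g ⟩
    ∑ E (λ y → ∑ (V (suc n)) (λ v → g (y ∷ᵛ v)))
      ≡⟨ ∑-cong E (λ y → ∑V-insertAt n j (λ v → g (y ∷ᵛ v)) (λ e → gc (λ { Fin.zero → ≈-refl ; (Fin.suc i) → e i }))) ⟩
    ∑ E (λ y → ∑ E (λ x → ∑ (V n) (λ w → g (y ∷ᵛ insertAt w j x))))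
      ≡⟨ ∑-swap E E _ ⟩
    ∑ E (λ x → ∑ E (λ y → ∑ (V n) (λ w → g (y ∷ᵛ insertAt w j x))))
      ≡⟨ ∑-cong E (λ x → ∑-cong E (λ y → ∑-cong (V n) (λ w → gc (λ { Fin.zero → ≈-refl ; (Fin.suc i) → ≈-refl })))) ⟩
    ∑ E (λ x → ∑ E (λ y → ∑ (V n) (λ w → g (insertAt (y ∷ᵛ w) (Fin.suc j) x))))
      ≡⟨ ∑-cong E (λ x → ∑-allFuns-suc n E (λ w → g (insertAt w (Fin.suc j) x))) ⟨
    ∑ E (λ x → ∑ (V (suc n)) (λ w → g (insertAt w (Fin.suc j) x))) ∎
    where open ≡-Reasoning

  ∷-cong : ∀ {m n} {u v : Vector Carrier n} {A B : Rows m n} → u ≋ v → A ≋≋ B → (u ∷ᵛ A) ≋≋ (v ∷ᵛ B)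
  ∷-cong e e′ Fin.zero    = e
  ∷-cong e e′ (Fin.suc i) = e′ i

  -- Matrices are enumerated by rows, so choosing column j first is a reordering. It is done row by
  -- row: the j-th entry of each row is split off and collected in c.
  ∑M-insertCol : ∀ m n j (G : Rows m (suc n) → ℤ) → (∀ {A B} → A ≋≋ B → G A ≡ G B) →
    ∑ (M m (suc n)) G ≡ ∑ (V m) (λ c → ∑ (M m n) (λ D → G (insertCol j c D)))
  ∑M-insertCol zero n j G Gc = cong (ℤ._+ 0ℤ) (≡.trans (Gc (λ ())) (≡.sym (ℤP.+-identityʳ _)))
  ∑M-insertCol (suc m) n j G Gc = begin
    ∑ (M (suc m) (suc n)) G
      ≡⟨ ∑-allFuns-suc m (V (suc n)) G ⟩
    ∑ (V (suc n)) (λ v → ∑ (M m (suc n)) (λ A → G (v ∷ᵛ A)))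
      ≡⟨ ∑V-insertAt n j _ (λ e → ∑-cong (M m (suc n)) (λ A → Gc (∷-cong e (λ _ _ → ≈-refl)))) ⟩
    ∑ E (λ x → ∑ (V n) (λ w → ∑ (M m (suc n)) (λ A → G (insertAt w j x ∷ᵛ A))))
      ≡⟨ ∑-cong E (λ x → ∑-cong (V n) (λ w → ∑M-insertCol m n j (λ A → G (insertAt w j x ∷ᵛ A))
           (λ e → Gc (∷-cong (λ _ → ≈-refl) e)))) ⟩
    ∑ E (λ x → ∑ (V n) (λ w → ∑ (V m) (λ c → ∑ (M m n) (λ D → G (insertAt w j x ∷ᵛ insertCol j c D)))))
      ≡⟨ ∑-cong E (λ x → ∑-swap (V n) (V m) _) ⟩
    ∑ E (λ x → ∑ (V m) (λ c → ∑ (V n) (λ w → ∑ (M m n) (λ D → G (insertAt w j x ∷ᵛ insertCol j c D)))))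
      ≡⟨ ∑-cong E (λ x → ∑-cong (V m) (λ c → ∑-cong (V n) (λ w → ∑-cong (M m n) (λ D →
           Gc (λ { Fin.zero k → ≈-refl ; (Fin.suc i) k → ≈-refl }))))) ⟩
    ∑ E (λ x → ∑ (V m) (λ c → ∑ (V n) (λ w → ∑ (M m n) (λ D → G (insertCol j (x ∷ᵛ c) (w ∷ᵛ D))))))
      ≡⟨ ∑-cong E (λ x → ∑-cong (V m) (λ c → ∑-allFuns-suc m (V n) (λ D → G (insertCol j (x ∷ᵛ c) D)))) ⟨
    ∑ E (λ x → ∑ (V m) (λ c → ∑ (M (suc m) n) (λ D → G (insertCol j (x ∷ᵛ c) D))))
      ≡⟨ ∑-allFuns-suc m E _ ⟨
    ∑ (V (suc m)) (λ c → ∑ (M (suc m) n) (λ D → G (insertCol j c D))) ∎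
    where open ≡-Reasoning

  -- For fixed other coordinates, y · m is an affine bijection in the coordinate j, as m_j is
  -- invertible. Hence y · m takes every value equally often.
  ∑V-· : ∀ n (m : Vector Carrier (suc n)) j → ¬ (m j ≈ 0#) → (f : Carrier → ℤ) → (∀ {x y} → x ≈ y → f x ≡ f y) →
    ∑ (V (suc n)) (λ y → f (y · m)) ≡ Q ℤ.^ n ℤ.* ∑ E f
  ∑V-· n m j mj≉0 f fc = begin
    ∑ (V (suc n)) (λ y → f (y · m))
      ≡⟨ ∑V-insertAt n j _ (λ e → fc (·-cong e (λ _ → ≈-refl))) ⟩
    ∑ E (λ x → ∑ (V n) (λ w → f (insertAt w j x · m)))
      ≡⟨ ∑-cong E (λ x → ∑-cong (V n) (λ w → fc (insertAt-· w j x m))) ⟩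
    ∑ E (λ x → ∑ (V n) (λ w → f (x * m j + w · (m ∘ punchIn j))))
      ≡⟨ ∑-swap E (V n) _ ⟩
    ∑ (V n) (λ w → ∑ E (λ x → f (x * m j + w · (m ∘ punchIn j))))
      ≡⟨ ∑-cong (V n) (λ w → ≡.trans (∑-scale mj≉0 (λ x → f (x + w · (m ∘ punchIn j))) (λ e → fc (+-congʳ e)))
           (∑-shift (w · (m ∘ punchIn j)) f fc)) ⟩
    ∑ (V n) (λ _ → ∑ E f)
      ≡⟨ ∑V-const n _ ⟩
    Q ℤ.^ n ℤ.* ∑ E f ∎
    where open ≡-Reasoning

  0v : ∀ {n} → Vector Carrier n
  0v _ = 0#

  ·-0 : ∀ {n} (y : Vector Carrier n) {m} → m ≋ 0v → y · m ≈ 0#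
  ·-0 {n} y e = sumFin-0 n (λ i → ≈-trans (*-congˡ (e i)) (zeroʳ _))

  nonzeroV : ∀ {n} → Vector Carrier n → ℤ
  nonzeroV v = ⟦ not (does (v ≋? 0v)) ⟧

  zero-or-entry : ∀ {n} (v : Vector Carrier n) → v ≋ 0v ⊎ ((∃ λ j → ¬ (v j ≈ 0#)) × ¬ (v ≋ 0v))
  zero-or-entry {n} v with v ≋? 0v
  ... | yes e = inj₁ e
  ... | no ¬e = inj₂ (FinP.¬∀⟶∃¬ n (λ j → v j ≈ 0#) (λ j → v j ≟ 0#) ¬e , ¬e)

  nonzeroV-≋ : ∀ {n} {v : Vector Carrier n} → v ≋ 0v → nonzeroV v ≡ 0ℤ
  nonzeroV-≋ {v = v} e = cong (⟦_⟧ ∘ not) (dec-true (v ≋? 0v) e)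

  nonzeroV-¬ : ∀ {n} {v : Vector Carrier n} → ¬ (v ≋ 0v) → nonzeroV v ≡ 1ℤ
  nonzeroV-¬ {v = v} e = cong (⟦_⟧ ∘ not) (dec-false (v ≋? 0v) e)

  nonzeroV-cong : ∀ {n} {u v : Vector Carrier n} → u ≋ v → nonzeroV u ≡ nonzeroV v
  nonzeroV-cong {u = u} {v} e = cong (⟦_⟧ ∘ not) (does-cong (u ≋? 0v) (v ≋? 0v) (≋-trans (≋-sym e)) (≋-trans e))

  -- Counting matrices by determinant

  detCount : (n : ℕ) → Carrier → ℤ
  detCount n d = ∑ (M n n) (λ A → ⟦ does (det n A ≟ d) ⟧)

  δ-cong : ∀ {x y d} → x ≈ y → ⟦ does (x ≟ d) ⟧ ≡ ⟦ does (y ≟ d) ⟧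
  δ-cong e = ⟦≟⟧-cong (≈-trans (≈-sym e)) (≈-trans e)

  hyperplane-count : ∀ n (m : Vector Carrier (suc n)) {d} → ¬ (d ≈ 0#) →
    ∑ (V (suc n)) (λ y → ⟦ does ((y · m) ≟ d) ⟧) ≡ Q ℤ.^ n ℤ.* nonzeroV m
  hyperplane-count n m {d} d≉0 with zero-or-entry m
  ... | inj₁ e = ≡.trans (∑-cong (V (suc n)) (λ y → ⟦no⟧ ((y · m) ≟ d) (λ p → d≉0 (≈-trans (≈-sym p) (·-0 y e)))))
    (≡.trans (∑-0 (V (suc n))) (≡.sym (≡.trans (cong (Q ℤ.^ n ℤ.*_) (nonzeroV-≋ e)) (ℤP.*-zeroʳ (Q ℤ.^ n)))))
  ... | inj₂ ((j , mj≉0) , ¬e) = ≡.trans (∑V-· n m j mj≉0 (λ x → ⟦ does (x ≟ d) ⟧) δ-cong)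
    (cong (Q ℤ.^ n ℤ.*_) (≡.trans (∑-δ-1 d) (≡.sym (nonzeroV-¬ ¬e))))

  -- Deleting column j leaves a square block D with det D = t_j ≠ 0. For such D every prescription
  -- of the other minors is met by exactly one deleted column, so each D counts once.
  minors-fibre : ∀ n (t : Vector Carrier (suc n)) j → ¬ (t j ≈ 0#) →
    ∑ (M n (suc n)) (λ B → ⟦ does (minors B ≋? t) ⟧) ≡ detCount n (t j)
  minors-fibre n t j tj≉0 = begin
    ∑ (M n (suc n)) (λ B → ⟦ does (minors B ≋? t) ⟧)
      ≡⟨ ∑M-insertCol n n j _ (λ {A} {B} e → cong ⟦_⟧ (does-cong (minors A ≋? t) (minors B ≋? t)
           (≋-trans (≋-sym (minors-cong e))) (≋-trans (minors-cong e)))) ⟩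
    ∑ (V n) (λ c → ∑ (M n n) (λ D → ⟦ does (minors (insertCol j c D) ≋? t) ⟧))
      ≡⟨ ∑-swap (V n) (M n n) _ ⟩
    ∑ (M n n) (λ D → ∑ (V n) (λ c → ⟦ does (minors (insertCol j c D) ≋? t) ⟧))
      ≡⟨ ∑-cong (M n n) (λ D → ≡.trans (∑-cong (V n) (λ c → split D c)) (∑-*ˡ (V n) ⟦ does (det n D ≟ t j) ⟧ _)) ⟩
    ∑ (M n n) (λ D → ⟦ does (det n D ≟ t j) ⟧ ℤ.* ∑ (V n) (λ c → ⟦ does (otherMinors j D c ≋? (t ∘ punchIn j)) ⟧))
      ≡⟨ ∑-cong (M n n) (λ D → ≡.trans (⟦⟧-when (det n D ≟ t j) (λ e →
           fibre-1 n (otherMinors j D) (otherMinors-cong j D)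
             (otherMinors-injective j D (λ D≈0 → tj≉0 (≈-trans (≈-sym e) D≈0))) (t ∘ punchIn j)))
           (ℤP.*-identityʳ _)) ⟩
    detCount n (t j) ∎
    where
    open ≡-Reasoning
    split : ∀ D c → ⟦ does (minors (insertCol j c D) ≋? t) ⟧
      ≡ ⟦ does (det n D ≟ t j) ⟧ ℤ.* ⟦ does (otherMinors j D c ≋? (t ∘ punchIn j)) ⟧
    split D c = ≡.trans (cong ⟦_⟧ (does-cong (minors (insertCol j c D) ≋? t)
        ((det n D ≟ t j) ×-dec (otherMinors j D c ≋? (t ∘ punchIn j)))
        (λ e → ≈-trans (≈-sym (insertCol-minor j c D)) (e j) , e ∘ punchIn j) join))
      (⟦∧⟧ (does (det n D ≟ t j)) _)
      where
      join : det n D ≈ t j × otherMinors j D c ≋ (t ∘ punchIn j) → minors (insertCol j c D) ≋ t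
      join (e , e′) i with j FinP.≟ i
      ... | yes refl = ≈-trans (insertCol-minor j c D) e
      ... | no j≢i   = subst (λ l → minors (insertCol j c D) l ≈ t l) (FinP.punchIn-punchOut j≢i) (e′ (Fin.punchOut j≢i))

  -- The hypothesis covers all nonzero determinants at once, because a value t of the minors leads
  -- to blocks of determinant t_j for whichever entry is nonzero. The factors count the q^n top rows
  -- y with y · m(B) = d and the q^(n+1) - 1 nonzero values t.
  detCount-suc : ∀ n u → (∀ x → ¬ (x ≈ 0#) → detCount n x ≡ u) → ∀ d → ¬ (d ≈ 0#) →
    detCount (suc n) d ≡ Q ℤ.^ n ℤ.* ((Q ℤ.^ suc n ℤ.- 1ℤ) ℤ.* u)
  detCount-suc n u hyp d d≉0 = begin
    detCount (suc n) d
      ≡⟨ ∑-allFuns-suc n (V (suc n)) _ ⟩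
    ∑ (V (suc n)) (λ y → ∑ (M n (suc n)) (λ B → ⟦ does (det (suc n) (y ∷ᵛ B) ≟ d) ⟧))
      ≡⟨ ∑-swap (V (suc n)) (M n (suc n)) _ ⟩
    ∑ (M n (suc n)) (λ B → ∑ (V (suc n)) (λ y → ⟦ does (det (suc n) (y ∷ᵛ B) ≟ d) ⟧))
      ≡⟨ ∑-cong (M n (suc n)) (λ B → ≡.trans (∑-cong (V (suc n)) (λ y → δ-cong (det-expand n (y ∷ᵛ B))))
           (hyperplane-count n (minors B) d≉0)) ⟩
    ∑ (M n (suc n)) (λ B → Q ℤ.^ n ℤ.* nonzeroV (minors B))
      ≡⟨ ∑-*ˡ (M n (suc n)) (Q ℤ.^ n) _ ⟩
    Q ℤ.^ n ℤ.* ∑ (M n (suc n)) (λ B → nonzeroV (minors B))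
      -- A delta over all t groups the blocks B by their vector of minors.
      ≡⟨ cong (Q ℤ.^ n ℤ.*_) (∑-cong (M n (suc n)) (λ B → ∑V-δ (suc n) (minors B) nonzeroV nonzeroV-cong)) ⟨
    Q ℤ.^ n ℤ.* ∑ (M n (suc n)) (λ B → ∑ (V (suc n)) (λ t → ⟦ does (t ≋? minors B) ⟧ ℤ.* nonzeroV t))
      ≡⟨ cong (Q ℤ.^ n ℤ.*_) (∑-swap (M n (suc n)) (V (suc n)) _) ⟩
    Q ℤ.^ n ℤ.* ∑ (V (suc n)) (λ t → ∑ (M n (suc n)) (λ B → ⟦ does (t ≋? minors B) ⟧ ℤ.* nonzeroV t))
      ≡⟨ cong (Q ℤ.^ n ℤ.*_) (∑-cong (V (suc n)) (λ t → ≡.trans (∑-*ʳ (M n (suc n)) (nonzeroV t) _) (fibre t))) ⟩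
    Q ℤ.^ n ℤ.* ∑ (V (suc n)) (λ t → nonzeroV t ℤ.* u)
      ≡⟨ cong (Q ℤ.^ n ℤ.*_) (≡.trans (∑-*ʳ (V (suc n)) u nonzeroV) (cong (ℤ._* u) total)) ⟩
    Q ℤ.^ n ℤ.* ((Q ℤ.^ suc n ℤ.- 1ℤ) ℤ.* u) ∎
    where
    open ≡-Reasoning
    fibre : ∀ t → ∑ (M n (suc n)) (λ B → ⟦ does (t ≋? minors B) ⟧) ℤ.* nonzeroV t ≡ nonzeroV t ℤ.* u
    fibre t with zero-or-entry t
    ... | inj₁ e = ≡.trans (cong (S ℤ.*_) (nonzeroV-≋ e)) (≡.trans (ℤP.*-zeroʳ S) (≡.sym (cong (ℤ._* u) (nonzeroV-≋ e))))
      where S = ∑ (M n (suc n)) (λ B → ⟦ does (t ≋? minors B) ⟧)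
    ... | inj₂ ((j , tj≉0) , _) = ≡.trans (ℤP.*-comm _ (nonzeroV t)) (cong (nonzeroV t ℤ.*_) (≡.trans
        (∑-cong (M n (suc n)) (λ B → cong ⟦_⟧ (does-cong (t ≋? minors B) (minors B ≋? t) ≋-sym ≋-sym)))
        (≡.trans (minors-fibre n t j tj≉0) (hyp (t j) tj≉0))))
    total : ∑ (V (suc n)) nonzeroV ≡ Q ℤ.^ suc n ℤ.- 1ℤ
    total = begin
      ∑ (V (suc n)) nonzeroV
        ≡⟨ ∑-cong (V (suc n)) (λ v → ⟦not⟧ (does (v ≋? 0v))) ⟩
      ∑ (V (suc n)) (λ v → 1ℤ ℤ.- ⟦ does (v ≋? 0v) ⟧)
        ≡⟨ ∑-+ (V (suc n)) (λ _ → 1ℤ) _ ⟩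
      ∑ (V (suc n)) (λ _ → 1ℤ) ℤ.+ ∑ (V (suc n)) (λ v → ℤ.- ⟦ does (v ≋? 0v) ⟧)
        ≡⟨ cong₂ ℤ._+_ (≡.trans (∑V-const (suc n) 1ℤ) (ℤP.*-identityʳ (Q ℤ.^ suc n)))
             (≡.trans (∑-neg (V (suc n)) _) (cong ℤ.-_ (∑V-δ-1 (suc n) 0v))) ⟩
      Q ℤ.^ suc n ℤ.- 1ℤ ∎

  det-1 : ∀ (A : Matrix 1) → det 1 A ≈ A Fin.zero Fin.zero
  det-1 A = ≈-trans (det-expand 0 A) (≈-trans (+-identityʳ _) (*-identityʳ _))

  ∑M-1 : (f : Matrix 1 → ℤ) (g : Carrier → ℤ) → (∀ A → f A ≡ g (A Fin.zero Fin.zero)) → ∑ (M 1 1) f ≡ ∑ E g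
  ∑M-1 f g e = ≡.trans (∑-allFuns-suc 0 (V 1) f) (≡.trans (∑-allFuns-suc 0 E _) (∑-cong E (λ x →
    ≡.trans (ℤP.+-identityʳ _) (≡.trans (ℤP.+-identityʳ _) (e _)))))

  detCount-1 : ∀ d → detCount 1 d ≡ 1ℤ
  detCount-1 d = ≡.trans (∑M-1 _ (λ x → ⟦ does (x ≟ d) ⟧) (λ A → δ-cong (det-1 A))) (∑-δ-1 d)

  orderProd : ℕ → ℤ
  orderProd n = prodℤ (map (λ j → (Q ℤ.^ j) ℤ.- 1ℤ) (fromTo 2 n))

  orderProd-suc : ∀ n → orderProd (suc (suc n)) ≡ orderProd (suc n) ℤ.* (Q ℤ.^ suc (suc n) ℤ.- 1ℤ)
  orderProd-suc n = ≡.trans (Prod.big-map (upTo (suc n)) (2 ℕ.+_) f) (≡.trans (Prod.big-upTo-snoc n (f ∘ (2 ℕ.+_)))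
    (cong (ℤ._* f (suc (suc n))) (≡.sym (Prod.big-map (upTo n) (2 ℕ.+_) f))))
    where
    module Prod = BigOp ℤP.*-1-commutativeMonoid
    f : ℕ → ℤ
    f j = Q ℤ.^ j ℤ.- 1ℤ

  [n+1]C2 : ∀ n → suc n C 2 ≡ n ℕ.+ n C 2
  [n+1]C2 n = ≡.trans (≡.sym (nCk+nC[k+1]≡[n+1]C[k+1] n 1)) (cong (ℕ._+ n C 2) (nC1≡n n))

  Q^C2-suc : ∀ n → Q ℤ.^ (suc n C 2) ≡ Q ℤ.^ n ℤ.* Q ℤ.^ (n C 2)
  Q^C2-suc n = ≡.trans (cong (Q ℤ.^_) ([n+1]C2 n)) (ℤP.^-distribˡ-+-* Q n (n C 2))

  detCount-formula : ∀ n d → ¬ (d ≈ 0#) → detCount (suc n) d ≡ Q ℤ.^ (suc n C 2) ℤ.* orderProd (suc n)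
  detCount-formula zero    d d≉0 = detCount-1 d
  detCount-formula (suc n) d d≉0 = begin
    detCount (suc (suc n)) d
      ≡⟨ detCount-suc (suc n) _ (detCount-formula n) d d≉0 ⟩
    Q ℤ.^ suc n ℤ.* ((Q ℤ.^ suc (suc n) ℤ.- 1ℤ) ℤ.* (Q ℤ.^ (suc n C 2) ℤ.* orderProd (suc n)))
      ≡⟨ lemma (Q ℤ.^ suc n) (Q ℤ.^ suc (suc n) ℤ.- 1ℤ) (Q ℤ.^ (suc n C 2)) (orderProd (suc n)) ⟩
    (Q ℤ.^ suc n ℤ.* Q ℤ.^ (suc n C 2)) ℤ.* (orderProd (suc n) ℤ.* (Q ℤ.^ suc (suc n) ℤ.- 1ℤ))
      ≡⟨ cong₂ ℤ._*_ (Q^C2-suc (suc n)) (orderProd-suc n) ⟨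
    Q ℤ.^ (suc (suc n) C 2) ℤ.* orderProd (suc (suc n)) ∎
    where
    open ≡-Reasoning
    lemma : ∀ a b c d → a ℤ.* (b ℤ.* (c ℤ.* d)) ≡ (a ℤ.* c) ℤ.* (d ℤ.* b)
    lemma = solve-∀

  -- Character sums over matrices of fixed determinant

  detSum : (n : ℕ) → Carrier → Carrier → ℤ
  detSum n a d = ∑ (M n n) (λ A → ⟦ does (det n A ≟ d) ⟧ ℤ.* lam (a * Tr n A))

  Tr-suc : ∀ n (A : Matrix (suc n)) → Tr (suc n) A ≈ A Fin.zero Fin.zero + Tr n (λ i k → A (Fin.suc i) (Fin.suc k))
  Tr-suc n A = sumFin-suc n (λ i → A i i)

  Tr-cong : ∀ n {A B : Matrix n} → A ≋≋ B → Tr n A ≈ Tr n B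
  Tr-cong n e = sumFin-cong n (λ i → e i i)

  ∑V-lam-· : ∀ n (m : Vector Carrier n) {e} → ¬ (e ≈ 0#) →
    ∑ (V n) (λ y → lam ((y · m) * e)) ≡ Q ℤ.^ n ℤ.* ⟦ does (m ≋? 0v) ⟧
  ∑V-lam-· n m {e} e≉0 with zero-or-entry m
  ... | inj₁ m≋0 = ≡.trans (∑-cong (V n) (λ y → lam-0 (≈-trans (*-congʳ (·-0 y m≋0)) (zeroˡ e))))
    (≡.trans (∑V-const n 1ℤ) (cong (Q ℤ.^ n ℤ.*_) (≡.sym (⟦yes⟧ (m ≋? 0v) m≋0))))
  ∑V-lam-· zero m e≉0 | inj₂ ((() , _) , _)
  ∑V-lam-· (suc n) m {e} e≉0 | inj₂ ((j , mj≉0) , m≉0) = begin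
    ∑ (V (suc n)) (λ y → lam ((y · m) * e))       ≡⟨ ∑V-· n m j mj≉0 (λ x → lam (x * e)) (λ p → lam-cong (*-congʳ p)) ⟩
    Q ℤ.^ n ℤ.* ∑ E (λ x → lam (x * e))           ≡⟨ cong (Q ℤ.^ n ℤ.*_) (≡.trans (∑-scale e≉0 lam lam-cong) ∑-lam) ⟩
    Q ℤ.^ n ℤ.* 0ℤ                                ≡⟨ ℤP.*-zeroʳ (Q ℤ.^ n) ⟩
    0ℤ                                            ≡⟨ ℤP.*-zeroʳ (Q ℤ.^ suc n) ⟨
    Q ℤ.^ suc n ℤ.* 0ℤ                            ≡⟨ cong (Q ℤ.^ suc n ℤ.*_) (⟦no⟧ (m ≋? 0v) m≉0) ⟨
    Q ℤ.^ suc n ℤ.* ⟦ does (m ≋? 0v) ⟧            ∎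
    where open ≡-Reasoning

  module Peel (n : ℕ) (a d : Carrier) (a≉0 : ¬ (a ≈ 0#)) (d≉0 : ¬ (d ≈ 0#)) where
    open ≡-Reasoning

    om : Matrix n → Vector Carrier n → Vector Carrier n
    om = otherMinors Fin.zero

    G : Rows (suc n) (suc n) → ℤ
    G A = ⟦ does (det (suc n) A ≟ d) ⟧ ℤ.* lam (a * Tr (suc n) A)

    G-cong : ∀ {A B} → A ≋≋ B → G A ≡ G B
    G-cong e = cong₂ ℤ._*_ (δ-cong (det-cong (suc n) e)) (lam-cong (*-congˡ (Tr-cong (suc n) e)))

    -- The summand for corner x, rest of the top row y, rest of the first column c and lower right
    -- block D. The determinant is then affine in x, with slope `det n D`.
    H : Matrix n → Vector Carrier n → Vector Carrier n → Carrier → ℤ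
    H D c y x = ⟦ does ((x * det n D + y · om D c) ≟ d) ⟧ ℤ.* (lam (x * a) ℤ.* lam (a * Tr n D))

    G-H : ∀ D c y x → G (insertAt y Fin.zero x ∷ᵛ insertCol Fin.zero c D) ≡ H D c y x
    G-H D c y x = cong₂ ℤ._*_
      (δ-cong (≈-trans (det-expand n A) (≈-trans (insertAt-· y Fin.zero x (minors B)) (+-congʳ (*-congˡ (insertCol-minor Fin.zero c D))))))
      (≡.trans (lam-cong (≈-trans (*-congˡ (Tr-suc n A)) (≈-trans (distribˡ a _ _) (+-congʳ (*-comm a x))))) (lam-+ _ _))
      where
      B = insertCol Fin.zero c D
      A = insertAt y Fin.zero x ∷ᵛ B

    peeled : detSum (suc n) a d ≡ ∑ (M n n) (λ D → ∑ (V n) (λ c → ∑ (V n) (λ y → ∑ E (H D c y))))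
    peeled = begin
      ∑ (M (suc n) (suc n)) G
        ≡⟨ ∑-allFuns-suc n (V (suc n)) G ⟩
      ∑ (V (suc n)) (λ v → ∑ (M n (suc n)) (λ B → G (v ∷ᵛ B)))
        ≡⟨ ∑V-insertAt n Fin.zero _ (λ e → ∑-cong (M n (suc n)) (λ B → G-cong (∷-cong e (λ _ _ → ≈-refl)))) ⟩
      ∑ E (λ x → ∑ (V n) (λ y → ∑ (M n (suc n)) (λ B → G (insertAt y Fin.zero x ∷ᵛ B))))
        ≡⟨ ∑-cong E (λ x → ∑-cong (V n) (λ y → ∑M-insertCol n n Fin.zero _ (λ e → G-cong (∷-cong (λ _ → ≈-refl) e)))) ⟩
      ∑ E (λ x → ∑ (V n) (λ y → ∑ (V n) (λ c → ∑ (M n n) (λ D → G (insertAt y Fin.zero x ∷ᵛ insertCol Fin.zero c D)))))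
        ≡⟨ ∑-cong E (λ x → ∑-cong (V n) (λ y → ≡.trans (∑-cong (V n) (λ c → ∑-cong (M n n) (λ D → G-H D c y x))) (∑-swap (V n) (M n n) _))) ⟩
      ∑ E (λ x → ∑ (V n) (λ y → ∑ (M n n) (λ D → ∑ (V n) (λ c → H D c y x))))
        ≡⟨ ∑-cong E (λ x → ∑-swap (V n) (M n n) _) ⟩
      ∑ E (λ x → ∑ (M n n) (λ D → ∑ (V n) (λ y → ∑ (V n) (λ c → H D c y x))))
        ≡⟨ ∑-swap E (M n n) _ ⟩
      ∑ (M n n) (λ D → ∑ E (λ x → ∑ (V n) (λ y → ∑ (V n) (λ c → H D c y x))))
        ≡⟨ ∑-cong (M n n) (λ D → ≡.trans (∑-cong E (λ x → ∑-swap (V n) (V n) _)) (≡.trans (∑-swap E (V n) _)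
             (∑-cong (V n) (λ c → ∑-swap E (V n) _)))) ⟩
      ∑ (M n n) (λ D → ∑ (V n) (λ c → ∑ (V n) (λ y → ∑ E (H D c y)))) ∎

    term : Carrier → Carrier → ℤ
    term δ t = lam ((a * d) * δ ⁻¹) ℤ.* lam (a * t)

    -- A singular lower-right block D makes the condition on the determinant independent of the corner
    -- entry x, and then the sum of λ(ax) over x vanishes.
    singular : ∀ D → det n D ≈ 0# → ∀ c y → ∑ E (H D c y) ≡ 0ℤ
    singular D D≈0 c y = begin
      ∑ E (H D c y)
        ≡⟨ ∑-cong E (λ x → ≡.trans (cong (ℤ._* (lam (x * a) ℤ.* lam (a * Tr n D)))
             (δ-cong (≈-trans (+-congʳ (≈-trans (*-congˡ D≈0) (zeroʳ x))) (+-identityˡ _))))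
             (lemma ⟦ does ((y · om D c) ≟ d) ⟧ (lam (x * a)) (lam (a * Tr n D)))) ⟩
      ∑ E (λ x → (⟦ does ((y · om D c) ≟ d) ⟧ ℤ.* lam (a * Tr n D)) ℤ.* lam (x * a))
        ≡⟨ ∑-*ˡ E (⟦ does ((y · om D c) ≟ d) ⟧ ℤ.* lam (a * Tr n D)) (λ x → lam (x * a)) ⟩
      (⟦ does ((y · om D c) ≟ d) ⟧ ℤ.* lam (a * Tr n D)) ℤ.* ∑ E (λ x → lam (x * a))
        ≡⟨ cong ((⟦ does ((y · om D c) ≟ d) ⟧ ℤ.* lam (a * Tr n D)) ℤ.*_) (≡.trans (∑-scale a≉0 lam lam-cong) ∑-lam) ⟩
      (⟦ does ((y · om D c) ≟ d) ⟧ ℤ.* lam (a * Tr n D)) ℤ.* 0ℤ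
        ≡⟨ ℤP.*-zeroʳ (⟦ does ((y · om D c) ≟ d) ⟧ ℤ.* lam (a * Tr n D)) ⟩
      0ℤ ∎
      where
      lemma : ∀ b l t → b ℤ.* (l ℤ.* t) ≡ (b ℤ.* t) ℤ.* l
      lemma = solve-∀

    -- The determinant condition has the unique solution x₀ = (d + s) / det D, where s = y ·
    -- `om D c`. So λ(a x₀) splits into a factor free of y and a character of s.
    invertible : ∀ D → ¬ (det n D ≈ 0#) → ∀ c y →
      ∑ E (H D c y) ≡ term (det n D) (Tr n D) ℤ.* lam ((y · om D c) * (a * det n D ⁻¹))
    invertible D D≉0 c y = begin
      ∑ E (H D c y)
        ≡⟨ ∑-cong E (λ x → cong (ℤ._* (lam (x * a) ℤ.* lam (a * Tr n D))) (⟦≟⟧-cong (to x) (from x))) ⟩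
      ∑ E (λ x → ⟦ does (x ≟ x₀) ⟧ ℤ.* (lam (x * a) ℤ.* lam (a * Tr n D)))
        ≡⟨ ∑-δ x₀ (λ x → lam (x * a) ℤ.* lam (a * Tr n D)) (λ e → cong (ℤ._* lam (a * Tr n D)) (lam-cong (*-congʳ e))) ⟩
      lam (x₀ * a) ℤ.* lam (a * Tr n D)
        ≡⟨ cong (ℤ._* lam (a * Tr n D)) (≡.trans (lam-cong (solve 4 (λ d s i a → ((d :+ s) :* i) :* a := (a :* d) :* i :+ s :* (a :* i))
             ≈-refl d s (δ ⁻¹) a)) (lam-+ _ _)) ⟩
      (lam ((a * d) * δ ⁻¹) ℤ.* lam (s * (a * δ ⁻¹))) ℤ.* lam (a * Tr n D)
        ≡⟨ lemma (lam ((a * d) * δ ⁻¹)) (lam (s * (a * δ ⁻¹))) (lam (a * Tr n D)) ⟩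
      term δ (Tr n D) ℤ.* lam (s * (a * δ ⁻¹)) ∎
      where
      δ s x₀ : Carrier
      δ  = det n D
      s  = y · om D c
      x₀ = (d + s) * δ ⁻¹
      to : ∀ x → x * δ + s ≈ d → x ≈ x₀
      to x e = ≈-sym (≈-trans (*-congʳ (≈-trans (+-congʳ (≈-sym e)) (x+a+a (x * δ) s))) (x*a*a⁻¹ x D≉0))
      from : ∀ x → x ≈ x₀ → x * δ + s ≈ d
      from x e = ≈-trans (+-congʳ (≈-trans (*-congʳ e) (x*a⁻¹*a (d + s) D≉0))) (x+a+a d s)
      lemma : ∀ x y z → (x ℤ.* y) ℤ.* z ≡ (x ℤ.* z) ℤ.* y
      lemma = solve-∀

    -- For invertible D the sum over y is a complete character sum, which vanishes unless `om D c`
    -- is zero. This happens for exactly one c, so the pairs (c, y) leave only the factor q^n.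
    block : ∀ D → ∑ (V n) (λ c → ∑ (V n) (λ y → ∑ E (H D c y))) ≡ unit (det n D) ℤ.* (Q ℤ.^ n ℤ.* term (det n D) (Tr n D))
    block D = go (det n D ≟ 0#)
      where
      δ = det n D
      τ = term δ (Tr n D)
      go : Dec (δ ≈ 0#) → ∑ (V n) (λ c → ∑ (V n) (λ y → ∑ E (H D c y))) ≡ unit δ ℤ.* (Q ℤ.^ n ℤ.* τ)
      go (yes D≈0) = ≡.trans (∑-cong (V n) (λ c → ≡.trans (∑-cong (V n) (singular D D≈0 c)) (∑-0 (V n))))
        (≡.trans (∑-0 (V n)) (≡.sym (cong (ℤ._* (Q ℤ.^ n ℤ.* τ)) (unit-≈0 D≈0))))
      go (no D≉0) = begin
        ∑ (V n) (λ c → ∑ (V n) (λ y → ∑ E (H D c y)))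
          ≡⟨ ∑-cong (V n) (λ c → ≡.trans (∑-cong (V n) (invertible D D≉0 c)) (≡.trans (∑-*ˡ (V n) τ _)
               (cong (τ ℤ.*_) (∑V-lam-· n (om D c) (x*y≉0 a≉0 (x⁻¹≉0 D≉0)))))) ⟩
        ∑ (V n) (λ c → τ ℤ.* (Q ℤ.^ n ℤ.* ⟦ does (om D c ≋? 0v) ⟧))
          ≡⟨ ≡.trans (∑-*ˡ (V n) τ _) (cong (τ ℤ.*_) (∑-*ˡ (V n) (Q ℤ.^ n) _)) ⟩
        τ ℤ.* (Q ℤ.^ n ℤ.* ∑ (V n) (λ c → ⟦ does (om D c ≋? 0v) ⟧))
          ≡⟨ cong (λ z → τ ℤ.* (Q ℤ.^ n ℤ.* z)) (fibre-1 n (om D) (otherMinors-cong Fin.zero D) (otherMinors-injective Fin.zero D D≉0) 0v) ⟩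
        τ ℤ.* (Q ℤ.^ n ℤ.* 1ℤ)
          ≡⟨ lemma τ (Q ℤ.^ n) ⟩
        1ℤ ℤ.* (Q ℤ.^ n ℤ.* τ)
          ≡⟨ cong (ℤ._* (Q ℤ.^ n ℤ.* τ)) (unit-≉0 D≉0) ⟨
        unit δ ℤ.* (Q ℤ.^ n ℤ.* τ) ∎
        where
        lemma : ∀ t x → t ℤ.* (x ℤ.* 1ℤ) ≡ 1ℤ ℤ.* (x ℤ.* t)
        lemma = solve-∀

    recursion : detSum (suc n) a d ≡ Q ℤ.^ n ℤ.* ∑ˣ (λ δ → lam ((a * d) * δ ⁻¹) ℤ.* detSum n a δ)
    recursion = begin
      detSum (suc n) a d
        ≡⟨ ≡.trans peeled (∑-cong (M n n) block) ⟩
      ∑ (M n n) (λ D → unit (det n D) ℤ.* (Q ℤ.^ n ℤ.* term (det n D) (Tr n D)))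
        ≡⟨ ∑-cong (M n n) (λ D → ∑-δ (det n D) (λ δ → unit δ ℤ.* (Q ℤ.^ n ℤ.* term δ (Tr n D)))
             (λ {x} {y} e → ≡.trans (unit-when x (λ n′ → cong (λ z → Q ℤ.^ n ℤ.* (z ℤ.* lam (a * Tr n D))) (lam-cong (*-congˡ (⁻¹-cong n′ e)))))
               (cong (ℤ._* (Q ℤ.^ n ℤ.* term y (Tr n D))) (unit-cong e)))) ⟨
      ∑ (M n n) (λ D → ∑ E (λ δ → ⟦ does (δ ≟ det n D) ⟧ ℤ.* (unit δ ℤ.* (Q ℤ.^ n ℤ.* term δ (Tr n D)))))
        ≡⟨ ∑-swap (M n n) E _ ⟩
      ∑ E (λ δ → ∑ (M n n) (λ D → ⟦ does (δ ≟ det n D) ⟧ ℤ.* (unit δ ℤ.* (Q ℤ.^ n ℤ.* term δ (Tr n D)))))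
        ≡⟨ ∑-cong E (λ δ → ≡.trans (∑-cong (M n n) (λ D → ≡.trans
             (cong (ℤ._* (unit δ ℤ.* (Q ℤ.^ n ℤ.* term δ (Tr n D)))) (⟦≟⟧-cong ≈-sym ≈-sym))
             (lemma ⟦ does (det n D ≟ δ) ⟧ (unit δ) (Q ℤ.^ n) (lam ((a * d) * δ ⁻¹)) (lam (a * Tr n D)))))
             (∑-*ˡ (M n n) (unit δ ℤ.* (Q ℤ.^ n ℤ.* lam ((a * d) * δ ⁻¹))) _)) ⟩
      ∑ E (λ δ → (unit δ ℤ.* (Q ℤ.^ n ℤ.* lam ((a * d) * δ ⁻¹))) ℤ.* detSum n a δ)
        ≡⟨ ∑-cong E (λ δ → lemma′ (unit δ) (Q ℤ.^ n) (lam ((a * d) * δ ⁻¹)) (detSum n a δ)) ⟩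
      ∑ E (λ δ → Q ℤ.^ n ℤ.* (unit δ ℤ.* (lam ((a * d) * δ ⁻¹) ℤ.* detSum n a δ)))
        ≡⟨ ∑-*ˡ E (Q ℤ.^ n) _ ⟩
      Q ℤ.^ n ℤ.* ∑ˣ (λ δ → lam ((a * d) * δ ⁻¹) ℤ.* detSum n a δ) ∎
      where
      lemma : ∀ b u p l t → b ℤ.* (u ℤ.* (p ℤ.* (l ℤ.* t))) ≡ (u ℤ.* (p ℤ.* l)) ℤ.* (b ℤ.* t)
      lemma = solve-∀
      lemma′ : ∀ u p l t → (u ℤ.* (p ℤ.* l)) ℤ.* t ≡ p ℤ.* (u ℤ.* (l ℤ.* t))
      lemma′ = solve-∀

  detSum-1 : ∀ a d → detSum 1 a d ≡ lam (a * d)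
  detSum-1 a d = ≡.trans (∑M-1 _ (λ x → ⟦ does (x ≟ d) ⟧ ℤ.* lam (a * x))
      (λ A → cong₂ ℤ._*_ (δ-cong (det-1 A)) (lam-cong (*-congˡ (+-identityʳ _)))))
    (∑-δ d (λ x → lam (a * x)) (λ e → lam-cong (*-congˡ e)))

  -- The determinant d stays general because the recursion meets every δ ≠ 0. Each enlargement from
  -- size k to k + 1 contributes q^k, which adds up to the exponent C(n+1,2).
  detSum-K : ∀ n a d → ¬ (a ≈ 0#) → ¬ (d ≈ 0#) → detSum (suc n) a d ≡ Q ℤ.^ (suc n C 2) ℤ.* K n (pow a (suc n) * d)
  detSum-K zero    a d a≉0 d≉0 = ≡.trans (detSum-1 a d) (≡.trans (lam-cong (*-congʳ (≈-sym (*-identityʳ a)))) (≡.sym (ℤP.*-identityˡ _)))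
  detSum-K (suc n) a d a≉0 d≉0 = begin
    detSum (suc (suc n)) a d
      ≡⟨ Peel.recursion (suc n) a d a≉0 d≉0 ⟩
    Q ℤ.^ suc n ℤ.* ∑ˣ (λ δ → lam (ad * δ ⁻¹) ℤ.* detSum (suc n) a δ)
      ≡⟨ cong (Q ℤ.^ suc n ℤ.*_) (≡.trans (∑ˣ-cong (λ δ δ≉0 → ≡.trans (cong (lam (ad * δ ⁻¹) ℤ.*_) (detSum-K n a δ a≉0 δ≉0))
           (lemma (lam (ad * δ ⁻¹)) (Q ℤ.^ (suc n C 2)) (K n (pow a (suc n) * δ))))) (∑ˣ-*ˡ (Q ℤ.^ (suc n C 2)) g)) ⟩
    Q ℤ.^ suc n ℤ.* (Q ℤ.^ (suc n C 2) ℤ.* ∑ˣ g)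
      ≡⟨ ℤP.*-assoc (Q ℤ.^ suc n) (Q ℤ.^ (suc n C 2)) (∑ˣ g) ⟨
    (Q ℤ.^ suc n ℤ.* Q ℤ.^ (suc n C 2)) ℤ.* ∑ˣ g
      ≡⟨ cong₂ ℤ._*_ (≡.sym (Q^C2-suc (suc n))) substitute ⟩
    Q ℤ.^ (suc (suc n) C 2) ℤ.* K (suc n) (pow a (suc (suc n)) * d) ∎
    where
    open ≡-Reasoning
    ad : Carrier
    ad = a * d
    ad≉0 : ¬ (ad ≈ 0#)
    ad≉0 = x*y≉0 a≉0 d≉0
    g : Carrier → ℤ
    g δ = lam (ad * δ ⁻¹) ℤ.* K n (pow a (suc n) * δ)
    g-cong : ∀ {x y} → ¬ (x ≈ 0#) → x ≈ y → g x ≡ g y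
    g-cong x≉0 e = cong₂ ℤ._*_ (lam-cong (*-congˡ (⁻¹-cong x≉0 e))) (K-cong n (*-congˡ e))
    lemma : ∀ l p k → l ℤ.* (p ℤ.* k) ≡ p ℤ.* (l ℤ.* k)
    lemma = solve-∀
    quot : ∀ α → ¬ (α ≈ 0#) → ad * (α ⁻¹ * ad) ⁻¹ ≈ α
    quot α α≉0 = ≈-trans (*-congˡ (≈-trans (⁻¹-* (x⁻¹≉0 α≉0) ad≉0) (*-congʳ (⁻¹-⁻¹ α≉0))))
      (≈-trans (solve 3 (λ x α i → x :* (α :* i) := (α :* x) :* i) ≈-refl ad α (ad ⁻¹)) (x*a*a⁻¹ α ad≉0))
    -- Putting δ = a d / α, by scaling and then inversion, turns the first character into λ(α) and
    -- a^(n+1) δ into a^(n+2) d / α, as in the Kloosterman recursion.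
    substitute : ∑ˣ g ≡ K (suc n) (pow a (suc (suc n)) * d)
    substitute = begin
      ∑ˣ g
        ≡⟨ ∑ˣ-scale ad≉0 g g-cong ⟨
      ∑ˣ (λ δ → g (δ * ad))
        ≡⟨ ∑ˣ-inv (λ δ → g (δ * ad)) (λ x≉0 e → g-cong (x*y≉0 x≉0 ad≉0) (*-congʳ e)) ⟨
      ∑ˣ (λ α → g (α ⁻¹ * ad))
        ≡⟨ ∑ˣ-cong (λ α α≉0 → cong₂ ℤ._*_ (lam-cong (quot α α≉0)) (K-cong n
             (solve 4 (λ p i a d → p :* (i :* (a :* d)) := ((a :* p) :* d) :* i) ≈-refl (pow a (suc n)) (α ⁻¹) a d))) ⟩
      ∑ˣ (λ α → lam α ℤ.* K n ((pow a (suc (suc n)) * d) * α ⁻¹))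
        ≡⟨ K-suc n _ ⟨
      K (suc n) (pow a (suc (suc n)) * d) ∎

  -- The special linear group: order, character sums, fibres of the trace

  ∑-SL : ∀ n (f : Matrix n → ℤ) → ∑ (SL n) f ≡ ∑ (M n n) (λ A → ⟦ does (det n A ≟ 1#) ⟧ ℤ.* f A)
  ∑-SL n f = ∑-filter (λ A → does (det n A ≟ 1#)) (M n n) f

  |SL| : ∀ n → + length (SL (suc n)) ≡ Q ℤ.^ (suc n C 2) ℤ.* orderProd (suc n)
  |SL| n = begin
    + length (SL (suc n))           ≡⟨ ℤP.*-identityʳ _ ⟨
    + length (SL (suc n)) ℤ.* 1ℤ    ≡⟨ ∑-const (SL (suc n)) 1ℤ ⟨
    ∑ (SL (suc n)) (λ _ → 1ℤ)       ≡⟨ ∑-SL (suc n) _ ⟩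
    ∑ (M (suc n) (suc n)) (λ A → ⟦ does (det (suc n) A ≟ 1#) ⟧ ℤ.* 1ℤ)
                                    ≡⟨ ∑-cong (M (suc n) (suc n)) (λ A → ℤP.*-identityʳ _) ⟩
    detCount (suc n) 1#             ≡⟨ detCount-formula n 1# 1≉0 ⟩
    Q ℤ.^ (suc n C 2) ℤ.* orderProd (suc n) ∎
    where open ≡-Reasoning

  traceSum : ℕ → Carrier → ℤ
  traceSum n a = ∑ (SL n) (λ g → lam (a * Tr n g))

  traceSum-K : ∀ n → (∀ a → K n (pow a (suc n)) ≡ K n a) → ∀ a → ¬ (a ≈ 0#) →
    traceSum (suc n) a ≡ Q ℤ.^ (suc n C 2) ℤ.* K n a
  traceSum-K n Frob a a≉0 = ≡.trans (∑-SL (suc n) _) (≡.trans (detSum-K n a 1# a≉0 1≉0)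
    (cong (Q ℤ.^ (suc n C 2) ℤ.*_) (≡.trans (K-cong n (*-identityʳ _)) (Frob a))))

  Q≢0 : ¬ (Q ≡ 0ℤ)
  Q≢0 e = go E (complete 0#) (ℤP.+-injective e)
    where
    go : ∀ xs → Any (0# ≈_) xs → ¬ (length xs ≡ 0)
    go (x ∷ xs) _ ()

  module _ (n : ℕ) where
    open Code (suc (suc n))

    -- The matrix size is n + 2. For even n the sign left by the transform is 1 both at zero and
    -- away from zero, so the two cases share one formula.
    J-θ : signℤ n ≡ 1ℤ → ∀ β → J (suc n) β ≡ 1ℤ ℤ.+ Q ℤ.* θ β
    J-θ even β with β ≟ 0#
    ... | yes e = begin
      J (suc n) β                    ≡⟨ ≡.trans (J-cong (suc n) e) (J-zero (suc n)) ⟩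
      -1ℤ ℤ.* (-1ℤ ℤ.* signℤ n)      ≡⟨ cong (λ z → -1ℤ ℤ.* (-1ℤ ℤ.* z)) even ⟩
      1ℤ                             ≡⟨ ℤ+-congˡ 1ℤ (ℤP.*-zeroʳ Q) ⟨
      1ℤ ℤ.+ Q ℤ.* 0ℤ                ∎
      where open ≡-Reasoning
    ... | no β≉0 = ≡.trans (J-≉0 n β≉0) (≡.trans (ℤ+-congˡ (Q ℤ.* K n (β ⁻¹)) even) (ℤP.+-comm (Q ℤ.* K n (β ⁻¹)) 1ℤ))

    -- q n_β is the sum of λ(a (Tr g + β)) over all a and g. The term a = 0 gives the order of the
    -- group; the others give q^C(m,2) times the transform of the Kloosterman sum at β, where m = n
    -- + 2. The identity is proved multiplied by q, which is then cancelled.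
    nβ-formula : signℤ n ≡ 1ℤ → (∀ a → K (suc n) (pow a (suc (suc n))) ≡ K (suc n) a) → ∀ β →
      + nβ β ≡ Q ℤ.^ ((suc (suc n) C 2) ℕ.∸ 1) ℤ.* (orderProd (suc (suc n)) ℤ.+ 1ℤ ℤ.+ Q ℤ.* θ β)
    nβ-formula even Frob β = ℤP.*-cancelˡ-≡ Q (+ nβ β) _ {{ℤ.≢-nonZero Q≢0}} (begin
      Q ℤ.* + nβ β
        ≡⟨ ≡.trans (cong (Q ℤ.*_) (count-∑ _ (SL m))) (≡.sym (∑-*ˡ (SL m) Q _)) ⟩
      ∑ (SL m) (λ g → Q ℤ.* ⟦ does (Tr m g ≟ β) ⟧)
        ≡⟨ ∑-cong (SL m) (λ g → ≡.trans (cong (Q ℤ.*_) (⟦≟⟧-cong x≈y⇒x+y≈0 x+y≈0⇒x≈y)) (≡.sym (∑-lam-* (Tr m g + β)))) ⟩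
      ∑ (SL m) (λ g → ∑ E (λ a → lam (a * (Tr m g + β))))
        ≡⟨ ∑-swap (SL m) E _ ⟩
      ∑ E (λ a → ∑ (SL m) (λ g → lam (a * (Tr m g + β))))
        ≡⟨ ∑-cong E (λ a → ≡.trans (∑-cong (SL m) (λ g → ≡.trans (lam-cong (≈-trans (distribˡ a _ _) (+-comm _ _))) (lam-+ (a * β) (a * Tr m g))))
             (∑-*ˡ (SL m) (lam (a * β)) _)) ⟩
      ∑ E (λ a → lam (a * β) ℤ.* traceSum m a)
        ≡⟨ ∑-split0 _ (λ e → cong₂ ℤ._*_ (lam-cong (*-congʳ e)) (∑-cong (SL m) (λ g → lam-cong (*-congʳ e)))) ⟩
      lam (0# * β) ℤ.* traceSum m 0# ℤ.+ ∑ˣ (λ a → lam (a * β) ℤ.* traceSum m a)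
        ≡⟨ cong₂ ℤ._+_ (≡.trans (cong₂ ℤ._*_ (lam-0 (zeroˡ β)) (≡.trans (∑-cong (SL m) (λ g → lam-0 (zeroˡ _))) (∑-const (SL m) 1ℤ)))
               (≡.trans (ℤP.*-identityˡ _) (≡.trans (ℤP.*-identityʳ _) (|SL| (suc n)))))
             (≡.trans (∑ˣ-cong (λ a a≉0 → ≡.trans (cong (lam (a * β) ℤ.*_) (traceSum-K (suc n) Frob a a≉0))
               (lemma (lam (a * β)) P (K (suc n) a)))) (∑ˣ-*ˡ P _)) ⟩
      P ℤ.* orderProd m ℤ.+ P ℤ.* J (suc n) β
        ≡⟨ ≡.trans (≡.sym (ℤP.*-distribˡ-+ P (orderProd m) (J (suc n) β))) (cong (P ℤ.*_)
             (≡.trans (ℤ+-congˡ (orderProd m) (J-θ even β)) (≡.sym (ℤP.+-assoc (orderProd m) 1ℤ (Q ℤ.* θ β))))) ⟩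
      P ℤ.* (orderProd m ℤ.+ 1ℤ ℤ.+ Q ℤ.* θ β)
        ≡⟨ cong (ℤ._* (orderProd m ℤ.+ 1ℤ ℤ.+ Q ℤ.* θ β)) P-split ⟩
      (Q ℤ.* Q ℤ.^ ((m C 2) ℕ.∸ 1)) ℤ.* (orderProd m ℤ.+ 1ℤ ℤ.+ Q ℤ.* θ β)
        ≡⟨ ℤP.*-assoc Q (Q ℤ.^ ((m C 2) ℕ.∸ 1)) (orderProd m ℤ.+ 1ℤ ℤ.+ Q ℤ.* θ β) ⟩
      Q ℤ.* (Q ℤ.^ ((m C 2) ℕ.∸ 1) ℤ.* (orderProd m ℤ.+ 1ℤ ℤ.+ Q ℤ.* θ β)) ∎)
      where
      open ≡-Reasoning
      m = suc (suc n)
      P = Q ℤ.^ (m C 2)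
      lemma : ∀ l p k → l ℤ.* (p ℤ.* k) ≡ p ℤ.* (l ℤ.* k)
      lemma = solve-∀
      -- C(m,2) = (m - 1) + C(m-1,2) is positive for m ≥ 2, so the truncated subtraction in the
      -- exponent is a true one.
      P-split : P ≡ Q ℤ.* Q ℤ.^ ((m C 2) ℕ.∸ 1)
      P-split = go (m C 2) ([n+1]C2 (suc n))
        where
        go : ∀ k {l} → k ≡ suc l → Q ℤ.^ k ≡ Q ℤ.* Q ℤ.^ (k ℕ.∸ 1)
        go (suc k) _ = refl

  -- Counting codewords by families of multiplicities

  Weighting : Set
  Weighting = ℕ → Carrier → ℤ

  Congruent : Weighting → Set
  Congruent φ = ∀ k {x y} → x ≈ y → φ k x ≡ φ k y

  -- Accounts for k further elements with total v. A general weight of size and sum replaces the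
  -- indicator of the code, because the induction moves both arguments.
  shift : ℕ → Carrier → Weighting → Weighting
  shift k v φ s x = φ (k ℕ.+ s) (v + x)

  shift-cong : ∀ k v {φ} → Congruent φ → Congruent (shift k v φ)
  shift-cong k v φc s e = φc (k ℕ.+ s) (+-congˡ e)

  bits : ℕ → List (List Bool)
  bits n = tuples n (true ∷ false ∷ [])

  weightᵇ : List Bool → ℕ
  weightᵇ = count (λ b → b)

  ∑-bits-suc : ∀ n (f : List Bool → ℤ) →
    ∑ (bits (suc n)) f ≡ ∑ (bits n) (λ u → f (true ∷ u)) ℤ.+ ∑ (bits n) (λ u → f (false ∷ u))
  ∑-bits-suc n f = ≡.trans (∑-tuples-suc n (true ∷ false ∷ []) f)
    (ℤ+-congˡ (∑ (bits n) (λ u → f (true ∷ u))) (ℤP.+-identityʳ _))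

  module _ {X : Set} (t : X → Carrier) where

    dotᵇ : List Bool → List X → Carrier
    dotᵇ u gs = sumF (zipWith (λ b g → if b then t g else 0#) u gs)

    -- Any list and any function t stand in for the group and the trace, so that induction over the
    -- list is possible.
    subsetSum : List X → Weighting → ℤ
    subsetSum gs φ = ∑ (bits (length gs)) (λ u → φ (weightᵇ u) (dotᵇ u gs))

    subsetSum-∷ : ∀ g gs φ → Congruent φ → subsetSum (g ∷ gs) φ ≡ subsetSum gs (shift 1 (t g) φ) ℤ.+ subsetSum gs φ
    subsetSum-∷ g gs φ φc = ≡.trans
      (∑-bits-suc (length gs) (λ u → φ (weightᵇ u) (dotᵇ u (g ∷ gs))))
      (ℤ+-congˡ (subsetSum gs (shift 1 (t g) φ)) (∑-cong (bits (length gs)) (λ u → φc (weightᵇ u) (+-identityˡ _))))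

    fibreCount : List X → Carrier → ℕ
    fibreCount gs β = count (λ g → does (t g ≟ β)) gs

  module _ (m : ℕ) where

    familySum : List Carrier → (Carrier → ℕ) → Weighting → ℤ
    familySum βs c φ = ∑ (tuples (length βs) (upTo (suc m)))
      (λ ν → + prodℕ (zipWith (λ β v → c β C v) βs ν) ℤ.* φ (sumℕ ν) (sumF (zipWith natMul ν βs)))

    familySum-∷ : ∀ β βs c φ → familySum (β ∷ βs) c φ
      ≡ ∑ (upTo (suc m)) (λ k → + (c β C k) ℤ.* familySum βs c (shift k (natMul k β) φ))
    familySum-∷ β βs c φ = ≡.trans (∑-tuples-suc (length βs) (upTo (suc m)) _) (∑-cong (upTo (suc m)) (λ k →
      ≡.trans (∑-cong (tuples (length βs) (upTo (suc m))) (λ ν → ≡.trans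
          (cong (ℤ._* φ (k ℕ.+ sumℕ ν) (natMul k β + sumF (zipWith natMul ν βs))) (ℤP.pos-* (c β C k) _))
          (ℤP.*-assoc (+ (c β C k)) _ _)))
        (∑-*ˡ (tuples (length βs) (upTo (suc m))) (+ (c β C k)) _)))

    familySum-cong : ∀ βs c {φ ψ} → (∀ k x → φ k x ≡ ψ k x) → familySum βs c φ ≡ familySum βs c ψ
    familySum-cong βs c e = ∑-cong (tuples (length βs) (upTo (suc m))) (λ ν →
      cong (+ prodℕ (zipWith (λ β v → c β C v) βs ν) ℤ.*_) (e (sumℕ ν) (sumF (zipWith natMul ν βs))))

    familySum-congᶜ : ∀ {βs c c′} φ → All (λ β → c β ≡ c′ β) βs → familySum βs c φ ≡ familySum βs c′ φ
    familySum-congᶜ φ [] = refl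
    familySum-congᶜ {β ∷ βs} {c} {c′} φ (e ∷ es) = begin
      familySum (β ∷ βs) c φ
        ≡⟨ familySum-∷ β βs c φ ⟩
      ∑ (upTo (suc m)) (λ k → + (c β C k) ℤ.* familySum βs c (shift k (natMul k β) φ))
        ≡⟨ ∑-cong (upTo (suc m)) (λ k → cong₂ ℤ._*_ (cong (λ z → + (z C k)) e) (familySum-congᶜ (shift k (natMul k β) φ) es)) ⟩
      ∑ (upTo (suc m)) (λ k → + (c′ β C k) ℤ.* familySum βs c′ (shift k (natMul k β) φ))
        ≡⟨ familySum-∷ β βs c′ φ ⟨
      familySum (β ∷ βs) c′ φ ∎
      where open ≡-Reasoning

    -- The families have entries at most m; a weight that vanishes for sizes above m makes this
    -- truncation harmless.
    Bounded : Weighting → Set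
    Bounded φ = ∀ k x → m ℕ.< k → φ k x ≡ 0ℤ

    shift-bounded : ∀ k v {φ} → Bounded φ → Bounded (shift k v φ)
    shift-bounded k v φb s x m<s = φb (k ℕ.+ s) (v + x) (ℕP.≤-trans m<s (ℕP.m≤n+m s k))

    -- `fibreCount` of an extended list unfolds to exactly this, so adding one element is one
    -- `bump`.
    bump : Carrier → (Carrier → ℕ) → Carrier → ℕ
    bump v c β = if does (v ≟ β) then suc (c β) else c β

    -- Pascal's rule moves the term k to k + 1. The last one would leave the range at m + 1, where R
    -- vanishes.
    pascal-step : ∀ a (R : ℕ → ℤ) → R (suc m) ≡ 0ℤ →
      ∑ (upTo (suc m)) (λ k → + (suc a C k) ℤ.* R k)
        ≡ ∑ (upTo (suc m)) (λ k → + (a C k) ℤ.* R (suc k)) ℤ.+ ∑ (upTo (suc m)) (λ k → + (a C k) ℤ.* R k)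
    pascal-step a R Rm≡0 = begin
      ∑ (upTo (suc m)) (λ k → + (suc a C k) ℤ.* R k)
        ≡⟨ ∑-upTo-suc m (λ k → + (suc a C k) ℤ.* R k) ⟩
      1ℤ ℤ.* R 0 ℤ.+ ∑ (upTo m) (λ k → + (suc a C suc k) ℤ.* R (suc k))
        ≡⟨ ℤ+-congˡ (1ℤ ℤ.* R 0) (≡.trans (∑-cong (upTo m) (λ k → ≡.trans
             (cong (ℤ._* R (suc k)) (≡.trans (cong +_ (≡.sym (nCk+nC[k+1]≡[n+1]C[k+1] a k))) (ℤP.pos-+ (a C k) (a C suc k))))
             (ℤP.*-distribʳ-+ (R (suc k)) (+ (a C k)) (+ (a C suc k))))) (∑-+ (upTo m) _ _)) ⟩
      1ℤ ℤ.* R 0 ℤ.+ (S ℤ.+ S′)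
        ≡⟨ lemma (1ℤ ℤ.* R 0) S S′ (+ (a C m)) ⟩
      (S ℤ.+ + (a C m) ℤ.* 0ℤ) ℤ.+ (1ℤ ℤ.* R 0 ℤ.+ S′)
        ≡⟨ cong₂ ℤ._+_ (≡.trans (∑-upTo-snoc m _) (cong (λ z → S ℤ.+ + (a C m) ℤ.* z) Rm≡0)) (∑-upTo-suc m (λ k → + (a C k) ℤ.* R k)) ⟨
      ∑ (upTo (suc m)) (λ k → + (a C k) ℤ.* R (suc k)) ℤ.+ ∑ (upTo (suc m)) (λ k → + (a C k) ℤ.* R k) ∎
      where
      open ≡-Reasoning
      S  = ∑ (upTo m) (λ k → + (a C k) ℤ.* R (suc k))
      S′ = ∑ (upTo m) (λ k → + (a C suc k) ℤ.* R (suc k))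
      lemma : ∀ x s s′ z → x ℤ.+ (s ℤ.+ s′) ≡ (s ℤ.+ z ℤ.* 0ℤ) ℤ.+ (x ℤ.+ s′)
      lemma = solve-∀

    -- Since the list is distinct, only the binomial at the class of v changes. Pascal's rule there
    -- separates the choices that contain the new element, with size and sum moved, from those that
    -- do not.
    familySum-bump : ∀ v βs c φ → Congruent φ → Bounded φ → Any (v ≈_) βs → AllPairs (λ x y → ¬ (x ≈ y)) βs →
      familySum βs (bump v c) φ ≡ familySum βs c (shift 1 v φ) ℤ.+ familySum βs c φ
    familySum-bump v (β ∷ βs) c φ φc φb (here v≈β) (d ∷ ds) = begin
      familySum (β ∷ βs) (bump v c) φ
        ≡⟨ familySum-∷ β βs (bump v c) φ ⟩
      ∑ (upTo (suc m)) (λ k → + (bump v c β C k) ℤ.* familySum βs (bump v c) (shift k (natMul k β) φ))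
        ≡⟨ ∑-cong (upTo (suc m)) (λ k → cong₂ ℤ._*_
             (cong (λ b → + ((if b then suc (c β) else c β) C k)) (dec-true (v ≟ β) v≈β))
             (familySum-congᶜ (shift k (natMul k β) φ) (All.map (λ {γ} β≉γ →
               cong (if_then suc (c γ) else c γ) (dec-false (v ≟ γ) (λ v≈γ → β≉γ (≈-trans (≈-sym v≈β) v≈γ)))) d))) ⟩
      ∑ (upTo (suc m)) (λ k → + (suc (c β) C k) ℤ.* R k)
        ≡⟨ pascal-step (c β) R (≡.trans (familySum-cong βs c {ψ = λ _ _ → 0ℤ} (λ s x → φb (suc m ℕ.+ s) (natMul (suc m) β + x) (ℕP.m≤m+n (suc m) s)))
             (≡.trans (∑-cong (tuples (length βs) (upTo (suc m))) (λ ν → ℤP.*-zeroʳ (+ prodℕ (zipWith (λ β v → c β C v) βs ν)))) (∑-0 (tuples (length βs) (upTo (suc m)))))) ⟩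
      ∑ (upTo (suc m)) (λ k → + (c β C k) ℤ.* R (suc k)) ℤ.+ ∑ (upTo (suc m)) (λ k → + (c β C k) ℤ.* R k)
        ≡⟨ cong₂ ℤ._+_
             (≡.trans (familySum-∷ β βs c (shift 1 v φ)) (∑-cong (upTo (suc m)) (λ k → cong (+ (c β C k) ℤ.*_)
               (familySum-cong βs c (λ s x → φc (suc k ℕ.+ s) (≈-trans (≈-sym (+-assoc v _ x)) (+-congʳ (+-congʳ v≈β))))))))
             (familySum-∷ β βs c φ) ⟨
      familySum (β ∷ βs) c (shift 1 v φ) ℤ.+ familySum (β ∷ βs) c φ ∎
      where
      open ≡-Reasoning
      R : ℕ → ℤ
      R k = familySum βs c (shift k (natMul k β) φ)
    familySum-bump v (β ∷ βs) c φ φc φb (there v∈) (d ∷ ds) = begin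
      familySum (β ∷ βs) (bump v c) φ
        ≡⟨ familySum-∷ β βs (bump v c) φ ⟩
      ∑ (upTo (suc m)) (λ k → + (bump v c β C k) ℤ.* familySum βs (bump v c) (shift k (natMul k β) φ))
        ≡⟨ ∑-cong (upTo (suc m)) (λ k → ≡.trans (cong₂ ℤ._*_
             (cong (λ b → + ((if b then suc (c β) else c β) C k)) (dec-false (v ≟ β) v≉β))
             (≡.trans (familySum-bump v βs c (shift k (natMul k β) φ) (shift-cong k _ φc) (shift-bounded k _ φb) v∈ ds)
               (cong (ℤ._+ familySum βs c (shift k (natMul k β) φ)) (familySum-cong βs c (commute k)))))
             (ℤP.*-distribˡ-+ (+ (c β C k)) (familySum βs c (shift k (natMul k β) (shift 1 v φ))) (familySum βs c (shift k (natMul k β) φ)))) ⟩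
      ∑ (upTo (suc m)) (λ k → + (c β C k) ℤ.* familySum βs c (shift k (natMul k β) (shift 1 v φ))
                          ℤ.+ + (c β C k) ℤ.* familySum βs c (shift k (natMul k β) φ))
        ≡⟨ ∑-+ (upTo (suc m)) (λ k → + (c β C k) ℤ.* familySum βs c (shift k (natMul k β) (shift 1 v φ)))
             (λ k → + (c β C k) ℤ.* familySum βs c (shift k (natMul k β) φ)) ⟩
      ∑ (upTo (suc m)) (λ k → + (c β C k) ℤ.* familySum βs c (shift k (natMul k β) (shift 1 v φ)))
        ℤ.+ ∑ (upTo (suc m)) (λ k → + (c β C k) ℤ.* familySum βs c (shift k (natMul k β) φ))
        ≡⟨ cong₂ ℤ._+_ (familySum-∷ β βs c (shift 1 v φ)) (familySum-∷ β βs c φ) ⟨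
      familySum (β ∷ βs) c (shift 1 v φ) ℤ.+ familySum (β ∷ βs) c φ ∎
      where
      open ≡-Reasoning
      commute : ∀ k s x → shift 1 v (shift k (natMul k β) φ) s x ≡ shift k (natMul k β) (shift 1 v φ) s x
      commute k s x = ≡.trans (cong (λ l → φ l (natMul k β + (v + x))) (ℕP.+-suc k s))
        (φc (suc (k ℕ.+ s)) (solve 3 (λ a b c → a :+ (b :+ c) := b :+ (a :+ c)) ≈-refl (natMul k β) v x))
      absent : ∀ {βs} → Any (v ≈_) βs → All (λ y → ¬ (β ≈ y)) βs → ¬ (v ≈ β)
      absent (here v≈y)  (n ∷ _)  v≈β = n (≈-trans (≈-sym v≈β) v≈y)
      absent (there v∈′) (_ ∷ ns) v≈β = absent v∈′ ns v≈β
      v≉β : ¬ (v ≈ β)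
      v≉β = absent v∈ d

    familySum-0 : ∀ βs φ → Congruent φ → familySum βs (λ _ → 0) φ ≡ φ 0 0#
    familySum-0 []       φ φc = ≡.trans (ℤP.+-identityʳ _) (ℤP.*-identityˡ _)
    familySum-0 (β ∷ βs) φ φc = begin
      familySum (β ∷ βs) (λ _ → 0) φ
        ≡⟨ familySum-∷ β βs (λ _ → 0) φ ⟩
      ∑ (upTo (suc m)) (λ k → + (0 C k) ℤ.* R k)
        ≡⟨ ∑-upTo-suc m (λ k → + (0 C k) ℤ.* R k) ⟩
      1ℤ ℤ.* R 0 ℤ.+ ∑ (upTo m) (λ k → 0ℤ)
        ≡⟨ cong₂ ℤ._+_ (ℤP.*-identityˡ (R 0)) (∑-0 (upTo m)) ⟩
      R 0 ℤ.+ 0ℤ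
        ≡⟨ ℤP.+-identityʳ (R 0) ⟩
      R 0
        ≡⟨ familySum-0 βs (shift 0 0# φ) (shift-cong 0 0# φc) ⟩
      φ 0 (0# + 0#)
        ≡⟨ φc 0 (+-identityˡ 0#) ⟩
      φ 0 0# ∎
      where
      open ≡-Reasoning
      R : ℕ → ℤ
      R k = familySum βs (λ _ → 0) (shift k (natMul k β) φ)

    subsetSum-familySum : {X : Set} (t : X → Carrier) (gs : List X) (φ : Weighting) → Congruent φ → Bounded φ →
      subsetSum t gs φ ≡ familySum E (fibreCount t gs) φ
    subsetSum-familySum t []       φ φc φb = ≡.trans (ℤP.+-identityʳ _) (≡.sym (familySum-0 E φ φc))
    subsetSum-familySum t (g ∷ gs) φ φc φb = begin
      subsetSum t (g ∷ gs) φ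
        ≡⟨ subsetSum-∷ t g gs φ φc ⟩
      subsetSum t gs (shift 1 (t g) φ) ℤ.+ subsetSum t gs φ
        ≡⟨ cong₂ ℤ._+_ (subsetSum-familySum t gs (shift 1 (t g) φ) (shift-cong 1 (t g) φc) (shift-bounded 1 (t g) φb))
             (subsetSum-familySum t gs φ φc φb) ⟩
      familySum E (fibreCount t gs) (shift 1 (t g) φ) ℤ.+ familySum E (fibreCount t gs) φ
        ≡⟨ familySum-bump (t g) E (fibreCount t gs) φ φc φb (complete (t g)) distinct ⟨
      familySum E (fibreCount t (g ∷ gs)) φ ∎
      where open ≡-Reasoning

  sumℕ-∑ : {A : Set} (f : A → ℕ) (xs : List A) → + sumℕ (map f xs) ≡ ∑ xs (λ x → + f x)
  sumℕ-∑ f []       = refl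
  sumℕ-∑ f (x ∷ xs) = ≡.trans (ℤP.pos-+ (f x) _) (ℤ+-congˡ (+ f x) (sumℕ-∑ f xs))

  module _ (n : ℕ) where
    open Code n

    Cw≡CwFormula : ∀ i → Cw i ≡ CwFormula i
    Cw≡CwFormula i = ℤP.+-injective (begin
      + Cw i
        ≡⟨ count-∑ _ binVecs ⟩
      subsetSum (Tr n) (SL n) φ
        ≡⟨ subsetSum-familySum i (Tr n) (SL n) φ (λ k e → cong (λ b → ⟦ (k ℕ.≡ᵇ i) ∧ b ⟧)
             (does-cong (_ ≟ 0#) (_ ≟ 0#) (≈-trans (≈-sym e)) (≈-trans e)))
             (λ k x i<k → cong (λ b → ⟦ b ∧ isZero x ⟧) (≢ᵇ k i (ℕP.>⇒≢ i<k))) ⟩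
      familySum i E nβ φ
        ≡⟨ ∑-cong (tuples q (upTo (suc i))) (λ ν → ℤP.*-comm (+ prodℕ (zipWith (λ β v → nβ β C v) E ν)) (φ (sumℕ ν) _)) ⟩
      ∑ (tuples q (upTo (suc i))) (λ ν → φ (sumℕ ν) (sumF (zipWith natMul ν E)) ℤ.* + prodℕ (zipWith (λ β v → nβ β C v) E ν))
        ≡⟨ ∑-filter (λ ν → (sumℕ ν ℕ.≡ᵇ i) ∧ isZero (sumF (zipWith natMul ν E))) (tuples q (upTo (suc i))) _ ⟨
      ∑ (families i) (λ ν → + prodℕ (zipWith (λ β v → nβ β C v) E ν))
        ≡⟨ sumℕ-∑ _ (families i) ⟨
      + CwFormula i ∎)
      where
      open ≡-Reasoning
      φ : Weighting
      φ k x = ⟦ (k ℕ.≡ᵇ i) ∧ isZero x ⟧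
      ≢ᵇ : ∀ k l → ¬ (k ≡ l) → (k ℕ.≡ᵇ l) ≡ false
      ≢ᵇ k l k≢l with k ℕ.≡ᵇ l in eq
      ... | false = refl
      ... | true  = ⊥-elim (k≢l (ℕP.≡ᵇ⇒≡ k l (subst T (≡.sym eq) _)))

  -- Power moments of the character sums

  zerosᵇ : List Bool → ℕ
  zerosᵇ = count not

  ∑-bits-cong : ∀ n {f g : List Bool → ℤ} → (∀ u → weightᵇ u ℕ.+ zerosᵇ u ≡ n → f u ≡ g u) → ∑ (bits n) f ≡ ∑ (bits n) g
  ∑-bits-cong zero    e = cong (ℤ._+ 0ℤ) (e [] refl)
  ∑-bits-cong (suc n) {f} {g} e = ≡.trans (∑-bits-suc n f) (≡.trans
    (cong₂ ℤ._+_ (∑-bits-cong n (λ u p → e (true ∷ u) (cong suc p)))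
      (∑-bits-cong n (λ u p → e (false ∷ u) (≡.trans (ℕP.+-suc (weightᵇ u) (zerosᵇ u)) (cong suc p)))))
    (≡.sym (∑-bits-suc n g)))

  module _ {X : Set} (t : X → Carrier) (a : Carrier) where

    negatives : List X → ℕ
    negatives = count (λ g → not (isZero (tr (a * t g))))

    ∑-lam-negatives : ∀ gs → + length gs ℤ.- ∑ gs (λ g → lam (a * t g)) ≡ + 2 ℤ.* + negatives gs
    ∑-lam-negatives [] = refl
    ∑-lam-negatives (g ∷ gs) with isZero (tr (a * t g))
    ... | true  = ≡.trans (same (+ length gs) (∑ gs (λ g → lam (a * t g)))) (∑-lam-negatives gs)
      where
      same : ∀ l s → (1ℤ ℤ.+ l) ℤ.- (1ℤ ℤ.+ s) ≡ l ℤ.- s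
      same = solve-∀
    ... | false = ≡.trans (more (+ length gs) (∑ gs (λ g → lam (a * t g)))) (≡.trans (ℤ+-congˡ (+ 2) (∑-lam-negatives gs)) (dist (+ negatives gs)))
      where
      more : ∀ l s → (1ℤ ℤ.+ l) ℤ.- (-1ℤ ℤ.+ s) ≡ + 2 ℤ.+ (l ℤ.- s)
      more = solve-∀
      dist : ∀ x → + 2 ℤ.+ + 2 ℤ.* x ≡ + 2 ℤ.* (1ℤ ℤ.+ x)
      dist = solve-∀

    -- In the expansion of the product of (1 + x) - λ(a t(g)) x, a true bit picks -λ(a t(g)) x and a
    -- false bit picks 1 + x. This is the coefficient of x^k in the term of u, with the characters
    -- combined by additivity.
    charTerm : List X → ℕ → List Bool → ℤ
    charTerm gs k u = signℤ (weightᵇ u) ℤ.* (lam (a * dotᵇ t u gs) ℤ.* + coef (weightᵇ u) (zerosᵇ u) k)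

    charSum : List X → ℕ → ℤ
    charSum gs k = ∑ (bits (length gs)) (charTerm gs k)

    charTerm-false-0 : ∀ g gs u → charTerm (g ∷ gs) 0 (false ∷ u) ≡ charTerm gs 0 u
    charTerm-false-0 g gs u = cong (signℤ (weightᵇ u) ℤ.*_) (cong₂ ℤ._*_
      (lam-cong (*-congˡ (+-identityˡ _))) (cong +_ (coef-0 (weightᵇ u) (zerosᵇ u))))

    charTerm-false : ∀ g gs k u → charTerm (g ∷ gs) (suc k) (false ∷ u) ≡ charTerm gs k u ℤ.+ charTerm gs (suc k) u
    charTerm-false g gs k u = ≡.trans (cong (signℤ (weightᵇ u) ℤ.*_) (cong₂ ℤ._*_
        (lam-cong (*-congˡ (+-identityˡ _)))
        (≡.trans (cong +_ (coef-suc (weightᵇ u) (zerosᵇ u) k)) (ℤP.pos-+ (coef (weightᵇ u) (zerosᵇ u) k) _))))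
      (dist (signℤ (weightᵇ u)) (lam (a * dotᵇ t u gs)) (+ coef (weightᵇ u) (zerosᵇ u) k) (+ coef (weightᵇ u) (zerosᵇ u) (suc k)))
      where
      dist : ∀ s l x y → s ℤ.* (l ℤ.* (x ℤ.+ y)) ≡ s ℤ.* (l ℤ.* x) ℤ.+ s ℤ.* (l ℤ.* y)
      dist = solve-∀

    charTerm-true : ∀ g gs k u → charTerm (g ∷ gs) (suc k) (true ∷ u) ≡ (ℤ.- lam (a * t g)) ℤ.* charTerm gs k u
    charTerm-true g gs k u = ≡.trans (cong (λ l → signℤ (suc (weightᵇ u)) ℤ.* (l ℤ.* + coef (weightᵇ u) (zerosᵇ u) k))
        (≡.trans (lam-cong (distribˡ a _ _)) (lam-+ (a * t g) (a * dotᵇ t u gs))))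
      (rearrange (signℤ (weightᵇ u)) (lam (a * t g)) (lam (a * dotᵇ t u gs)) (+ coef (weightᵇ u) (zerosᵇ u) k))
      where
      rearrange : ∀ s l m x → (-1ℤ ℤ.* s) ℤ.* ((l ℤ.* m) ℤ.* x) ≡ (ℤ.- l) ℤ.* (s ℤ.* (m ℤ.* x))
      rearrange = solve-∀

    charSum-0 : ∀ g gs → charSum (g ∷ gs) 0 ≡ charSum gs 0
    charSum-0 g gs = ≡.trans (∑-bits-suc (length gs) (charTerm (g ∷ gs) 0)) (≡.trans
      (cong₂ ℤ._+_ (≡.trans (∑-cong (bits (length gs)) (λ u → vanish (signℤ (suc (weightᵇ u))) (lam (a * dotᵇ t (true ∷ u) (g ∷ gs))))) (∑-0 (bits (length gs))))
        (∑-cong (bits (length gs)) (charTerm-false-0 g gs))) (ℤP.+-identityˡ _))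
      where
      vanish : ∀ s l → s ℤ.* (l ℤ.* 0ℤ) ≡ 0ℤ
      vanish = solve-∀

    charSum-suc : ∀ g gs k → charSum (g ∷ gs) (suc k) ≡ (ℤ.- lam (a * t g)) ℤ.* charSum gs k ℤ.+ (charSum gs k ℤ.+ charSum gs (suc k))
    charSum-suc g gs k = ≡.trans (∑-bits-suc (length gs) (charTerm (g ∷ gs) (suc k))) (cong₂ ℤ._+_
      (≡.trans (∑-cong (bits (length gs)) (charTerm-true g gs k)) (∑-*ˡ (bits (length gs)) (ℤ.- lam (a * t g)) (charTerm gs k)))
      (≡.trans (∑-cong (bits (length gs)) (charTerm-false g gs k)) (∑-+ (bits (length gs)) (charTerm gs k) (charTerm gs (suc k)))))

    -- Compare coefficients of xᵏ in ∏ ((1 + x) - λ(a t(g)) x) = (1 + 2x)^w, where w = negatives gs.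
    charSum-binomial : ∀ gs k → charSum gs k ≡ (+ 2) ℤ.^ k ℤ.* + (negatives gs C k)
    charSum-binomial [] zero    = cong (λ l → 1ℤ ℤ.* (l ℤ.* 1ℤ) ℤ.+ 0ℤ) (lam-0 (zeroʳ a))
    charSum-binomial [] (suc k) = ≡.trans (vanish (lam (a * 0#))) (≡.sym (ℤP.*-zeroʳ ((+ 2) ℤ.^ suc k)))
      where
      vanish : ∀ l → 1ℤ ℤ.* (l ℤ.* 0ℤ) ℤ.+ 0ℤ ≡ 0ℤ
      vanish = solve-∀
    charSum-binomial (g ∷ gs) zero    = ≡.trans (charSum-0 g gs) (charSum-binomial gs 0)
    charSum-binomial (g ∷ gs) (suc k) = ≡.trans (charSum-suc g gs k) step
      where
      A = charSum gs k
      B = charSum gs (suc k)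
      w = negatives gs
      positive : ∀ x y → (ℤ.- 1ℤ) ℤ.* x ℤ.+ (x ℤ.+ y) ≡ y
      positive = solve-∀
      negative : ∀ p x y → (ℤ.- -1ℤ) ℤ.* (p ℤ.* x) ℤ.+ (p ℤ.* x ℤ.+ (+ 2 ℤ.* p) ℤ.* y) ≡ (+ 2 ℤ.* p) ℤ.* (x ℤ.+ y)
      negative = solve-∀
      step : (ℤ.- lam (a * t g)) ℤ.* A ℤ.+ (A ℤ.+ B) ≡ (+ 2) ℤ.^ suc k ℤ.* + (negatives (g ∷ gs) C suc k)
      step with isZero (tr (a * t g))
      ... | true  = ≡.trans (positive A B) (charSum-binomial gs (suc k))
      ... | false = ≡.trans (cong₂ (λ x y → (ℤ.- -1ℤ) ℤ.* x ℤ.+ (x ℤ.+ y)) (charSum-binomial gs k) (charSum-binomial gs (suc k)))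
        (≡.trans (negative ((+ 2) ℤ.^ k) (+ (w C k)) (+ (w C suc k))) (cong ((+ 2) ℤ.^ suc k ℤ.*_) (≡.sym (pascalℤ w k))))

  module _ (n : ℕ) where
    open Code n

    innerSum : ℕ → ℕ → ℤ
    innerSum h i = sumℤ (map (λ t → (+ (t !)) ℤ.* stirling2 h t ℤ.* ((+ 2) ℤ.^ (h ℕ.∸ t)) ℤ.* (+ binomNN i t)) (fromTo i h))

    -- With N - w = z, the symmetry of binomials turns C(N-w, N-w-k) into C(z,k). Past N the default
    -- value 0 agrees with C(z,k) for k > z.
    binomNN-+ : ∀ w z k → w ℕ.+ z ≡ N → binomNN w (w ℕ.+ k) ≡ z C k
    binomNN-+ w z k w+z≡N with (w ℕ.+ k) ℕ.≤ᵇ N in eq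
    ... | true  = ≡.trans (cong₂ _C_ N∸w N∸[w+k]) (≡.sym (nCk≡nC[n∸k] k≤z))
      where
      k≤z : k ℕ.≤ z
      k≤z = ℕP.+-cancelˡ-≤ w k z (subst (w ℕ.+ k ℕ.≤_) (≡.sym w+z≡N) (ℕP.≤ᵇ⇒≤ (w ℕ.+ k) N (subst T (≡.sym eq) _)))
      N∸w : N ℕ.∸ w ≡ z
      N∸w = ≡.trans (cong (ℕ._∸ w) (≡.sym w+z≡N)) (ℕP.m+n∸m≡n w z)
      N∸[w+k] : N ℕ.∸ (w ℕ.+ k) ≡ z ℕ.∸ k
      N∸[w+k] = ≡.trans (≡.sym (ℕP.∸-+-assoc N w k)) (cong (ℕ._∸ k) N∸w)
    ... | false = ≡.sym (k>n⇒nCk≡0 (ℕP.+-cancelˡ-< w z k (subst (ℕ._< w ℕ.+ k) (≡.sym w+z≡N)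
        (ℕP.≰⇒> (λ le → subst T eq (ℕP.≤⇒≤ᵇ le))))))

    -- x^w (1 + x)^z has no terms below x^w, so the sum over t ≤ h effectively begins at t = w. For
    -- w > h both sides vanish.
    innerSum-coef : ∀ h w z → w ℕ.+ z ≡ N →
      ∑ (upTo (suc h)) (λ t → (+ surjections h t ℤ.* (+ 2) ℤ.^ (h ℕ.∸ t)) ℤ.* + coef w z t) ≡ innerSum h w
    innerSum-coef h w z w+z≡N = ≡.trans (tail (ℕP.≤-total w (suc h))) (≡.sym (≡.trans
        (∑-map (upTo (suc h ℕ.∸ w)) (w ℕ.+_) _)
        (∑-cong (upTo (suc h ℕ.∸ w)) (λ k → cong₂ ℤ._*_
          (cong (ℤ._* (+ 2) ℤ.^ (h ℕ.∸ (w ℕ.+ k))) (t!*stirling2 h (w ℕ.+ k)))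
          (cong +_ (≡.trans (binomNN-+ w z k w+z≡N) (≡.sym (coef-+ w z k))))))))
      where
      open ≡-Reasoning
      f : ℕ → ℤ
      f t = (+ surjections h t ℤ.* (+ 2) ℤ.^ (h ℕ.∸ t)) ℤ.* + coef w z t
      below : ∀ t → t ℕ.< w → f t ≡ 0ℤ
      below t t<w = ≡.trans (cong (λ c → (+ surjections h t ℤ.* (+ 2) ℤ.^ (h ℕ.∸ t)) ℤ.* + c) (coef-< w z t t<w))
        (ℤP.*-zeroʳ (+ surjections h t ℤ.* (+ 2) ℤ.^ (h ℕ.∸ t)))
      tail : w ℕ.≤ suc h ⊎ suc h ℕ.≤ w → ∑ (upTo (suc h)) f ≡ ∑ (upTo (suc h ℕ.∸ w)) (λ k → f (w ℕ.+ k))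
      tail (inj₁ w≤1+h) = begin
        ∑ (upTo (suc h)) f
          ≡⟨ cong (λ m → ∑ (upTo m) f) (ℕP.m+[n∸m]≡n w≤1+h) ⟨
        ∑ (upTo (w ℕ.+ (suc h ℕ.∸ w))) f
          ≡⟨ ∑-upTo-+ w (suc h ℕ.∸ w) f ⟩
        ∑ (upTo w) f ℤ.+ ∑ (upTo (suc h ℕ.∸ w)) (λ k → f (w ℕ.+ k))
          ≡⟨ cong (ℤ._+ ∑ (upTo (suc h ℕ.∸ w)) (λ k → f (w ℕ.+ k))) (∑-upTo-zero w f below) ⟩
        0ℤ ℤ.+ ∑ (upTo (suc h ℕ.∸ w)) (λ k → f (w ℕ.+ k))
          ≡⟨ ℤP.+-identityˡ _ ⟩
        ∑ (upTo (suc h ℕ.∸ w)) (λ k → f (w ℕ.+ k)) ∎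
      tail (inj₂ 1+h≤w) = ≡.trans (∑-upTo-zero (suc h) f (λ t t<1+h → below t (ℕP.≤-trans t<1+h 1+h≤w)))
        (cong (λ m → ∑ (upTo m) (λ k → f (w ℕ.+ k))) (≡.sym (ℕP.m≤n⇒m∸n≡0 1+h≤w)))

    weightedSum : ℕ → ℤ
    weightedSum h = ∑ (fromTo 0 (N ℕ.⊓ h)) (λ i → signℤ i ℤ.* + Cw i ℤ.* innerSum h i)

    -- Weights above N do not occur, and above h the inner sum is empty; hence the cutoff at
    -- min(N,h).
    codewords-by-weight : ∀ h →
      ∑ binVecs (λ u → ⟦ isZero (dot u) ⟧ ℤ.* (signℤ (weight u) ℤ.* innerSum h (weight u))) ≡ weightedSum h
    codewords-by-weight h = ≡.sym (begin
      weightedSum h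
        ≡⟨ ∑-map (upTo M₁) (0 ℕ.+_) (λ i → signℤ i ℤ.* + Cw i ℤ.* innerSum h i) ⟩
      ∑ (upTo M₁) (λ i → signℤ i ℤ.* + Cw i ℤ.* innerSum h i)
        ≡⟨ ∑-cong (upTo M₁) (λ i → ≡.trans (cong (λ z → signℤ i ℤ.* z ℤ.* innerSum h i) (count-∑ _ binVecs))
             (≡.trans (rearrange₁ (signℤ i) (∑ binVecs (λ u → ⟦ (weight u ℕ.≡ᵇ i) ∧ isZero (dot u) ⟧)) (innerSum h i)) (≡.sym (∑-*ʳ binVecs (φ i) _)))) ⟩
      ∑ (upTo M₁) (λ i → ∑ binVecs (λ u → ⟦ (weight u ℕ.≡ᵇ i) ∧ isZero (dot u) ⟧ ℤ.* φ i))
        ≡⟨ ∑-swap (upTo M₁) binVecs _ ⟩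
      ∑ binVecs (λ u → ∑ (upTo M₁) (λ i → ⟦ (weight u ℕ.≡ᵇ i) ∧ isZero (dot u) ⟧ ℤ.* φ i))
        ≡⟨ ∑-bits-cong N (λ u w+z≡N → ≡.trans
             (∑-cong (upTo M₁) (λ i → ≡.trans (cong (ℤ._* φ i) (⟦∧⟧ (weight u ℕ.≡ᵇ i) (isZero (dot u))))
               (ℤP.*-assoc ⟦ weight u ℕ.≡ᵇ i ⟧ ⟦ isZero (dot u) ⟧ (φ i))))
             (pick u (ℕP.<-≤-connex (weight u) M₁) (subst (weight u ℕ.≤_) w+z≡N (ℕP.m≤m+n (weight u) (zerosᵇ u))))) ⟩
      ∑ binVecs (λ u → ⟦ isZero (dot u) ⟧ ℤ.* φ (weight u)) ∎)
      where
      open ≡-Reasoning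
      M₁ : ℕ
      M₁ = suc (N ℕ.⊓ h)
      φ : ℕ → ℤ
      φ i = signℤ i ℤ.* innerSum h i
      rearrange₁ : ∀ s c g → s ℤ.* c ℤ.* g ≡ c ℤ.* (s ℤ.* g)
      rearrange₁ = solve-∀
      φ-large : ∀ w → h ℕ.< w → φ w ≡ 0ℤ
      φ-large w h<w = ≡.trans (cong (λ m → signℤ w ℤ.* sumℤ (map (λ t → (+ (t !)) ℤ.* stirling2 h t ℤ.* ((+ 2) ℤ.^ (h ℕ.∸ t)) ℤ.* (+ binomNN w t)) (map (w ℕ.+_) (upTo m))))
        (ℕP.m≤n⇒m∸n≡0 h<w)) (ℤP.*-zeroʳ (signℤ w))
      pick : ∀ u → weight u ℕ.< M₁ ⊎ M₁ ℕ.≤ weight u → weight u ℕ.≤ N →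
        ∑ (upTo M₁) (λ i → ⟦ weight u ℕ.≡ᵇ i ⟧ ℤ.* (⟦ isZero (dot u) ⟧ ℤ.* φ i)) ≡ ⟦ isZero (dot u) ⟧ ℤ.* φ (weight u)
      pick u (inj₁ w<) w≤N = ∑-upTo-δ M₁ (weight u) (λ i → ⟦ isZero (dot u) ⟧ ℤ.* φ i) w<
      pick u (inj₂ ≤w) w≤N = ≡.trans (∑-upTo-δ-≥ M₁ (weight u) (λ i → ⟦ isZero (dot u) ⟧ ℤ.* φ i) ≤w)
        (≡.sym (≡.trans (cong (⟦ isZero (dot u) ⟧ ℤ.*_) (φ-large (weight u) h<w)) (ℤP.*-zeroʳ ⟦ isZero (dot u) ⟧)))
        where
        h<w : h ℕ.< weight u
        h<w with ℕP.≤-total N h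
        ... | inj₁ N≤h = ⊥-elim (ℕP.<⇒≱ (subst (λ m → suc m ℕ.≤ weight u) (ℕP.m≤n⇒m⊓n≡m N≤h) ≤w) w≤N)
        ... | inj₂ h≤N = subst (λ m → suc m ℕ.≤ weight u) (ℕP.m≥n⇒m⊓n≡n h≤N) ≤w

    power-charSum : ∀ h a → (+ N ℤ.- traceSum n a) ℤ.^ h
      ≡ ∑ (upTo (suc h)) (λ t → (+ surjections h t ℤ.* (+ 2) ℤ.^ (h ℕ.∸ t)) ℤ.* charSum (Tr n) a (SL n) t)
    power-charSum h a = begin
      (+ N ℤ.- traceSum n a) ℤ.^ h
        ≡⟨ cong (ℤ._^ h) (∑-lam-negatives (Tr n) a (SL n)) ⟩
      (+ 2 ℤ.* + w) ℤ.^ h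
        ≡⟨ ≡.trans (^-*ℤ (+ 2) (+ w) h) (cong ((+ 2) ℤ.^ h ℤ.*_) (≡.trans (pos-^ w h) (pow-surjections w h))) ⟩
      (+ 2) ℤ.^ h ℤ.* ∑ (upTo (suc h)) (λ t → + surjections h t ℤ.* + (w C t))
        ≡⟨ ∑-*ˡ (upTo (suc h)) ((+ 2) ℤ.^ h) (λ t → + surjections h t ℤ.* + (w C t)) ⟨
      ∑ (upTo (suc h)) (λ t → (+ 2) ℤ.^ h ℤ.* (+ surjections h t ℤ.* + (w C t)))
        -- Of the factor 2^h, the part 2^t joins C(w,t) to form the character sum of index t, and
        -- 2^(h-t) stays as a coefficient.
        ≡⟨ ∑-upTo-cong (suc h) (λ t t≤h → ≡.trans (cong (ℤ._* (+ surjections h t ℤ.* + (w C t)))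
             (≡.trans (cong ((+ 2) ℤ.^_) (≡.sym (ℕP.m∸n+n≡m (ℕP.≤-pred t≤h)))) (ℤP.^-distribˡ-+-* (+ 2) (h ℕ.∸ t) t)))
             (≡.trans (rearrange ((+ 2) ℤ.^ (h ℕ.∸ t)) ((+ 2) ℤ.^ t) (+ surjections h t) (+ (w C t)))
               (cong ((+ surjections h t ℤ.* (+ 2) ℤ.^ (h ℕ.∸ t)) ℤ.*_) (≡.sym (charSum-binomial (Tr n) a (SL n) t))))) ⟩
      ∑ (upTo (suc h)) (λ t → (+ surjections h t ℤ.* (+ 2) ℤ.^ (h ℕ.∸ t)) ℤ.* charSum (Tr n) a (SL n) t) ∎
      where
      open ≡-Reasoning
      w = negatives (Tr n) a (SL n)
      rearrange : ∀ p p′ y c → (p ℤ.* p′) ℤ.* (y ℤ.* c) ≡ (y ℤ.* p) ℤ.* (p′ ℤ.* c)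
      rearrange = solve-∀

    ∑-charSum : ∀ k → ∑ E (λ a → charSum (Tr n) a (SL n) k)
      ≡ Q ℤ.* ∑ binVecs (λ u → ⟦ isZero (dot u) ⟧ ℤ.* (signℤ (weight u) ℤ.* + coef (weight u) (zerosᵇ u) k))
    ∑-charSum k = begin
      ∑ E (λ a → charSum (Tr n) a (SL n) k)
        ≡⟨ ∑-swap E binVecs _ ⟩
      ∑ binVecs (λ u → ∑ E (λ a → signℤ (weight u) ℤ.* (lam (a * dot u) ℤ.* + coef (weight u) (zerosᵇ u) k)))
        ≡⟨ ∑-cong binVecs (λ u → ≡.trans (∑-cong E (λ a → rearrange₁ (signℤ (weight u)) (lam (a * dot u)) (+ coef (weight u) (zerosᵇ u) k)))
             (≡.trans (∑-*ʳ E (signℤ (weight u) ℤ.* + coef (weight u) (zerosᵇ u) k) (λ a → lam (a * dot u)))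
               (≡.trans (cong (ℤ._* (signℤ (weight u) ℤ.* + coef (weight u) (zerosᵇ u) k)) (∑-lam-* (dot u)))
                 (ℤP.*-assoc Q ⟦ isZero (dot u) ⟧ (signℤ (weight u) ℤ.* + coef (weight u) (zerosᵇ u) k))))) ⟩
      ∑ binVecs (λ u → Q ℤ.* (⟦ isZero (dot u) ⟧ ℤ.* (signℤ (weight u) ℤ.* + coef (weight u) (zerosᵇ u) k)))
        ≡⟨ ∑-*ˡ binVecs Q _ ⟩
      Q ℤ.* ∑ binVecs (λ u → ⟦ isZero (dot u) ⟧ ℤ.* (signℤ (weight u) ℤ.* + coef (weight u) (zerosᵇ u) k)) ∎
      where
      open ≡-Reasoning
      rearrange₁ : ∀ s l c → s ℤ.* (l ℤ.* c) ≡ l ℤ.* (s ℤ.* c)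
      rearrange₁ = solve-∀

    -- The sum includes a = 0, as orthogonality requires; it turns each binary vector u into q times
    -- the indicator of u · v = 0.
    power-moment : ∀ h → ∑ E (λ a → (+ N ℤ.- traceSum n a) ℤ.^ h) ≡ Q ℤ.* weightedSum h
    power-moment h = begin
      ∑ E (λ a → (+ N ℤ.- traceSum n a) ℤ.^ h)
        ≡⟨ ≡.trans (∑-cong E (power-charSum h)) (∑-swap E (upTo (suc h)) (λ a t → c t ℤ.* charSum (Tr n) a (SL n) t)) ⟩
      ∑ (upTo (suc h)) (λ t → ∑ E (λ a → c t ℤ.* charSum (Tr n) a (SL n) t))
        ≡⟨ ∑-cong (upTo (suc h)) (λ t → ≡.trans (∑-*ˡ E (c t) _) (≡.trans (cong (c t ℤ.*_) (∑-charSum t))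
             (≡.trans (rearrange₁ (c t) Q (∑ binVecs (λ u → ζ u ℤ.* (σ u ℤ.* κ u t)))) (cong (Q ℤ.*_) (≡.sym (∑-*ˡ binVecs (c t) _)))))) ⟩
      ∑ (upTo (suc h)) (λ t → Q ℤ.* ∑ binVecs (λ u → c t ℤ.* (ζ u ℤ.* (σ u ℤ.* κ u t))))
        ≡⟨ ≡.trans (∑-*ˡ (upTo (suc h)) Q (λ t → ∑ binVecs (λ u → c t ℤ.* (ζ u ℤ.* (σ u ℤ.* κ u t)))))
             (cong (Q ℤ.*_) (∑-swap (upTo (suc h)) binVecs (λ t u → c t ℤ.* (ζ u ℤ.* (σ u ℤ.* κ u t))))) ⟩
      Q ℤ.* ∑ binVecs (λ u → ∑ (upTo (suc h)) (λ t → c t ℤ.* (ζ u ℤ.* (σ u ℤ.* κ u t))))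
        ≡⟨ cong (Q ℤ.*_) (∑-bits-cong N (λ u w+z≡N → ≡.trans (∑-cong (upTo (suc h)) (λ t → rearrange₂ (c t) (ζ u) (σ u) (κ u t)))
             (≡.trans (∑-*ˡ (upTo (suc h)) (ζ u ℤ.* σ u) (λ t → c t ℤ.* κ u t))
               (≡.trans (cong ((ζ u ℤ.* σ u) ℤ.*_) (innerSum-coef h (weight u) (zerosᵇ u) w+z≡N)) (ℤP.*-assoc (ζ u) (σ u) (innerSum h (weight u))))))) ⟩
      Q ℤ.* ∑ binVecs (λ u → ζ u ℤ.* (σ u ℤ.* innerSum h (weight u)))
        ≡⟨ cong (Q ℤ.*_) (codewords-by-weight h) ⟩
      Q ℤ.* weightedSum h ∎
      where
      open ≡-Reasoning
      c : ℕ → ℤ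
      c t = + surjections h t ℤ.* (+ 2) ℤ.^ (h ℕ.∸ t)
      ζ σ : List Bool → ℤ
      ζ u = ⟦ isZero (dot u) ⟧
      σ u = signℤ (weight u)
      κ : List Bool → ℕ → ℤ
      κ u t = + coef (weight u) (zerosᵇ u) t
      rearrange₁ : ∀ c q s → c ℤ.* (q ℤ.* s) ≡ q ℤ.* (c ℤ.* s)
      rearrange₁ = solve-∀
      rearrange₂ : ∀ c z s k → c ℤ.* (z ℤ.* (s ℤ.* k)) ≡ (z ℤ.* s) ℤ.* (c ℤ.* k)
      rearrange₂ = solve-∀

  -- The recursion for the moments of the Kloosterman sums

  module _ (n : ℕ) (Frob : ∀ a → K n (pow a (suc n)) ≡ K n a) where
    open Code (suc n)

    private
      P : ℤ
      P = Q ℤ.^ (suc n C 2)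

      T′ : ℕ → ℕ → ℤ
      T′ h i = (+ (h C i) ℤ.* (+ N) ℤ.^ (h ℕ.∸ i)) ℤ.* (signℤ i ℤ.* P ℤ.^ i) ℤ.* MK n i

    -- At a = 0 the trace sum equals N, so that term of the moment is 0^h = 0. For the other a, the
    -- power of N - `P` K(a) is expanded by the binomial theorem.
    moment-expansion : ∀ h → 1 ℕ.≤ h → ∑ (upTo (suc h)) (T′ h) ≡ Q ℤ.* weightedSum (suc n) h
    moment-expansion h@(suc h-1) _ = begin
      ∑ (upTo (suc h)) (T′ h)
        ≡⟨ ∑-cong (upTo (suc h)) (λ i → ≡.trans (cong (A i ℤ.*_) (∑-nonzeros (λ a → K n a ℤ.^ i))) (≡.sym (∑ˣ-*ˡ (A i) (λ a → K n a ℤ.^ i)))) ⟩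
      ∑ (upTo (suc h)) (λ i → ∑ˣ (λ a → A i ℤ.* K n a ℤ.^ i))
        ≡⟨ ∑ˣ-swap-∑ (upTo (suc h)) (λ a i → A i ℤ.* K n a ℤ.^ i) ⟨
      ∑ˣ (λ a → ∑ (upTo (suc h)) (λ i → A i ℤ.* K n a ℤ.^ i))
        ≡⟨ ∑ˣ-cong expand ⟨
      ∑ˣ X
        ≡⟨ ℤP.+-identityˡ _ ⟨
      0ℤ ℤ.+ ∑ˣ X
        ≡⟨ cong (ℤ._+ ∑ˣ X) X-0 ⟨
      X 0# ℤ.+ ∑ˣ X
        ≡⟨ ∑-split0 X (λ e → cong (λ z → (+ N ℤ.- z) ℤ.^ h) (∑-cong (SL (suc n)) (λ g → lam-cong (*-congʳ e)))) ⟨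
      ∑ E X
        ≡⟨ power-moment (suc n) h ⟩
      Q ℤ.* weightedSum (suc n) h ∎
      where
      open ≡-Reasoning
      A : ℕ → ℤ
      A i = (+ (h C i) ℤ.* (+ N) ℤ.^ (h ℕ.∸ i)) ℤ.* (signℤ i ℤ.* P ℤ.^ i)
      X : Carrier → ℤ
      X a = (+ N ℤ.- traceSum (suc n) a) ℤ.^ h
      X-0 : X 0# ≡ 0ℤ
      X-0 = cong (λ z → z ℤ.* z ℤ.^ h-1) (≡.trans (cong (λ z → + N ℤ.- z) (≡.trans
        (∑-cong (SL (suc n)) (λ g → lam-0 (zeroˡ (Tr (suc n) g)))) (≡.trans (∑-const (SL (suc n)) 1ℤ) (ℤP.*-identityʳ (+ N)))))
        (ℤP.+-inverseʳ (+ N)))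
      neg : ∀ p k → ℤ.- (p ℤ.* k) ≡ (-1ℤ ℤ.* p) ℤ.* k
      neg = solve-∀
      rearrange : ∀ c m s p k → c ℤ.* (m ℤ.* (s ℤ.* p ℤ.* k)) ≡ (c ℤ.* m) ℤ.* (s ℤ.* p) ℤ.* k
      rearrange = solve-∀
      expand : ∀ a → ¬ (a ≈ 0#) → X a ≡ ∑ (upTo (suc h)) (λ i → A i ℤ.* K n a ℤ.^ i)
      expand a a≉0 = ≡.trans (cong (λ z → (+ N ℤ.+ z) ℤ.^ h) (≡.trans (cong ℤ.-_ (traceSum-K n Frob a a≉0)) (neg P (K n a))))
        (≡.trans (binomial (+ N) ((-1ℤ ℤ.* P) ℤ.* K n a) h) (∑-cong (upTo (suc h)) (λ i → ≡.trans
          (cong (λ z → + (h C i) ℤ.* ((+ N) ℤ.^ (h ℕ.∸ i) ℤ.* z)) (≡.trans (^-*ℤ (-1ℤ ℤ.* P) (K n a) i) (cong (ℤ._* K n a ℤ.^ i) (^-*ℤ -1ℤ P i))))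
          (rearrange (+ (h C i)) ((+ N) ℤ.^ (h ℕ.∸ i)) (signℤ i) (P ℤ.^ i) (K n a ℤ.^ i)))))

    -- The term i = h of the expansion is the wanted moment with sign (-1)^h. Isolating it and
    -- multiplying by (-1)^h produces the signs (-1)^(h+i+1) and (-1)^(h+i).
    moment-recursion : ∀ h → 1 ℕ.≤ h →
      Q ℤ.^ ((suc n C 2) ℕ.* h) ℤ.* MK n h
        ≡ sumℤ (map (λ i → (-1ℤ ℤ.^ (h ℕ.+ i ℕ.+ 1)) ℤ.* (+ (h C i)) ℤ.* ((+ N) ℤ.^ (h ℕ.∸ i))
                             ℤ.* (Q ℤ.^ ((suc n C 2) ℕ.* i)) ℤ.* MK n i) (upTo h))
          ℤ.+ Q ℤ.* sumℤ (map (λ i → (-1ℤ ℤ.^ (h ℕ.+ i)) ℤ.* (+ Cw i) ℤ.* innerSum (suc n) h i) (fromTo 0 (N ℕ.⊓ h)))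
    moment-recursion h 1≤h = ≡.sym (begin
      ∑ (upTo h) (λ i → (-1ℤ ℤ.^ (h ℕ.+ i ℕ.+ 1)) ℤ.* (+ (h C i)) ℤ.* ((+ N) ℤ.^ (h ℕ.∸ i)) ℤ.* (Q ℤ.^ ((suc n C 2) ℕ.* i)) ℤ.* MK n i)
        ℤ.+ Q ℤ.* ∑ (fromTo 0 (N ℕ.⊓ h)) (λ i → (-1ℤ ℤ.^ (h ℕ.+ i)) ℤ.* (+ Cw i) ℤ.* innerSum (suc n) h i)
        ≡⟨ cong₂ (λ x y → x ℤ.+ Q ℤ.* y)
             (≡.trans (∑-cong (upTo h) lower) (∑-*ˡ (upTo h) (ℤ.- s) (T′ h)))
             (≡.trans (∑-cong (fromTo 0 (N ℕ.⊓ h)) (λ i → ≡.trans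
                 (cong (λ z → z ℤ.* (+ Cw i) ℤ.* innerSum (suc n) h i) (ℤP.^-distribˡ-+-* -1ℤ h i))
                 (assoc₄ s (signℤ i) (+ Cw i) (innerSum (suc n) h i))))
               (∑-*ˡ (fromTo 0 (N ℕ.⊓ h)) s _)) ⟩
      (ℤ.- s) ℤ.* L ℤ.+ Q ℤ.* (s ℤ.* W)
        ≡⟨ rearrange₁ s L Q W ⟩
      s ℤ.* (Q ℤ.* W ℤ.- L)
        ≡⟨ cong (λ z → s ℤ.* (z ℤ.- L)) (≡.trans (≡.sym (moment-expansion h 1≤h)) (∑-upTo-snoc h (T′ h))) ⟩
      s ℤ.* ((L ℤ.+ T′ h h) ℤ.- L)
        ≡⟨ rearrange₂ s L (T′ h h) ⟩
      s ℤ.* T′ h h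
        ≡⟨ cong (λ z → s ℤ.* (z ℤ.* (s ℤ.* P ℤ.^ h) ℤ.* MK n h))
             (cong₂ (λ x y → + x ℤ.* (+ N) ℤ.^ y) (nCn≡1 h) (ℕP.n∸n≡0 h)) ⟩
      s ℤ.* ((1ℤ ℤ.* 1ℤ) ℤ.* (s ℤ.* P ℤ.^ h) ℤ.* MK n h)
        ≡⟨ rearrange₃ s (P ℤ.^ h) (MK n h) ⟩
      (s ℤ.* s) ℤ.* (P ℤ.^ h ℤ.* MK n h)
        ≡⟨ ≡.trans (cong (ℤ._* (P ℤ.^ h ℤ.* MK n h)) (-1^-sq h)) (ℤP.*-identityˡ _) ⟩
      P ℤ.^ h ℤ.* MK n h
        ≡⟨ cong (ℤ._* MK n h) (ℤP.^-*-assoc Q (suc n C 2) h) ⟩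
      Q ℤ.^ ((suc n C 2) ℕ.* h) ℤ.* MK n h ∎)
      where
      open ≡-Reasoning
      s L W : ℤ
      s = signℤ h
      L = ∑ (upTo h) (T′ h)
      W = weightedSum (suc n) h
      assoc₄ : ∀ a b c d → (a ℤ.* b) ℤ.* c ℤ.* d ≡ a ℤ.* (b ℤ.* c ℤ.* d)
      assoc₄ = solve-∀
      rearrange₁ : ∀ s l q w → (ℤ.- s) ℤ.* l ℤ.+ q ℤ.* (s ℤ.* w) ≡ s ℤ.* (q ℤ.* w ℤ.- l)
      rearrange₁ = solve-∀
      rearrange₂ : ∀ s l t → s ℤ.* ((l ℤ.+ t) ℤ.- l) ≡ s ℤ.* t
      rearrange₂ = solve-∀
      rearrange₃ : ∀ s p m → s ℤ.* ((1ℤ ℤ.* 1ℤ) ℤ.* (s ℤ.* p) ℤ.* m) ≡ (s ℤ.* s) ℤ.* (p ℤ.* m)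
      rearrange₃ = solve-∀
      rearrange₄ : ∀ s t c m p k → ((s ℤ.* t) ℤ.* -1ℤ) ℤ.* c ℤ.* m ℤ.* p ℤ.* k ≡ (ℤ.- s) ℤ.* ((c ℤ.* m) ℤ.* (t ℤ.* p) ℤ.* k)
      rearrange₄ = solve-∀
      lower : ∀ i → (-1ℤ ℤ.^ (h ℕ.+ i ℕ.+ 1)) ℤ.* (+ (h C i)) ℤ.* ((+ N) ℤ.^ (h ℕ.∸ i)) ℤ.* (Q ℤ.^ ((suc n C 2) ℕ.* i)) ℤ.* MK n i
        ≡ (ℤ.- s) ℤ.* T′ h i
      lower i = ≡.trans (cong₂ (λ x y → x ℤ.* (+ (h C i)) ℤ.* ((+ N) ℤ.^ (h ℕ.∸ i)) ℤ.* y ℤ.* MK n i)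
          (≡.trans (ℤP.^-distribˡ-+-* -1ℤ (h ℕ.+ i) 1) (cong (ℤ._* -1ℤ) (ℤP.^-distribˡ-+-* -1ℤ h i)))
          (≡.sym (ℤP.^-*-assoc Q (suc n C 2) i)))
        (rearrange₄ s (signℤ i) (+ (h C i)) ((+ N) ℤ.^ (h ℕ.∸ i)) (P ℤ.^ i) (MK n i))

-- In the form n + 2 the size makes the truncated subtractions of the statement compute; the parity
-- of n settles the sign in the trace fibres.
two-power : ∀ s → 1 ℕ.≤ s → ∃ λ n → 2 ℕ.^ s ≡ suc (suc n) × -1ℤ ℤ.^ n ≡ 1ℤ
two-power (suc s) _ = go (2 ℕ.^ suc s) (ℕP.^-monoʳ-≤ 2 {1} {suc s} (s≤s z≤n)) even
  where
  even : -1ℤ ℤ.^ (2 ℕ.^ suc s) ≡ 1ℤ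
  even = ≡.trans (≡.sym (ℤP.^-*-assoc -1ℤ 2 (2 ℕ.^ s))) (ℤP.^-zeroˡ (2 ℕ.^ s))
  double : ∀ x → x ≡ -1ℤ ℤ.* (-1ℤ ℤ.* x)
  double = solve-∀
  go : ∀ m → 2 ℕ.≤ m → -1ℤ ℤ.^ m ≡ 1ℤ → ∃ λ n → m ≡ suc (suc n) × -1ℤ ℤ.^ n ≡ 1ℤ
  go (suc (suc n)) _ e = n , refl , ≡.trans (double (-1ℤ ℤ.^ n)) e

open import Data.Nat using (_≤_; _+_; _*_; _∸_; _^_; _⊓_)

theorem1 : (F : FiniteField) (s r : ℕ) → 1 ≤ s → 1 ≤ r → length (FiniteField.elements F) ≡ 2 ^ r →
  let open OverField F r in
  let open Code (2 ^ s) in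
  (∀ (h : ℕ) → 1 ≤ h →
    (+ q) ℤ.^ (((2 ^ s) C 2) * h) ℤ.* MK (2 ^ s ∸ 1) h
      ≡ sumℤ (map (λ i → (-1ℤ ℤ.^ (h + i + 1)) ℤ.* (+ (h C i)) ℤ.* ((+ N) ℤ.^ (h ∸ i))
                           ℤ.* ((+ q) ℤ.^ (((2 ^ s) C 2) * i)) ℤ.* MK (2 ^ s ∸ 1) i)
                  (upTo h))
        ℤ.+ (+ q) ℤ.* sumℤ (map (λ i → (-1ℤ ℤ.^ (h + i)) ℤ.* (+ Cw i)
                                   ℤ.* sumℤ (map (λ t → (+ (t !)) ℤ.* stirling2 h t ℤ.* ((+ 2) ℤ.^ (h ∸ t)) ℤ.* (+ binomNN i t))
                                                 (fromTo i h)))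
                               (fromTo 0 (N ⊓ h))))
  × (∀ (i : ℕ) → i ≤ N → Cw i ≡ CwFormula i)
  × (∀ (β : FiniteField.Carrier F) →
       + nβ β ≡ ((+ q) ℤ.^ (((2 ^ s) C 2) ∸ 1))
                  ℤ.* (prodℤ (map (λ j → ((+ q) ℤ.^ j) ℤ.- 1ℤ) (fromTo 2 (2 ^ s))) ℤ.+ 1ℤ ℤ.+ (+ q) ℤ.* θ β))
theorem1 F s r 1≤s 1≤r |F|≡2^r
  -- The invariance of the Kloosterman sums is abstracted together with `2 ^ s`, so that its
  -- exponent becomes n + 2 at the same time as the goal.
  with 2 ^ s | two-power s 1≤s | (λ m → OverF.K-pow-2^ F r 1≤r |F|≡2^r m s)
... | _ | n , refl , even | Frob =
  moment-recursion (suc n) (Frob (suc n)) , (λ i _ → Cw≡CwFormula (suc (suc n)) i) , nβ-formula n even (Frob (suc n))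
  where open OverF F r 1≤r |F|≡2^r
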